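{- Let $w\in S_n$ avoid the patterns $1432$, $1423$, $13254$, and write $\mathfrak{G}_w(x)=\sum_\alpha c_\alpha x^\alpha$ with support $\mathrm{supp}(\mathfrak{G}_w)=\{\alpha\in\mathbb{Z}_{\ge0}^n:c_\alpha\ne0\}$. Then: (1) if $\alpha\in\mathrm{supp}(\mathfrak{G}_w)$ and $|\alpha|<\deg\mathfrak{G}_w$, there exists $\beta\in\mathrm{supp}(\mathfrak{G}_w)$ with $\alpha<\beta$ and $|\beta|=|\alpha|+1$; (2) $\mathrm{supp}(\mathfrak{G}_w)$ is closed under taking intervals: if $\alpha,\gamma\in\mathrm{supp}(\mathfrak{G}_w)$ and $\beta\in\mathbb{Z}^n$ with $\alpha\le\beta\le\gamma$, then $\beta\in\mathrm{supp}(\mathfrak{G}_w)$; (3) $\mathfrak{G}_w$ has saturated Newton polytope, i.e. $\mathrm{Newton}(\mathfrak{G}_w)\cap\mathbb{Z}^n=\mathrm{supp}(\mathfrak{G}_w)$, and $\mathrm{Newton}(\mathfrak{G}_w)$ is a generalized polymatroid; (4) for every $\beta\in\mathrm{supp}(\mathfrak{G}_w)$ with $|\beta|=\deg\mathfrak{G}_w$, $\sum_{\alpha\in\mathrm{supp}(\mathfrak{G}_w),\,\alpha\le\beta}c_\alpha=1$.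
   Context: Grothendieck polynomials: with $\partial_i f=(f-s_if)/(x_i-x_{i+1})$ ($s_i$ swaps $x_i,x_{i+1}$), $\mathfrak{G}_{w_0}=x_1^{n-1}\cdots x_{n-1}$ for $w_0=n(n-1)\cdots1$, and $\mathfrak{G}_w=\partial_i((1-x_{i+1})\mathfrak{G}_{ws_i})$ whenever $w(i)<w(i+1)$. Pattern avoidance: $w$ contains $\tau\in S_k$ if some subsequence $w(i_1),\ldots,w(i_k)$, $i_1<\cdots<i_k$, is order-isomorphic to $\tau$; otherwise it avoids $\tau$. For $\alpha\in\mathbb{Z}^n$, $|\alpha|=\sum_i\alpha_i$; $\alpha\le\beta$ is componentwise comparison and $\alpha<\beta$ means $\alpha\le\beta$, $\alpha\ne\beta$. $\deg\mathfrak{G}_w$ is the maximal $|\alpha|$ over the support. $\mathrm{Newton}(f)=\mathrm{conv}(\mathrm{supp} f)$. A paramodular pair is $(y,z)$, $y,z:2^{[n]}\to\mathbb{R}$ with $y(\emptyset)=z(\emptyset)=0$, $y$ supermodular, $z$ submodular, and $z(I)-y(J)\ge z(I\setminus J)-y(J\setminus I)$ for all $I,J$; a generalized polymatroid is a polytope of the form $\{x\in\mathbb{R}^n: y(I)\le\sum_{i\in I}x_i\le z(I)\ \forall I\subseteq[n]\}$ for a paramodular pair $(y,z)$.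
   Formalization: In (3) the Newton polytope is represented by its rational points (convex combinations with rational weights), and the generalized polymatroid condition is stated on rational vectors with rational-valued y and z instead of real ones. -}

module Defs where

open import Data.Nat as ℕ using (ℕ; zero; suc; _∸_)
open import Data.Nat.Properties using () renaming (_≟_ to _≟ℕ_)
open import Data.Integer as ℤ using (ℤ; +_; -_; 0ℤ; 1ℤ)
open import Data.Rational as ℚ using (ℚ; 0ℚ; 1ℚ)
open import Data.Fin as Fin using (Fin; toℕ; inject₁)
open import Data.Fin.Permutation using (Permutation′; _⟨$⟩ʳ_; _∘ₚ_; transpose)
open import Data.Fin.Subset using (Subset; inside; outside; _∩_; _∪_; _─_) renaming (⊥ to ∅)
open import Data.Vec as Vec using (Vec; []; _∷_; lookup; tabulate; _[_]%=_; _[_]≔_)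
open import Data.Vec.Properties using (≡-dec)
import Data.Vec.Relation.Binary.Pointwise.Inductive as PW
open import Data.List as List using (List; []; _∷_; _++_; upTo; allFin; concatMap)
open import Data.List.Relation.Unary.All using (All)
open import Data.Maybe using (Maybe; just; nothing)
open import Data.Product using (Σ; _×_; _,_; proj₁; proj₂)
open import Relation.Nullary using (¬_; yes; no)
open import Relation.Binary.PropositionalEquality using (_≡_; _≢_)
open import Function.Bundles using (_⇔_)

-- Polynomials in x_1..x_n with integer coefficients, as formal sums of
-- terms c·x^α (not normalised; the coefficient of x^α is the sum of the
-- coefficients of all terms with exponent α).

Exp : ℕ → Set
Exp n = Vec ℕ n

Poly : ℕ → Set
Poly n = List (Exp n × ℤ)

coeff : ∀ {n} → Poly n → Exp n → ℤ
coeff [] α = 0ℤ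
coeff ((β , c) ∷ p) α with ≡-dec _≟ℕ_ β α
... | yes _ = c ℤ.+ coeff p α
... | no  _ = coeff p α

InSupp : ∀ {n} → Poly n → Exp n → Set
InSupp f α = coeff f α ≢ 0ℤ

∣_∣ : ∀ {n} → Exp n → ℕ
∣ α ∣ = Vec.sum α

-- deg f = max { |α| : α ∈ supp f }  (0 for the zero polynomial)
degree : ∀ {n} → Poly n → ℕ
degree f = go f
  where
  go : _ → ℕ
  go [] = 0
  go ((β , _) ∷ p) with coeff f β ℤ.≟ 0ℤ
  ... | yes _ = go p
  ... | no  _ = ℕ._⊔_ ∣ β ∣ (go p)

_≤ᵥ_ : ∀ {n} → Exp n → Exp n → Set
α ≤ᵥ β = PW.Pointwise ℕ._≤_ α β

_<ᵥ_ : ∀ {n} → Exp n → Exp n → Set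
α <ᵥ β = (α ≤ᵥ β) × (α ≢ β)

_≤ℤᵥ_ : ∀ {n} → Vec ℤ n → Vec ℤ n → Set
α ≤ℤᵥ β = PW.Pointwise ℤ._≤_ α β

toℤᵥ : ∀ {n} → Exp n → Vec ℤ n
toℤᵥ = Vec.map +_

InSuppℤ : ∀ {n} → Poly n → Vec ℤ n → Set
InSuppℤ {n} f β = Σ (Exp n) λ α → (toℤᵥ α ≡ β) × InSupp f α

oneMinus : ∀ {n} → Fin n → Poly n → Poly n
oneMinus j p = p ++ List.map (λ t → (proj₁ t [ j ]%= suc) , ℤ.- proj₂ t) p

-- divided difference ∂ (for the variables x_i, x_j, j = i+1) on a term:
-- (x^α - s(x^α))/(x_i - x_j); with a = α_i, b = α_j this is
--   Σ_{k<a-b} x^{α[i:=b+k, j:=a-1-k]}        if a > b,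
--  -Σ_{k<b-a} x^{α[i:=a+k, j:=b-1-k]}        if a < b,   and 0 if a = b.
∂term : ∀ {n} → Fin n → Fin n → Exp n × ℤ → Poly n
∂term i j (α , c) =
  List.map (λ k → ((α [ i ]≔ (b ℕ.+ k)) [ j ]≔ (a ∸ 1 ∸ k)) , c) (upTo (a ∸ b))
  ++ List.map (λ k → ((α [ i ]≔ (a ℕ.+ k)) [ j ]≔ (b ∸ 1 ∸ k)) , ℤ.- c) (upTo (b ∸ a))
  where
  a = lookup α i
  b = lookup α j

∂ : ∀ {n} → Fin n → Fin n → Poly n → Poly n
∂ i j = concatMap (∂term i j)

isobaric : ∀ {n} → Fin n → Fin n → Poly n → Poly n
isobaric i j f = ∂ i j (oneMinus j f)

adjacent : (n : ℕ) → List (Fin n × Fin n)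
adjacent zero = []
adjacent (suc m) = List.map (λ k → inject₁ k , Fin.suc k) (allFin m)

firstAscent : ∀ {n} → Permutation′ n → List (Fin n × Fin n) → Maybe (Fin n × Fin n)
firstAscent w [] = nothing
firstAscent w ((i , j) ∷ ps) with (w ⟨$⟩ʳ i) Fin.<? (w ⟨$⟩ʳ j)
... | yes _ = just (i , j)
... | no  _ = firstAscent w ps

staircase : (n : ℕ) → Exp n
staircase n = tabulate (λ k → n ∸ suc (toℕ k))

-- 𝔊_{w0} = x^staircase; 𝔊_w = π_i 𝔊_{w s_i} for the first ascent i of w.
-- (w s_i)(k) = w(s_i(k)); _∘ₚ_ is diagrammatic composition.
grothFuel : ∀ {n} → ℕ → Permutation′ n → Poly n
grothFuel {n} fuel w with firstAscent w (adjacent n)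
... | nothing = (staircase n , 1ℤ) ∷ []
... | just (i , j) with fuel
...   | zero = []
...   | suc f = isobaric i j (grothFuel f (transpose i j ∘ₚ w))

-- at most n(n-1)/2 ≤ n·n steps are needed to reach w0
𝔊 : ∀ {n} → Permutation′ n → Poly n
𝔊 {n} w = grothFuel (n ℕ.* n) w

-- Pattern containment / avoidance; patterns τ ∈ S_k given in one-line
-- notation as vectors (0-indexed values).

Contains : ∀ {n k} → Permutation′ n → Vec (Fin k) k → Set
Contains {n} {k} w τ =
  Σ (Fin k → Fin n) λ ι →
    (∀ a b → a Fin.< b → ι a Fin.< ι b) ×
    (∀ a b → ((w ⟨$⟩ʳ ι a) Fin.< (w ⟨$⟩ʳ ι b)) ⇔ (lookup τ a Fin.< lookup τ b))

Avoids : ∀ {n k} → Permutation′ n → Vec (Fin k) k → Set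
Avoids w τ = ¬ Contains w τ

p1432 : Vec (Fin 4) 4
p1432 = Fin.zero ∷ Fin.fromℕ 3 ∷ Fin.suc (Fin.suc Fin.zero) ∷ Fin.suc Fin.zero ∷ []

p1423 : Vec (Fin 4) 4
p1423 = Fin.zero ∷ Fin.fromℕ 3 ∷ Fin.suc Fin.zero ∷ Fin.suc (Fin.suc Fin.zero) ∷ []

p13254 : Vec (Fin 5) 5
p13254 = Fin.zero ∷ Fin.suc (Fin.suc Fin.zero) ∷ Fin.suc Fin.zero
       ∷ Fin.fromℕ 4 ∷ Fin.suc (Fin.suc (Fin.suc Fin.zero)) ∷ []

toℚᵥ : ∀ {n} → Vec ℤ n → Vec ℚ n
toℚᵥ = Vec.map (λ z → z ℚ./ 1)

ℕtoℚ : ℕ → ℚ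
ℕtoℚ k = (+ k) ℚ./ 1

InNewton : ∀ {n} → Poly n → Vec ℚ n → Set
InNewton {n} f x =
  Σ (List (ℚ × Exp n)) λ ts →
    All (λ t → (0ℚ ℚ.≤ proj₁ t) × InSupp f (proj₂ t)) ts ×
    (List.foldr ℚ._+_ 0ℚ (List.map proj₁ ts) ≡ 1ℚ) ×
    (x ≡ List.foldr (λ t acc → Vec.zipWith ℚ._+_
                        (Vec.map (λ a → proj₁ t ℚ.* ℕtoℚ a) (proj₂ t)) acc)
                    (Vec.replicate n 0ℚ) ts)

sumOver : ∀ {n} → Subset n → Vec ℚ n → ℚ
sumOver I x = Vec.foldr _ ℚ._+_ 0ℚ (Vec.zipWith (λ s a → sel s a) I x)
  where
  sel : _ → ℚ → ℚ
  sel inside a = a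
  sel outside a = 0ℚ

Supermodular : ∀ {n} → (Subset n → ℚ) → Set
Supermodular y = ∀ I J → y I ℚ.+ y J ℚ.≤ y (I ∪ J) ℚ.+ y (I ∩ J)

Submodular : ∀ {n} → (Subset n → ℚ) → Set
Submodular z = ∀ I J → z (I ∪ J) ℚ.+ z (I ∩ J) ℚ.≤ z I ℚ.+ z J

Paramodular : ∀ {n} → (Subset n → ℚ) → (Subset n → ℚ) → Set
Paramodular {n} y z =
  (y ∅ ≡ 0ℚ) × (z ∅ ≡ 0ℚ) ×
  Supermodular y × Submodular z ×
  (∀ I J → z (I ─ J) ℚ.- y (J ─ I) ℚ.≤ z I ℚ.- y J)

IsGenPolymatroid : ∀ {n} → (Vec ℚ n → Set) → Set
IsGenPolymatroid {n} P =
  Σ (Subset n → ℚ) λ y → Σ (Subset n → ℚ) λ z →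
    Paramodular y z ×
    (∀ x → P x ⇔ (∀ I → (y I ℚ.≤ sumOver I x) × (sumOver I x ℚ.≤ z I)))

below : ∀ {n} → Exp n → List (Exp n)
below [] = [] ∷ []
below (b ∷ β) = concatMap (λ a → List.map (a ∷_) (below β)) (upTo (suc b))

{-# OPTIONS --safe #-}
-- For w avoiding the three patterns, 𝔊_w = x^λ P_w, where λ_r = min (w(1), …, w(r)) − 1 and P_w is a
-- probability.  Let the rows carry independent Bernoulli variables, the one of row r with success
-- probability x_r.  The boxes of the Rothe diagram outside its dominant component form blocks, one per
-- column, that occupy disjoint intervals of rows, and P_w is the probability that every initial
-- segment of every block contains at least as many successes as boxes.
--
-- The formula is carried from w₀ down along first ascents, which do not leave the class of avoiding
-- permutations.  In terms of a function φ of the Bernoulli variables (u, v) of rows i and i + 1, the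
-- isobaric operator acts by π_i (x_i φ) = φ (u ∨ v, u ∧ v) and, if φ depends on v only, by
-- π_i (x_i² φ) = (u ∨ v) φ (u ∧ v); avoidance says that no other power of x_i occurs.
--
-- Within a block the coefficients alternate in sign with the degree and vanish only at infeasible
-- vectors, so the support consists of λ plus the feasible 0/1 vectors, an interval-closed set; the sum
-- of all coefficients is P_w (1, …, 1) = 1.  The support is cut out by bounds on sums over intervals of
-- rows, hence systematic sampling, i.e. rounding the partial sums of a rational point after a shift,
-- writes each point of the polytope as an average of support points.
module Submission where

open import Defs

-- Where the two powers of x_i and the three patterns come from: up to a first ascent i the values
-- of w decrease, so w(i) is the least of them. Before π_i is applied, the exponent of x_i in x^λ
-- exceeds that of x_{i+1} by the gap from w(i) to the least of the first i entries of w s_i. Every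
-- value strictly inside this gap is taken after row i + 1 and lies below w(i + 1), so two of them
-- would give 1432 or 1423; the excess is 1 or 2. If it is 2, P must not involve the variable of row
-- i; 13254, together with the other two patterns, ensures that row i lies in no block, and the
-- value inside the gap becomes the first box of a new block. π_i is never evaluated: x_i - x_{i+1}
-- is not a zero divisor, so checking a relation between coefficient functions is enough. For the
-- support the obstacle is cancellation in a saturated block, one whose surplus covers all its
-- remaining boxes: it contributes the factor 1, and only its minimal exponents survive. Inside a
-- block, feasible and nonzero therefore differ; they agree while boxes remain unpaid, because the
-- last row of a block carries a box.

-- Linear inequalities over the integers, certified by ring identities.

module LinearInequalities where

  open import Data.Integer as ℤ using (ℤ; 0ℤ; 1ℤ; _+_; _-_; -_; _*_; _≤_)
  import Data.Integer.Properties as ℤ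
  open import Data.Integer.Tactic.RingSolver using (solve)
  open import Data.List using (_∷_; [])
  open import Relation.Binary.PropositionalEquality

  -- A certificate for a linear inequality: its slack `d - c` is the sum of the slacks of the
  -- hypotheses, so only a ring identity is left to check. Every hypothesis enters with coefficient
  -- 1.
  by₁ : ∀ {a b c d} → a ≤ b → d - c ≡ b - a → c ≤ d
  by₁ p e = ℤ.0≤i-j⇒j≤i (subst (0ℤ ≤_) (sym e) (ℤ.i≤j⇒0≤j-i p))

  by₂ : ∀ {a b a′ b′ c d} → a ≤ b → a′ ≤ b′ → d - c ≡ (b - a) + (b′ - a′) → c ≤ d
  by₂ p q e = ℤ.0≤i-j⇒j≤i (subst (0ℤ ≤_) (sym e) (ℤ.+-mono-≤ (ℤ.i≤j⇒0≤j-i p) (ℤ.i≤j⇒0≤j-i q)))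

  by₃ : ∀ {a b a′ b′ a″ b″ c d} → a ≤ b → a′ ≤ b′ → a″ ≤ b″ →
        d - c ≡ (b - a) + (b′ - a′) + (b″ - a″) → c ≤ d
  by₃ p q r e = ℤ.0≤i-j⇒j≤i (subst (0ℤ ≤_) (sym e)
    (ℤ.+-mono-≤ (ℤ.+-mono-≤ (ℤ.i≤j⇒0≤j-i p) (ℤ.i≤j⇒0≤j-i q)) (ℤ.i≤j⇒0≤j-i r)))

  lower-+ : ∀ τ τ′ l x y → τ * l ≤ x → τ′ * l ≤ y → (τ + τ′) * l ≤ x + y
  lower-+ τ τ′ l x y p q = by₂ p q (solve (τ ∷ τ′ ∷ l ∷ x ∷ y ∷ []))

  upper-+ : ∀ τ τ′ l w x y → x ≤ τ * l + τ * w → y ≤ τ′ * l + τ′ * w → x + y ≤ (τ + τ′) * l + (τ + τ′) * w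
  upper-+ τ τ′ l w x y p q = by₂ p q (solve (τ ∷ τ′ ∷ l ∷ w ∷ x ∷ y ∷ []))

  upper-digit : ∀ u w l → u ≤ w → u + l ≤ 1ℤ * l + 1ℤ * w
  upper-digit u w l p = by₁ p (solve (u ∷ w ∷ l ∷ []))

  upper-in : ∀ τ x l w low wid X → x ≤ τ * l + τ * w → X ≤ τ * (low + wid) →
             x + X ≤ τ * ((l + low) + (w + wid))
  upper-in τ x l w low wid X p q = by₂ p q (solve (τ ∷ x ∷ l ∷ w ∷ low ∷ wid ∷ X ∷ []))

  upper-out : ∀ τ low wid X → X ≤ τ * (low + wid) → 0ℤ + X ≤ τ * ((0ℤ + low) + (0ℤ + wid))
  upper-out τ low wid X q = by₁ q (solve (τ ∷ low ∷ wid ∷ X ∷ []))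

  unit-digit : ∀ τ x l w → x ≤ τ * l + τ * w → τ * w ≤ τ * 1ℤ → x - τ * l ≤ τ
  unit-digit τ x l w p q = by₂ p q (solve (τ ∷ x ∷ l ∷ w ∷ []))

  digit-in : ∀ τ x l → x - τ * l ≤ x - τ * l + τ * 0ℤ
  digit-in τ x l = ℤ.≤-reflexive (solve (x ∷ τ ∷ l ∷ []))

  digit-out : ∀ τ u → u ≤ τ → u ≤ 0ℤ - τ * 0ℤ + τ * 1ℤ
  digit-out τ u p = by₁ p (solve (u ∷ τ ∷ []))

  lower-zero : ∀ τ B s low R → τ * (low + R) ≤ B → 0ℤ ≤ s → τ * (low + (R + 0ℤ)) ≤ B + s
  lower-zero τ B s low R p q = by₂ p q (solve (τ ∷ B ∷ s ∷ low ∷ R ∷ []))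

  lower-extend : ∀ τ li low R xi X → τ * (low + R) ≤ X → τ * li ≤ xi → τ * (li + low + R) ≤ xi + X
  lower-extend τ li low R xi X p q = by₂ p q (solve (τ ∷ li ∷ low ∷ R ∷ xi ∷ X ∷ []))

  lower-extend₀ : ∀ τ li low R xi X → τ * (low + R) ≤ X + 0ℤ → τ * li ≤ xi → τ * (li + low + R) ≤ xi + X
  lower-extend₀ τ li low R xi X p q = by₂ p q (solve (τ ∷ li ∷ low ∷ R ∷ xi ∷ X ∷ []))

  lower-open : ∀ τ s x li l low R M b o xi X → τ * (low + (R + M)) ≤ X + (s + (x - τ * l) - τ * b) →
    x - τ * l ≤ xi - τ * li + τ * o → τ * (li + low + (R + (b - o + M))) ≤ xi + X + s
  lower-open τ s x li l low R M b o xi X p q =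
    by₂ p q (solve (τ ∷ s ∷ x ∷ li ∷ l ∷ low ∷ R ∷ M ∷ b ∷ o ∷ xi ∷ X ∷ []))

  lower-close : ∀ τ s x li l low R b o xi X → τ * (low + R) ≤ X + 0ℤ → 0ℤ ≤ s + (x - τ * l) - τ * b →
    x - τ * l ≤ xi - τ * li + τ * o → τ * (li + low + (R + (b - o + 0ℤ))) ≤ xi + X + s
  lower-close τ s x li l low R b o xi X p q r =
    by₃ p q r (solve (τ ∷ s ∷ x ∷ li ∷ l ∷ low ∷ R ∷ b ∷ o ∷ xi ∷ X ∷ []))

  single-lower : ∀ τ x l → τ * (l + 0ℤ + 0ℤ) ≤ x + 0ℤ → τ * l ≤ x
  single-lower τ x l p = by₁ p (solve (τ ∷ x ∷ l ∷ []))

  single-upper : ∀ τ x l w → x + 0ℤ ≤ τ * (l + 0ℤ + (w + 0ℤ)) → x ≤ τ * l + τ * w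
  single-upper τ x l w p = by₁ p (solve (τ ∷ x ∷ l ∷ w ∷ []))

  single-surplus : ∀ τ s x l b M → τ * (l + 0ℤ + (0ℤ + M)) ≤ x + 0ℤ + s → τ * b ≤ τ * M → 0ℤ ≤ s + (x - τ * l) - τ * b
  single-surplus τ s x l b M p q = by₂ p q (solve (τ ∷ s ∷ x ∷ l ∷ b ∷ M ∷ []))

  tail-open : ∀ τ s x l low R M b N X → τ * (l + low + (R + N)) ≤ x + X + s → τ * (b + M) ≤ τ * N →
              τ * (low + (R + M)) ≤ X + (s + (x - τ * l) - τ * b)
  tail-open τ s x l low R M b N X p q = by₂ p q (solve (τ ∷ s ∷ x ∷ l ∷ low ∷ R ∷ M ∷ b ∷ N ∷ X ∷ []))

  tail-upper : ∀ τ low wid X → 0ℤ + X ≤ τ * ((0ℤ + low) + (0ℤ + wid)) → X ≤ τ * (low + wid)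
  tail-upper τ low wid X p = by₁ p (solve (τ ∷ low ∷ wid ∷ X ∷ []))

  tail-lower : ∀ τ low R X → τ * (0ℤ + low + R) ≤ 0ℤ + X → τ * (low + R) ≤ X
  tail-lower τ low R X p = by₁ p (solve (τ ∷ low ∷ R ∷ X ∷ []))

  tail-close : ∀ τ low R X → τ * (0ℤ + low + R) ≤ 0ℤ + X → τ * (low + R) ≤ X + 0ℤ
  tail-close τ low R X p = by₁ p (solve (τ ∷ low ∷ R ∷ X ∷ []))

  drop-nonneg : ∀ τ low R M X → τ * (low + (R + M)) ≤ X → 0ℤ ≤ τ * M → τ * (low + R) ≤ X
  drop-nonneg τ low R M X p q = by₂ p q (solve (τ ∷ low ∷ R ∷ M ∷ X ∷ []))

  deficit-arg-mono : ∀ b o o′ m m′ → o′ ≤ o → m ≤ m′ → b - o + m ≤ b - o′ + m′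
  deficit-arg-mono b o o′ m m′ p q = by₂ p q (solve (b ∷ o ∷ o′ ∷ m ∷ m′ ∷ []))

  deficit-arg-super : ∀ b o₁ o₂ o₃ o₄ m₁ m₂ m₃ m₄ → o₃ + o₄ ≤ o₁ + o₂ → m₁ + m₂ ≤ m₃ + m₄ →
    (b - o₁ + m₁) + (b - o₂ + m₂) ≤ (b - o₃ + m₃) + (b - o₄ + m₄)
  deficit-arg-super b o₁ o₂ o₃ o₄ m₁ m₂ m₃ m₄ p q =
    by₂ p q (solve (b ∷ o₁ ∷ o₂ ∷ o₃ ∷ o₄ ∷ m₁ ∷ m₂ ∷ m₃ ∷ m₄ ∷ []))

  super-+ : ∀ r₁ r₂ r₃ r₄ m₁ m₂ m₃ m₄ → r₁ + r₂ ≤ r₃ + r₄ → m₁ + m₂ ≤ m₃ + m₄ →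
    (r₁ + m₁) + (r₂ + m₂) ≤ (r₃ + m₃) + (r₄ + m₄)
  super-+ r₁ r₂ r₃ r₄ m₁ m₂ m₃ m₄ p q = by₂ p q (solve (r₁ ∷ r₂ ∷ r₃ ∷ r₄ ∷ m₁ ∷ m₂ ∷ m₃ ∷ m₄ ∷ []))

  lipschitz-arg : ∀ b o o′ m m′ → b - o + m ≡ b - o′ + m′ + ((o′ - o) + (m - m′))
  lipschitz-arg b o o′ m m′ = solve (b ∷ o ∷ o′ ∷ m ∷ m′ ∷ [])

  cross-open : ∀ R R′ M M′ W W′ N N′ o o′ w w′ → R + M + W ≤ R′ + M′ + W′ → N ≤ N′ + ((o′ - o) + (M - M′)) →
    o′ - o + w ≤ w′ → R + N + (w + W) ≤ R′ + N′ + (w′ + W′)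
  cross-open R R′ M M′ W W′ N N′ o o′ w w′ p q r =
    by₃ p q r (solve (R ∷ R′ ∷ M ∷ M′ ∷ W ∷ W′ ∷ N ∷ N′ ∷ o ∷ o′ ∷ w ∷ w′ ∷ []))

  cross-close : ∀ R R′ W W′ N N′ w w′ → R + W ≤ R′ + W′ → N + w ≤ N′ + w′ → R + N + (w + W) ≤ R′ + N′ + (w′ + W′)
  cross-close R R′ W W′ N N′ w w′ p q = by₂ p q (solve (R ∷ R′ ∷ W ∷ W′ ∷ N ∷ N′ ∷ w ∷ w′ ∷ []))

  cross-bounds : ∀ lI lJ lH lK wI wH yJ yK → lH + lJ ≤ lK + lI → yJ + wH ≤ yK + wI →
    (lH + wH) - (lK + yK) ≤ (lI + wI) - (lJ + yJ)
  cross-bounds lI lJ lH lK wI wH yJ yK p q = by₂ p q (solve (lI ∷ lJ ∷ lH ∷ lK ∷ wI ∷ wH ∷ yJ ∷ yK ∷ []))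

open import Data.Bool using (Bool; true; false; _∨_; _∧_; if_then_else_)
open import Data.Nat as ℕ using (ℕ; zero; suc; _∸_; z≤n; s≤s; z<s; s<s; _<ᵇ_; _≡ᵇ_; NonZero)
import Data.Nat.Properties as ℕ
open import Data.Integer as ℤ using (ℤ; 0ℤ; 1ℤ)
import Data.Integer.Properties as ℤ
open import Data.Fin as Fin using (Fin; zero; suc; inject₁; toℕ)
import Data.Fin.Properties as Fin
open import Data.Vec as Vec using (Vec; []; _∷_; tabulate; lookup; zipWith; replicate)
open import Data.Vec.Relation.Binary.Pointwise.Inductive as PW using (Pointwise; []; _∷_)
open import Data.Maybe using (Maybe; just; nothing)
open import Data.Product using (Σ; ∃; _×_; _,_; proj₁; proj₂)
open import Data.Sum using (_⊎_; inj₁; inj₂)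
open import Function using (_∘_)
open import Function.Bundles using (_⇔_; mk⇔)
open import Relation.Nullary using (¬_; Dec; yes; no; does; contradiction)
open import Relation.Binary.PropositionalEquality

-- Divided differences and isobaric operators on coefficient functions.

module DividedDifferences where

  open import Data.Integer using (_+_; _-_; -_)
  open import Data.Integer.Tactic.RingSolver using (solve-∀)
  open import Data.Vec using (_[_]%=_)
  open import Data.Vec.Properties using (≡-dec)
  open import Data.List as List using (List; []; _∷_; _++_; upTo; applyUpTo)
  import Data.List.Properties as List

  Coeffs : ℕ → Set
  Coeffs n = Exp n → ℤ

  monomial : ∀ {n} → Exp n → ℤ → Coeffs n
  monomial [] c [] = c
  monomial (b ∷ β) c (a ∷ α) = if b ≡ᵇ a then monomial β c α else 0ℤ

  ≡ᵇ-refl : ∀ a → (a ≡ᵇ a) ≡ true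
  ≡ᵇ-refl zero = refl
  ≡ᵇ-refl (suc a) = ≡ᵇ-refl a

  monomial-refl : ∀ {n} (β : Exp n) c → monomial β c β ≡ c
  monomial-refl [] c = refl
  monomial-refl (b ∷ β) c rewrite ≡ᵇ-refl b = monomial-refl β c

  monomial-≢ : ∀ {n} (β α : Exp n) c → β ≢ α → monomial β c α ≡ 0ℤ
  monomial-≢ [] [] c ne = contradiction refl ne
  monomial-≢ (b ∷ β) (a ∷ α) c ne with b ≡ᵇ a | ℕ.≡ᵇ⇒≡ b a
  ... | false | _ = refl
  ... | true | b≡a = monomial-≢ β α c (λ e → ne (cong₂ _∷_ (b≡a _) e))

  monomial-neg : ∀ {n} (β α : Exp n) c → monomial β (- c) α ≡ - monomial β c α
  monomial-neg [] [] c = refl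
  monomial-neg (b ∷ β) (a ∷ α) c with b ≡ᵇ a
  ... | true = monomial-neg β α c
  ... | false = refl

  coeff-∷ : ∀ {n} (β : Exp n) c p α → coeff ((β , c) ∷ p) α ≡ monomial β c α + coeff p α
  coeff-∷ β c p α with ≡-dec ℕ._≟_ β α
  ... | yes refl = cong (_+ coeff p α) (sym (monomial-refl β c))
  ... | no ne = trans (sym (ℤ.+-identityˡ _)) (cong (_+ coeff p α) (sym (monomial-≢ β α c ne)))

  coeff-++ : ∀ {n} (p q : Poly n) α → coeff (p ++ q) α ≡ coeff p α + coeff q α
  coeff-++ [] q α = sym (ℤ.+-identityˡ _)
  coeff-++ ((β , c) ∷ p) q α = begin
    coeff ((β , c) ∷ p ++ q) α                 ≡⟨ coeff-∷ β c (p ++ q) α ⟩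
    monomial β c α + coeff (p ++ q) α          ≡⟨ cong (monomial β c α +_) (coeff-++ p q α) ⟩
    monomial β c α + (coeff p α + coeff q α)   ≡⟨ ℤ.+-assoc (monomial β c α) _ _ ⟨
    monomial β c α + coeff p α + coeff q α     ≡⟨ cong (_+ coeff q α) (coeff-∷ β c p α) ⟨
    coeff ((β , c) ∷ p) α + coeff q α          ∎
    where open ≡-Reasoning

  -- Multiplication by the variable, for the coefficient sequence of a power series in one variable.
  raise : (ℕ → ℤ) → ℕ → ℤ
  raise g zero = 0ℤ
  raise g (suc p) = g p

  raise-cong : ∀ {g h : ℕ → ℤ} → g ≗ h → raise g ≗ raise h
  raise-cong e zero = refl
  raise-cong e (suc p) = e p

  mulx : ∀ {n} → Fin n → Coeffs n → Coeffs n
  mulx zero X (p ∷ α) = raise (λ p′ → X (p′ ∷ α)) p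
  mulx (suc j) X (a ∷ α) = mulx j (X ∘ (a ∷_)) α

  mulx-cong : ∀ {n} (j : Fin n) {X Y : Coeffs n} → X ≗ Y → mulx j X ≗ mulx j Y
  mulx-cong zero e (p ∷ α) = raise-cong (λ p′ → e (p′ ∷ α)) p
  mulx-cong (suc j) e (a ∷ α) = mulx-cong j (e ∘ (a ∷_)) α

  mulx-0 : ∀ {n} (j : Fin n) α → mulx j (λ _ → 0ℤ) α ≡ 0ℤ
  mulx-0 zero (zero ∷ α) = refl
  mulx-0 zero (suc p ∷ α) = refl
  mulx-0 (suc j) (a ∷ α) = mulx-0 j α

  mulx-+ : ∀ {n} (j : Fin n) (X Y : Coeffs n) α →
           mulx j (λ β → X β + Y β) α ≡ mulx j X α + mulx j Y α
  mulx-+ zero X Y (zero ∷ α) = refl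
  mulx-+ zero X Y (suc p ∷ α) = refl
  mulx-+ (suc j) X Y (a ∷ α) = mulx-+ j _ _ α

  mulx-- : ∀ {n} (j : Fin n) (X Y : Coeffs n) α →
           mulx j (λ β → X β - Y β) α ≡ mulx j X α - mulx j Y α
  mulx-- zero X Y (zero ∷ α) = refl
  mulx-- zero X Y (suc p ∷ α) = refl
  mulx-- (suc j) X Y (a ∷ α) = mulx-- j _ _ α

  mulx-monomial : ∀ {n} (j : Fin n) β c (α : Exp n) →
                  mulx j (monomial β c) α ≡ monomial (β [ j ]%= suc) c α
  mulx-monomial zero (b ∷ β) c (zero ∷ α) = refl
  mulx-monomial zero (b ∷ β) c (suc a ∷ α) = refl
  mulx-monomial (suc j) (b ∷ β) c (a ∷ α) with b ≡ᵇ a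
  ... | true = mulx-monomial j β c α
  ... | false = mulx-0 j α

  coeff-oneMinus : ∀ {n} (j : Fin n) f α →
                   coeff (oneMinus j f) α ≡ coeff f α - mulx j (coeff f) α
  coeff-oneMinus j f α =
    trans (coeff-++ f _ α) (cong (coeff f α +_) (go f))
    where
    term : _ → _
    term t = (proj₁ t [ j ]%= suc) , - proj₂ t
    go : ∀ f → coeff (List.map term f) α ≡ - mulx j (coeff f) α
    go [] = sym (cong -_ (mulx-0 j α))
    go ((β , c) ∷ f) = begin
      coeff (List.map term ((β , c) ∷ f)) α
        ≡⟨ coeff-∷ (β [ j ]%= suc) (- c) _ α ⟩
      monomial (β [ j ]%= suc) (- c) α + coeff (List.map term f) α
        ≡⟨ cong₂ _+_ (monomial-neg (β [ j ]%= suc) α c) (go f) ⟩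
      - monomial (β [ j ]%= suc) c α + - mulx j (coeff f) α
        ≡⟨ cong (λ z → - z + - mulx j (coeff f) α) (mulx-monomial j β c α) ⟨
      - mulx j (monomial β c) α + - mulx j (coeff f) α
        ≡⟨ ℤ.neg-distrib-+ (mulx j (monomial β c) α) _ ⟨
      - (mulx j (monomial β c) α + mulx j (coeff f) α)
        ≡⟨ cong -_ (mulx-+ j _ _ α) ⟨
      - mulx j (λ γ → monomial β c γ + coeff f γ) α
        ≡⟨ cong -_ (mulx-cong j (coeff-∷ β c f) α) ⟨
      - mulx j (coeff ((β , c) ∷ f)) α ∎
      where open ≡-Reasoning

  swapAt : ∀ {m} → Fin m → Exp (suc m) → Exp (suc m)
  swapAt zero (p ∷ q ∷ α) = q ∷ p ∷ α
  swapAt (suc k) (a ∷ α) = a ∷ swapAt k α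

  -- W = ∂_k X, expressed as (x_k − x_{k+1}) W = X − s_k X.
  record IsDivDiff {m} (k : Fin m) (X W : Coeffs (suc m)) : Set where
    constructor divDiff
    field
      at : ∀ γ → mulx (inject₁ k) W γ - mulx (suc k) W γ ≡ X γ - X (swapAt k γ)

  open IsDivDiff

  interchange : ∀ a b c d → (a + b) - (c + d) ≡ (a - c) + (b - d)
  interchange = solve-∀

  interchange- : ∀ a b c d → (a - b) - (c - d) ≡ (a - c) - (b - d)
  interchange- = solve-∀

  IsDivDiff-cong : ∀ {m} (k : Fin m) {X X′ W W′ : Coeffs (suc m)} → X ≗ X′ → W ≗ W′ →
                   IsDivDiff k X W → IsDivDiff k X′ W′
  IsDivDiff-cong k eX eW D = divDiff λ γ →
    trans (sym (cong₂ _-_ (mulx-cong (inject₁ k) eW γ) (mulx-cong (suc k) eW γ)))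
          (trans (at D γ) (cong₂ _-_ (eX γ) (eX (swapAt k γ))))

  IsDivDiff-0 : ∀ {m} (k : Fin m) → IsDivDiff k (λ _ → 0ℤ) (λ _ → 0ℤ)
  IsDivDiff-0 k = divDiff λ γ → cong₂ _-_ (mulx-0 (inject₁ k) γ) (mulx-0 (suc k) γ)

  IsDivDiff-+ : ∀ {m} (k : Fin m) {X Y W V : Coeffs (suc m)} →
                IsDivDiff k X W → IsDivDiff k Y V →
                IsDivDiff k (λ α → X α + Y α) (λ α → W α + V α)
  IsDivDiff-+ k {X} {Y} {W} {V} D E = divDiff λ γ → begin
    mulx (inject₁ k) (λ α → W α + V α) γ - mulx (suc k) (λ α → W α + V α) γ
      ≡⟨ cong₂ _-_ (mulx-+ (inject₁ k) W V γ) (mulx-+ (suc k) W V γ) ⟩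
    (mulx (inject₁ k) W γ + mulx (inject₁ k) V γ) - (mulx (suc k) W γ + mulx (suc k) V γ)
      ≡⟨ interchange (mulx (inject₁ k) W γ) _ (mulx (suc k) W γ) _ ⟩
    (mulx (inject₁ k) W γ - mulx (suc k) W γ) + (mulx (inject₁ k) V γ - mulx (suc k) V γ)
      ≡⟨ cong₂ _+_ (at D γ) (at E γ) ⟩
    (X γ - X (swapAt k γ)) + (Y γ - Y (swapAt k γ))
      ≡⟨ interchange (X γ) _ (X (swapAt k γ)) _ ⟨
    (X γ + Y γ) - (X (swapAt k γ) + Y (swapAt k γ)) ∎
    where open ≡-Reasoning

  IsDivDiff-- : ∀ {m} (k : Fin m) {X Y W V : Coeffs (suc m)} →
                IsDivDiff k X W → IsDivDiff k Y V →
                IsDivDiff k (λ α → X α - Y α) (λ α → W α - V α)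
  IsDivDiff-- k {X} {Y} {W} {V} D E = divDiff λ γ → begin
    mulx (inject₁ k) (λ α → W α - V α) γ - mulx (suc k) (λ α → W α - V α) γ
      ≡⟨ cong₂ _-_ (mulx-- (inject₁ k) W V γ) (mulx-- (suc k) W V γ) ⟩
    (mulx (inject₁ k) W γ - mulx (inject₁ k) V γ) - (mulx (suc k) W γ - mulx (suc k) V γ)
      ≡⟨ interchange- (mulx (inject₁ k) W γ) _ (mulx (suc k) W γ) _ ⟩
    (mulx (inject₁ k) W γ - mulx (suc k) W γ) - (mulx (inject₁ k) V γ - mulx (suc k) V γ)
      ≡⟨ cong₂ _-_ (at D γ) (at E γ) ⟩
    (X γ - X (swapAt k γ)) - (Y γ - Y (swapAt k γ))
      ≡⟨ interchange- (X γ) _ (X (swapAt k γ)) _ ⟨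
    (X γ - Y γ) - (X (swapAt k γ) - Y (swapAt k γ)) ∎
    where open ≡-Reasoning

  -- x_k − x_{k+1} is not a zero divisor.
  diff-cancel : ∀ {m} (k : Fin m) (V : Coeffs (suc m)) →
                (∀ γ → mulx (inject₁ k) V γ ≡ mulx (suc k) V γ) → ∀ γ → V γ ≡ 0ℤ
  diff-cancel zero V h (p ∷ q ∷ α) = go p q
    where
    go : ∀ p q → V (p ∷ q ∷ α) ≡ 0ℤ
    go p zero = h (suc p ∷ zero ∷ α)
    go p (suc q) = trans (h (suc p ∷ suc q ∷ α)) (go (suc p) q)
  diff-cancel (suc k) V h (a ∷ γ) = diff-cancel k (V ∘ (a ∷_)) (λ γ → h (a ∷ γ)) γ

  IsDivDiff-unique : ∀ {m} (k : Fin m) {X W V : Coeffs (suc m)} →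
                     IsDivDiff k X W → IsDivDiff k X V → W ≗ V
  IsDivDiff-unique k {X} {W} {V} D E γ =
    ℤ.i-j≡0⇒i≡j (W γ) (V γ) (diff-cancel k (λ α → W α - V α) h γ)
    where
    open ≡-Reasoning
    h : ∀ γ → mulx (inject₁ k) (λ α → W α - V α) γ ≡ mulx (suc k) (λ α → W α - V α) γ
    h γ = ℤ.i-j≡0⇒i≡j _ _ (trans (at (IsDivDiff-- k D E) γ) (cancel-both (X γ) (X (swapAt k γ))))
      where
      cancel-both : ∀ x y → (x - x) - (y - y) ≡ 0ℤ
      cancel-both = solve-∀

  -- The geometric sum x^u y^v (x^d - y^d)/(x - y). The recursion keeps truncated subtraction out of
  -- the exponents.
  ladder : ∀ {n} → ℕ → ℕ → ℕ → Exp n → ℤ → Poly (suc (suc n))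
  ladder zero u v α c = []
  ladder (suc d) u v α c = (u ∷ d ℕ.+ v ∷ α , c) ∷ ladder d (suc u) v α c

  map-upTo-ladder : ∀ {n} d u v (α : Exp n) c →
    List.map (λ k → (u ℕ.+ k ∷ d ℕ.+ v ∸ 1 ∸ k ∷ α) , c) (upTo d) ≡ ladder d u v α c
  map-upTo-ladder d u v α c =
    trans (List.map-upTo _ d) (go d u _ (λ _ → refl))
    where
    go : ∀ d u (g : ℕ → _) → (∀ k → g k ≡ ((u ℕ.+ k ∷ d ℕ.+ v ∸ 1 ∸ k ∷ α) , c)) →
         applyUpTo g d ≡ ladder d u v α c
    go zero u g e = refl
    go (suc d) u g e =
      cong₂ _∷_
        (trans (e 0) (cong (λ z → (z ∷ d ℕ.+ v ∷ α) , c) (ℕ.+-identityʳ u)))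
        (go d (suc u) (g ∘ suc) λ k → trans (e (suc k))
          (cong₂ (λ y z → (y ∷ z ∷ α) , c) (ℕ.+-suc u k) (sym (ℕ.∸-+-assoc (d ℕ.+ v) 1 k))))

  -- Multiplication by x - y telescopes: x times one rung cancels against y times the next.
  coeff-ladder : ∀ {n} d u v (α : Exp n) c γ →
    mulx zero (coeff (ladder d u v α c)) γ - mulx (suc zero) (coeff (ladder d u v α c)) γ
    ≡ monomial (u ℕ.+ d ∷ v ∷ α) c γ - monomial (u ∷ d ℕ.+ v ∷ α) c γ
  coeff-ladder zero u v α c γ rewrite ℕ.+-identityʳ u =
    trans (cong₂ _-_ (mulx-0 zero γ) (mulx-0 (suc zero) γ)) (sym (ℤ.+-inverseʳ (monomial (u ∷ v ∷ α) c γ)))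
  coeff-ladder (suc d) u v α c γ rewrite ℕ.+-suc u d = begin
    mulx zero (coeff (t ∷ r)) γ - mulx (suc zero) (coeff (t ∷ r)) γ
      ≡⟨ cong₂ _-_ (split zero) (split (suc zero)) ⟩
    (A + mulx zero (coeff r) γ) - (B + mulx (suc zero) (coeff r) γ)
      ≡⟨ interchange A _ B _ ⟩
    (A - B) + (mulx zero (coeff r) γ - mulx (suc zero) (coeff r) γ)
      ≡⟨ cong ((A - B) +_) (coeff-ladder d (suc u) v α c γ) ⟩
    (A - B) + (monomial (suc u ℕ.+ d ∷ v ∷ α) c γ - A)
      ≡⟨ tele A B (monomial (suc u ℕ.+ d ∷ v ∷ α) c γ) ⟩
    monomial (suc u ℕ.+ d ∷ v ∷ α) c γ - B ∎
    where
    open ≡-Reasoning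
    t = (u ∷ d ℕ.+ v ∷ α , c)
    r = ladder d (suc u) v α c
    A = monomial (suc u ∷ d ℕ.+ v ∷ α) c γ
    B = monomial (u ∷ suc d ℕ.+ v ∷ α) c γ
    tele : ∀ A B C → (A - B) + (C - A) ≡ C - B
    tele = solve-∀
    split : ∀ j → mulx j (coeff (t ∷ r)) γ ≡
            monomial (proj₁ t [ j ]%= suc) c γ + mulx j (coeff r) γ
    split j = trans (mulx-cong j (coeff-∷ (proj₁ t) c r) γ)
              (trans (mulx-+ j (monomial (proj₁ t) c) _ γ) (cong (_+ mulx j (coeff r) γ) (mulx-monomial j (proj₁ t) c γ)))

  monomial-swap : ∀ {n} a b (α : Exp n) c p q γ →
    monomial (a ∷ b ∷ α) c (p ∷ q ∷ γ) ≡ monomial (b ∷ a ∷ α) c (q ∷ p ∷ γ)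
  monomial-swap a b α c p q γ with a ≡ᵇ p | b ≡ᵇ q
  ... | true  | true  = refl
  ... | true  | false = refl
  ... | false | true  = refl
  ... | false | false = refl

  coeff-map-∷ : ∀ {n} a (p : Poly n) b γ →
    coeff (List.map (λ t → (a ∷ proj₁ t) , proj₂ t) p) (b ∷ γ) ≡ (if a ≡ᵇ b then coeff p γ else 0ℤ)
  coeff-map-∷ a [] b γ with a ≡ᵇ b
  ... | true = refl
  ... | false = refl
  coeff-map-∷ a ((β , c) ∷ p) b γ =
    trans (coeff-∷ (a ∷ β) c _ (b ∷ γ))
          (trans (cong (monomial (a ∷ β) c (b ∷ γ) +_) (coeff-map-∷ a p b γ)) h)
    where
    h : monomial (a ∷ β) c (b ∷ γ) + (if a ≡ᵇ b then coeff p γ else 0ℤ)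
        ≡ (if a ≡ᵇ b then coeff ((β , c) ∷ p) γ else 0ℤ)
    h with a ≡ᵇ b
    ... | true = sym (coeff-∷ β c p γ)
    ... | false = refl

  ∂term-∷ : ∀ {n} (i j : Fin n) a α c →
    ∂term (suc i) (suc j) (a ∷ α , c) ≡ List.map (λ t → (a ∷ proj₁ t) , proj₂ t) (∂term i j (α , c))
  ∂term-∷ i j a α c =
    sym (trans (List.map-++ _ (List.map _ (upTo (Vec.lookup α i ∸ Vec.lookup α j))) _)
      (cong₂ _++_ (sym (List.map-∘ (upTo (Vec.lookup α i ∸ Vec.lookup α j))))
                  (sym (List.map-∘ (upTo (Vec.lookup α j ∸ Vec.lookup α i))))))

  ∂term-divDiff : ∀ {m} (k : Fin m) α c →
    IsDivDiff k (monomial α c) (coeff (∂term (inject₁ k) (suc k) (α , c)))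
  ∂term-divDiff zero (a ∷ b ∷ α) c with ℕ.≤-total b a
  ... | inj₁ b≤a = divDiff (go (a ∸ b) (sym (ℕ.m∸n+n≡m b≤a)) (ℕ.m≤n⇒m∸n≡0 b≤a))
    where
    go : ∀ d → a ≡ d ℕ.+ b → b ∸ a ≡ 0 → ∀ γ →
         mulx zero (coeff (∂term zero (suc zero) (a ∷ b ∷ α , c))) γ
         - mulx (suc zero) (coeff (∂term zero (suc zero) (a ∷ b ∷ α , c))) γ
         ≡ monomial (a ∷ b ∷ α) c γ - monomial (a ∷ b ∷ α) c (swapAt zero γ)
    go d refl e γ@(p ∷ q ∷ γ′) rewrite e | ℕ.m+n∸n≡m d b | map-upTo-ladder d b b α c
      | List.++-identityʳ (ladder d b b α c) =
      trans (coeff-ladder d b b α c γ)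
        (cong₂ _-_ (cong (λ z → monomial (z ∷ b ∷ α) c γ) (ℕ.+-comm b d))
                   (monomial-swap b (d ℕ.+ b) α c p q γ′))
  ... | inj₂ a≤b = divDiff (go (b ∸ a) (sym (ℕ.m∸n+n≡m a≤b)) (ℕ.m≤n⇒m∸n≡0 a≤b))
    where
    neg-flip : ∀ x y → (- x) - (- y) ≡ y - x
    neg-flip = solve-∀
    go : ∀ d → b ≡ d ℕ.+ a → a ∸ b ≡ 0 → ∀ γ →
         mulx zero (coeff (∂term zero (suc zero) (a ∷ b ∷ α , c))) γ
         - mulx (suc zero) (coeff (∂term zero (suc zero) (a ∷ b ∷ α , c))) γ
         ≡ monomial (a ∷ b ∷ α) c γ - monomial (a ∷ b ∷ α) c (swapAt zero γ)
    go d refl e γ@(p ∷ q ∷ γ′) rewrite e | ℕ.m+n∸n≡m d a | map-upTo-ladder d a a α (- c) =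
      trans (coeff-ladder d a a α (- c) γ)
      (trans (cong₂ _-_ (trans (monomial-neg (a ℕ.+ d ∷ a ∷ α) γ c)
                          (cong -_ (trans (cong (λ z → monomial (z ∷ a ∷ α) c γ) (ℕ.+-comm a d))
                                          (monomial-swap (d ℕ.+ a) a α c p q γ′))))
                        (monomial-neg (a ∷ d ℕ.+ a ∷ α) γ c))
             (neg-flip (monomial (a ∷ d ℕ.+ a ∷ α) c (q ∷ p ∷ γ′)) (monomial (a ∷ d ℕ.+ a ∷ α) c γ)))
  ∂term-divDiff (suc k) (a ∷ α) c = divDiff λ { (b ∷ γ) →
    trans (cong₂ _-_ (mulx-cong (inject₁ k) (e b) γ) (mulx-cong (suc k) (e b) γ)) (h b γ) }
    where
    Y : ℕ → Coeffs _
    Y b γ = if a ≡ᵇ b then coeff (∂term (inject₁ k) (suc k) (α , c)) γ else 0ℤ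
    e : ∀ b γ → coeff (∂term (suc (inject₁ k)) (suc (suc k)) (a ∷ α , c)) (b ∷ γ) ≡ Y b γ
    e b γ = trans (cong (λ p → coeff p (b ∷ γ)) (∂term-∷ (inject₁ k) (suc k) a α c))
                  (coeff-map-∷ a (∂term (inject₁ k) (suc k) (α , c)) b γ)
    h : ∀ b γ → mulx (inject₁ k) (Y b) γ - mulx (suc k) (Y b) γ
        ≡ monomial (a ∷ α) c (b ∷ γ) - monomial (a ∷ α) c (b ∷ swapAt k γ)
    h b γ with a ≡ᵇ b
    ... | true = at (∂term-divDiff k α c) γ
    ... | false = at (IsDivDiff-0 k) γ

  ∂-divDiff : ∀ {m} (k : Fin m) f → IsDivDiff k (coeff f) (coeff (∂ (inject₁ k) (suc k) f))
  ∂-divDiff k [] = IsDivDiff-0 k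
  ∂-divDiff k ((α , c) ∷ f) =
    IsDivDiff-cong k (λ γ → sym (coeff-∷ α c f γ))
      (λ γ → sym (coeff-++ (∂term (inject₁ k) (suc k) (α , c)) (∂ (inject₁ k) (suc k) f) γ))
      (IsDivDiff-+ k (∂term-divDiff k α c) (∂-divDiff k f))

  -- W = π_k X, as the relation (x_k - x_{k+1}) W = Y - s_k Y with Y = (1 - x_{k+1}) X. It
  -- determines W, so a formula for π_k X is proved by verifying the relation.
  record IsIsobaric {m} (k : Fin m) (X W : Coeffs (suc m)) : Set where
    constructor isIsobaric
    field
      divided : IsDivDiff k (λ γ → X γ - mulx (suc k) X γ) W

  open IsIsobaric

  isobaric-isIsobaric : ∀ {m} (k : Fin m) f →
    IsIsobaric k (coeff f) (coeff (isobaric (inject₁ k) (suc k) f))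
  isobaric-isIsobaric k f = isIsobaric
    (IsDivDiff-cong k (coeff-oneMinus (suc k) f) (λ _ → refl) (∂-divDiff k (oneMinus (suc k) f)))

  IsIsobaric-cong : ∀ {m} (k : Fin m) {X X′ W W′ : Coeffs (suc m)} → X ≗ X′ → W ≗ W′ →
                    IsIsobaric k X W → IsIsobaric k X′ W′
  IsIsobaric-cong k eX eW D = isIsobaric
    (IsDivDiff-cong k (λ γ → cong₂ _-_ (eX γ) (mulx-cong (suc k) eX γ)) eW (divided D))

  IsIsobaric-unique : ∀ {m} (k : Fin m) {X W V : Coeffs (suc m)} →
                      IsIsobaric k X W → IsIsobaric k X V → W ≗ V
  IsIsobaric-unique k D E = IsDivDiff-unique k (divided D) (divided E)

  IsIsobaric-0 : ∀ {m} (k : Fin m) → IsIsobaric k (λ _ → 0ℤ) (λ _ → 0ℤ)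
  IsIsobaric-0 k = isIsobaric
    (IsDivDiff-cong k (λ γ → sym (cong (λ z → 0ℤ - z) (mulx-0 (suc k) γ))) (λ _ → refl) (IsDivDiff-0 k))

  IsIsobaric-- : ∀ {m} (k : Fin m) {X Y W V : Coeffs (suc m)} →
                 IsIsobaric k X W → IsIsobaric k Y V →
                 IsIsobaric k (λ α → X α - Y α) (λ α → W α - V α)
  IsIsobaric-- k {X} {Y} D E = isIsobaric
    (IsDivDiff-cong k
      (λ γ → trans (interchange- (X γ) (mulx (suc k) X γ) (Y γ) (mulx (suc k) Y γ))
                   (cong (λ z → (X γ - Y γ) - z) (sym (mulx-- (suc k) X Y γ))))
      (λ _ → refl) (IsDivDiff-- k (divided D) (divided E)))

-- Scan polynomials and the action of the isobaric operators on them.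

module ScanPolynomials where

  open DividedDifferences
  open import Data.Integer using (_+_; _-_; -_)
  open import Data.Integer.Tactic.RingSolver using (solve-∀)
  open import Data.List using ([]; _∷_)
  open import Data.Maybe using (_>>=_)

  -- Whether the row has a box, and whether its block continues in the next row.
  Label : Set
  Label = Bool × Bool

  -- `nothing` means that a box found no success to pay for it. A row that does not continue its
  -- block drops the surplus: successes left over in one block cannot serve the next.
  next : Label → ℕ → Maybe ℕ
  next (false , κ) s = just (if κ then s else 0)
  next (true , κ) zero = nothing
  next (true , κ) (suc s) = just (if κ then s else 0)

  pick : {A : Set} → A → ℕ → ℕ → A → A → A
  pick o zero zero x y = x
  pick o zero (suc zero) x y = y
  pick o zero (suc (suc a)) x y = o
  pick o (suc l) zero x y = o
  pick o (suc l) (suc a) x y = pick o l a x y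

  -- Coefficient of x^a in x^l ((1 − x) e₀ + x e₁).
  digit : ℕ → ℕ → ℤ → ℤ → ℤ
  digit l a e₀ e₁ = pick 0ℤ l a e₀ (e₁ - e₀)

  -- scan s Ls ls gives the coefficients of x^ls times the probability that, starting from surplus s, the
  -- surplus (successes minus boxes) never drops below zero; it is reset to zero where a block ends.
  scan : ∀ {n} → ℕ → Vec Label n → Vec ℕ n → Coeffs n
  scan? : ∀ {n} → Maybe ℕ → Vec Label n → Vec ℕ n → Coeffs n
  scan s [] [] [] = 1ℤ
  scan s (L ∷ Ls) (l ∷ ls) (a ∷ α) =
    digit l a (scan? (next L s) Ls ls α) (scan? (next L (suc s)) Ls ls α)
  scan? nothing Ls ls α = 0ℤ
  scan? (just s) Ls ls α = scan s Ls ls α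

  digit-0 : ∀ l a → digit l a 0ℤ 0ℤ ≡ 0ℤ
  digit-0 zero zero = refl
  digit-0 zero (suc zero) = refl
  digit-0 zero (suc (suc a)) = refl
  digit-0 (suc l) zero = refl
  digit-0 (suc l) (suc a) = digit-0 l a

  -- The variable of a row before those of x_k and x_{k+1} commutes with π_k, so its coefficients
  -- are transformed one by one. This carries a step past the rows in front of it.
  digit-isobaric : ∀ {m} (k : Fin m) l a {X₀ X₁ W₀ W₁ : Coeffs (suc m)} →
    IsIsobaric k X₀ W₀ → IsIsobaric k X₁ W₁ →
    IsIsobaric k (λ α → digit l a (X₀ α) (X₁ α)) (λ α → digit l a (W₀ α) (W₁ α))
  digit-isobaric k zero zero D E = D
  digit-isobaric k zero (suc zero) D E = IsIsobaric-- k E D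
  digit-isobaric k zero (suc (suc a)) D E = IsIsobaric-0 k
  digit-isobaric k (suc l) zero D E = IsIsobaric-0 k
  digit-isobaric k (suc l) (suc a) D E = digit-isobaric k l a D E

  -- The isobaric relation in x_k and x_{k+1} alone, with exponents `p` and `q`, all other exponents
  -- being fixed.
  Isobaric₂ : (ℕ → ℕ → ℤ) → (ℕ → ℕ → ℤ) → Set
  Isobaric₂ X W = ∀ p q →
    raise (λ p′ → W p′ q) p - raise (W p) q
    ≡ (X p q - raise (X p) q) - (X q p - raise (X q) p)

  record Shifted (X Y : ℕ → ℕ → ℤ) : Set where
    field
      zeroˡ : ∀ q → Y 0 q ≡ 0ℤ
      zeroʳ : ∀ p → Y p 0 ≡ 0ℤ
      shift : ∀ p q → Y (suc p) (suc q) ≡ X p q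

  -- Multiplying both sides by the symmetric monomial x_k x_{k+1}.
  Isobaric₂-shift : ∀ {X W Y V} → Shifted X Y → Shifted W V → Isobaric₂ X W → Isobaric₂ Y V
  Isobaric₂-shift {X} {W} {Y} {V} S T h = go
    where
    module S = Shifted S
    module T = Shifted T
    rY : ∀ p q → raise (Y (suc p)) (suc q) ≡ raise (X p) q
    rY p zero = S.zeroʳ (suc p)
    rY p (suc q) = S.shift p q
    rV : ∀ p q → raise (V (suc p)) (suc q) ≡ raise (W p) q
    rV p zero = T.zeroʳ (suc p)
    rV p (suc q) = T.shift p q
    rV′ : ∀ p q → raise (λ p′ → V p′ (suc q)) (suc p) ≡ raise (λ p′ → W p′ q) p
    rV′ zero q = T.zeroˡ (suc q)
    rV′ (suc p) q = T.shift p q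
    zs : ∀ {a b c d e f} → a ≡ 0ℤ → b ≡ 0ℤ → c ≡ 0ℤ → d ≡ 0ℤ → e ≡ 0ℤ → f ≡ 0ℤ →
         a - b ≡ (c - d) - (e - f)
    zs refl refl refl refl refl refl = refl
    go : Isobaric₂ Y V
    go zero zero = zs {a = 0ℤ} {b = 0ℤ} refl refl (S.zeroˡ 0) refl (S.zeroˡ 0) refl
    go zero (suc q) = zs {a = 0ℤ} refl (T.zeroˡ q) (S.zeroˡ (suc q)) (S.zeroˡ q) (S.zeroʳ (suc q)) refl
    go (suc p) zero = zs {b = 0ℤ} (T.zeroʳ p) refl (S.zeroʳ (suc p)) refl (S.zeroˡ (suc p)) (S.zeroˡ p)
    go (suc p) (suc q) =
      trans (cong₂ _-_ (rV′ p q) (rV p q))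
      (trans (h p q)
        (sym (cong₂ _-_ (cong₂ _-_ (S.shift p q) (rY p q)) (cong₂ _-_ (S.shift q p) (rY q p)))))

  grid : ℕ → ℕ → (f₀₀ f₀₁ f₁₀ f₁₁ : ℤ) → ℕ → ℕ → ℤ
  grid l₁ l₂ f₀₀ f₀₁ f₁₀ f₁₁ p q = digit l₁ p (digit l₂ q f₀₀ f₀₁) (digit l₂ q f₁₀ f₁₁)

  grid-shifted : ∀ l₁ l₂ f₀₀ f₀₁ f₁₀ f₁₁ →
    Shifted (grid l₁ l₂ f₀₀ f₀₁ f₁₀ f₁₁) (grid (suc l₁) (suc l₂) f₀₀ f₀₁ f₁₀ f₁₁)
  grid-shifted l₁ l₂ _ _ _ _ = record
    { zeroˡ = λ q → refl
    ; zeroʳ = λ { zero → refl ; (suc p) → digit-0 l₁ p }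
    ; shift = λ p q → refl
    }

  -- π(x f) keeps f₀₀, f₁₀, f₁₁, copies f₁₀ to f₀₁, and forgets f₀₁.
  isobaric-grid₁ : ∀ l f₀₀ f₀₁ f₁₀ f₁₁ →
    Isobaric₂ (grid (suc l) l f₀₀ f₀₁ f₁₀ f₁₁) (grid l l f₀₀ f₁₀ f₁₀ f₁₁)
  isobaric-grid₁ (suc l) f₀₀ f₀₁ f₁₀ f₁₁ =
    Isobaric₂-shift (grid-shifted (suc l) l f₀₀ f₀₁ f₁₀ f₁₁) (grid-shifted l l f₀₀ f₁₀ f₁₀ f₁₁) (isobaric-grid₁ l f₀₀ f₀₁ f₁₀ f₁₁)
  isobaric-grid₁ zero a b c d = go
    where
    e01 : ∀ a b c d → 0ℤ - a ≡ (0ℤ - 0ℤ) - (a - 0ℤ)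
    e01 = solve-∀
    e02 : ∀ a b c d → 0ℤ - (c - a) ≡ (0ℤ - 0ℤ) - ((c - a) - 0ℤ)
    e02 = solve-∀
    e10 : ∀ a b c d → a - 0ℤ ≡ (a - 0ℤ) - (0ℤ - 0ℤ)
    e10 = solve-∀
    e11 : ∀ a b c d → (c - a) - (c - a) ≡ ((b - a) - a) - ((b - a) - a)
    e11 = solve-∀
    e12 : ∀ a b c d → 0ℤ - ((d - c) - (c - a)) ≡ (0ℤ - (b - a)) - (((d - c) - (b - a)) - (c - a))
    e12 = solve-∀
    e20 : ∀ a b c d → (c - a) - 0ℤ ≡ ((c - a) - 0ℤ) - (0ℤ - 0ℤ)
    e20 = solve-∀
    e21 : ∀ a b c d → ((d - c) - (c - a)) - 0ℤ ≡ (((d - c) - (b - a)) - (c - a)) - (0ℤ - (b - a))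
    e21 = solve-∀
    e22 : ∀ a b c d → (0ℤ - 0ℤ) - 0ℤ ≡ ((0ℤ - 0ℤ) - ((d - c) - (b - a))) - ((0ℤ - 0ℤ) - ((d - c) - (b - a)))
    e22 = solve-∀
    -- Exponents above 2 carry no term on either side, so the relation is a finite table of ring
    -- identities in the four values.
    go : Isobaric₂ (grid 1 0 a b c d) (grid 0 0 a c c d)
    go 0 0 = refl
    go 0 1 = e01 a b c d
    go 0 2 = e02 a b c d
    go 0 (suc (suc (suc q))) = refl
    go 1 0 = e10 a b c d
    go 1 1 = e11 a b c d
    go 1 2 = e12 a b c d
    go 1 (suc (suc (suc q))) = refl
    go 2 0 = e20 a b c d
    go 2 1 = e21 a b c d
    go 2 2 = e22 a b c d
    go 2 (suc (suc (suc q))) = refl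
    go (suc (suc (suc p))) 0 = refl
    go (suc (suc (suc p))) 1 = refl
    go (suc (suc (suc p))) 2 = refl
    go (suc (suc (suc p))) (suc (suc (suc q))) = refl

  -- π(x² f) for f depending on x_{k+1} only.
  isobaric-grid₂ : ∀ l f₀ f₁ →
    Isobaric₂ (grid (suc (suc l)) l f₀ f₁ f₀ f₁) (grid l l 0ℤ f₀ f₀ f₁)
  isobaric-grid₂ (suc l) f₀ f₁ =
    Isobaric₂-shift (grid-shifted (suc (suc l)) l f₀ f₁ f₀ f₁) (grid-shifted l l 0ℤ f₀ f₀ f₁) (isobaric-grid₂ l f₀ f₁)
  isobaric-grid₂ zero a b = go
    where
    e02 : ∀ a b → 0ℤ - (a - 0ℤ) ≡ (0ℤ - 0ℤ) - (a - 0ℤ)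
    e02 = solve-∀
    e03 : ∀ a b → 0ℤ - 0ℤ ≡ (0ℤ - 0ℤ) - ((a - a) - 0ℤ)
    e03 = solve-∀
    e11 : ∀ a b → (a - 0ℤ) - (a - 0ℤ) ≡ (0ℤ - 0ℤ) - (0ℤ - 0ℤ)
    e11 = solve-∀
    e12 : ∀ a b → 0ℤ - ((b - a) - (a - 0ℤ)) ≡ (0ℤ - 0ℤ) - ((b - a) - a)
    e12 = solve-∀
    e13 : ∀ a b → 0ℤ - (0ℤ - 0ℤ) ≡ (0ℤ - 0ℤ) - (((b - a) - (b - a)) - (a - a))
    e13 = solve-∀
    e20 : ∀ a b → (a - 0ℤ) - 0ℤ ≡ (a - 0ℤ) - (0ℤ - 0ℤ)
    e20 = solve-∀
    e21 : ∀ a b → ((b - a) - (a - 0ℤ)) - 0ℤ ≡ ((b - a) - a) - (0ℤ - 0ℤ)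
    e21 = solve-∀
    e22 : ∀ a b → (0ℤ - 0ℤ) - 0ℤ ≡ (0ℤ - (b - a)) - (0ℤ - (b - a))
    e22 = solve-∀
    e23 : ∀ a b → (0ℤ - 0ℤ) - 0ℤ ≡ (0ℤ - 0ℤ) - ((0ℤ - 0ℤ) - ((b - a) - (b - a)))
    e23 = solve-∀
    e30 : ∀ a b → 0ℤ - 0ℤ ≡ ((a - a) - 0ℤ) - (0ℤ - 0ℤ)
    e30 = solve-∀
    e31 : ∀ a b → 0ℤ - 0ℤ ≡ (((b - a) - (b - a)) - (a - a)) - (0ℤ - 0ℤ)
    e31 = solve-∀
    e32 : ∀ a b → 0ℤ - 0ℤ ≡ ((0ℤ - 0ℤ) - ((b - a) - (b - a))) - (0ℤ - 0ℤ)
    e32 = solve-∀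
    go : Isobaric₂ (grid 2 0 a b a b) (grid 0 0 0ℤ a a b)
    go 0 0 = refl
    go 0 1 = refl
    go 0 2 = e02 a b
    go 0 3 = e03 a b
    go 0 (suc (suc (suc (suc q)))) = refl
    go 1 0 = refl
    go 1 1 = e11 a b
    go 1 2 = e12 a b
    go 1 3 = e13 a b
    go 1 (suc (suc (suc (suc q)))) = refl
    go 2 0 = e20 a b
    go 2 1 = e21 a b
    go 2 2 = e22 a b
    go 2 3 = e23 a b
    go 2 (suc (suc (suc (suc q)))) = refl
    go 3 0 = e30 a b
    go 3 1 = e31 a b
    go 3 2 = e32 a b
    go 3 3 = refl
    go 3 (suc (suc (suc (suc q)))) = refl
    go (suc (suc (suc (suc p)))) 0 = refl
    go (suc (suc (suc (suc p)))) 1 = refl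
    go (suc (suc (suc (suc p)))) 2 = refl
    go (suc (suc (suc (suc p)))) 3 = refl
    go (suc (suc (suc (suc p)))) (suc (suc (suc (suc q)))) = refl

  next₂ : Label → Label → ℕ → ℕ → ℕ → Maybe ℕ
  next₂ L M u v s = next L (u ℕ.+ s) >>= λ t → next M (v ℕ.+ t)

  scan-grid : ∀ {n} s L M (Ls : Vec Label n) l₁ l₂ ls p q α →
    let f = λ u v → scan? (next₂ L M u v s) Ls ls α in
    scan s (L ∷ M ∷ Ls) (l₁ ∷ l₂ ∷ ls) (p ∷ q ∷ α) ≡ grid l₁ l₂ (f 0 0) (f 0 1) (f 1 0) (f 1 1) p q
  scan-grid s L M Ls l₁ l₂ ls p q α = cong₂ (digit l₁ p) (h (next L s)) (h (next L (suc s)))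
    where
    h : ∀ t → scan? t (M ∷ Ls) (l₂ ∷ ls) (q ∷ α) ≡
        digit l₂ q (scan? (t >>= λ t → next M t) Ls ls α) (scan? (t >>= λ t → next M (suc t)) Ls ls α)
    h nothing = sym (digit-0 l₂ q)
    h (just t) = refl

  -- The isobaric operator π_k turns scan s Ls′ ls′ into scan s Ls ls, provided that s = 0 unless the flag e
  -- (a block is open) is set.
  data Step : ∀ {m} → Fin m → Bool → (Ls′ : Vec Label (suc m)) (ls′ : Vec ℕ (suc m))
              (Ls : Vec Label (suc m)) (ls : Vec ℕ (suc m)) → Set where
    move : ∀ {n e l} β κ {Ls : Vec Label n} {ls : Vec ℕ n} →
      Step zero e ((β , κ) ∷ (false , κ) ∷ Ls) (suc l ∷ l ∷ ls)
                  ((false , β ∨ κ) ∷ (β , κ) ∷ Ls) (l ∷ l ∷ ls)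
    create : ∀ {n l} κ {Ls : Vec Label n} {ls : Vec ℕ n} →
      Step zero false ((false , false) ∷ (false , κ) ∷ Ls) (suc (suc l) ∷ l ∷ ls)
                      ((false , true) ∷ (true , κ) ∷ Ls) (l ∷ l ∷ ls)
    there : ∀ {m} {k : Fin m} {e L l Ls′ ls′ Ls ls} → Step k (proj₂ L) Ls′ ls′ Ls ls →
      Step (suc k) e (L ∷ Ls′) (l ∷ ls′) (L ∷ Ls) (l ∷ ls)

  -- `create` rests on this: before the step row k resets the surplus, after the step it hands the
  -- surplus on, and the two agree only if none comes in.
  OpenOrZero : Bool → ℕ → Set
  OpenOrZero e s = e ≡ false → s ≡ 0

  next-OpenOrZero : ∀ L s {t} → next L s ≡ just t → OpenOrZero (proj₂ L) t
  next-OpenOrZero (false , false) s refl e = refl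
  next-OpenOrZero (true , false) (suc s) refl e = refl

  isobaric-at-head : ∀ {n} {X W : Coeffs (suc (suc n))} (F G : Exp n → ℕ → ℕ → ℤ) →
    (∀ p q α → X (p ∷ q ∷ α) ≡ F α p q) → (∀ p q α → W (p ∷ q ∷ α) ≡ G α p q) →
    (∀ α → Isobaric₂ (F α) (G α)) → IsIsobaric zero X W
  isobaric-at-head {X = X} {W} F G eX eW h = isIsobaric (divDiff go)
    where
    go : ∀ γ → mulx zero W γ - mulx (suc zero) W γ ≡
         (X γ - mulx (suc zero) X γ) - (X (swapAt zero γ) - mulx (suc zero) X (swapAt zero γ))
    go (p ∷ q ∷ α) = trans
      (cong₂ _-_ (raise-cong (λ p′ → eW p′ q α) p) (raise-cong (λ q′ → eW p q′ α) q))
      (trans (h α p q) (sym (cong₂ _-_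
        (cong₂ _-_ (eX p q α) (raise-cong (λ q′ → eX p q′ α) q))
        (cong₂ _-_ (eX q p α) (raise-cong (λ q′ → eX q q′ α) p)))))

  -- For `move`: a box in the upper row faces u ∨ v, one row lower it faces u + v, and with incoming
  -- surplus s both are paid under the same condition, leaving the same surplus since (u ∨ v) + (u ∧
  -- v) = u + v. For `create`: the new box consumes u ∨ v, and u ∧ v is what it passes on.
  Step-isobaric : ∀ {m} {k : Fin m} {e Ls′ ls′ Ls ls} s → OpenOrZero e s →
    Step k e Ls′ ls′ Ls ls → IsIsobaric k (scan s Ls′ ls′) (scan s Ls ls)
  Step-isobaric s o (move {l = l} β κ {Ls} {ls}) =
    isobaric-at-head
      (λ α → grid (suc l) l (f α 0 0) (f α 0 1) (f α 1 0) (f α 1 1))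
      (λ α → grid l l (f α 0 0) (f α 1 0) (f α 1 0) (f α 1 1))
      (scan-grid s (β , κ) (false , κ) Ls (suc l) l ls)
      (λ p q α → trans (scan-grid s (false , β ∨ κ) (β , κ) Ls l l ls p q α)
        (cong-grid p q (cong (λ z → scan? z Ls ls α) (e₀₀ β κ s)) (cong (λ z → scan? z Ls ls α) (e₀₁ β κ s))
                       (cong (λ z → scan? z Ls ls α) (e₁₀ β κ s)) (cong (λ z → scan? z Ls ls α) (e₁₁ β κ s))))
      (λ α → isobaric-grid₁ l (f α 0 0) (f α 0 1) (f α 1 0) (f α 1 1))
    where
    f = λ α u v → scan? (next₂ (β , κ) (false , κ) u v s) Ls ls α
    cong-grid : ∀ p q {a a′ b b′ c c′ d d′} → a ≡ a′ → b ≡ b′ → c ≡ c′ → d ≡ d′ →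
                grid l l a b c d p q ≡ grid l l a′ b′ c′ d′ p q
    cong-grid p q refl refl refl refl = refl
    e₀₀ : ∀ β κ s → next₂ (false , β ∨ κ) (β , κ) 0 0 s ≡ next₂ (β , κ) (false , κ) 0 0 s
    e₀₀ false false s = refl
    e₀₀ false true s = refl
    e₀₀ true false zero = refl
    e₀₀ true false (suc s) = refl
    e₀₀ true true zero = refl
    e₀₀ true true (suc s) = refl
    e₀₁ : ∀ β κ s → next₂ (false , β ∨ κ) (β , κ) 0 1 s ≡ next₂ (β , κ) (false , κ) 1 0 s
    e₀₁ false false s = refl
    e₀₁ false true s = refl
    e₀₁ true false s = refl
    e₀₁ true true s = refl
    e₁₀ : ∀ β κ s → next₂ (false , β ∨ κ) (β , κ) 1 0 s ≡ next₂ (β , κ) (false , κ) 1 0 s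
    e₁₀ false false s = refl
    e₁₀ false true s = refl
    e₁₀ true false s = refl
    e₁₀ true true s = refl
    e₁₁ : ∀ β κ s → next₂ (false , β ∨ κ) (β , κ) 1 1 s ≡ next₂ (β , κ) (false , κ) 1 1 s
    e₁₁ false false s = refl
    e₁₁ false true s = refl
    e₁₁ true false s = refl
    e₁₁ true true s = refl
  Step-isobaric s o (create {l = l} κ {Ls} {ls}) rewrite o refl =
    isobaric-at-head
      (λ α → grid (suc (suc l)) l (f α 0) (f α 1) (f α 0) (f α 1))
      (λ α → grid l l 0ℤ (f α 0) (f α 0) (f α 1))
      (scan-grid 0 (false , false) (false , κ) Ls (suc (suc l)) l ls)
      (scan-grid 0 (false , true) (true , κ) Ls l l ls)
      (λ α → isobaric-grid₂ l (f α 0) (f α 1))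
    where
    f = λ α u → scan? (next (false , κ) u) Ls ls α
  Step-isobaric {k = suc k} s o (there {L = L} {l} {Ls′} {ls′} {Ls} {ls} st) =
    isIsobaric (divDiff λ { (a ∷ γ) → IsDivDiff.at (IsIsobaric.divided
      (digit-isobaric k l a (h (next L s) (next-OpenOrZero L s)) (h (next L (suc s)) (next-OpenOrZero L (suc s))))) γ })
    where
    h : ∀ t → (∀ {t′} → t ≡ just t′ → OpenOrZero (proj₂ L) t′) →
        IsIsobaric k (scan? t Ls′ ls′) (scan? t Ls ls)
    h nothing o = IsIsobaric-0 k
    h (just t) o = Step-isobaric t (o refl) st

-- First ascents: the effect of the swap on boxes, open rows and prefix minima.

module FirstAscents where

  open ScanPolynomials
  open import Data.Nat using (_⊓_; _≤_; _<_)
  open import Data.Fin.Permutation using (Permutation′; _⟨$⟩ʳ_; transpose)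
  open import Data.Vec.Properties using (tabulate-cong)
  open import Data.Empty using (⊥; ⊥-elim)
  open import Function.Definitions using (Injective)
  open import Relation.Binary.Definitions using (tri<; tri≈; tri>)
  open import Relation.Nullary.Decidable using (_×-dec_; _⊎-dec_; does-⇔; dec-true; dec-false)

  oneLine : ∀ {n} → Permutation′ n → Fin n → ℕ
  oneLine w r = toℕ (w ⟨$⟩ʳ r)

  -- Row r has a box of the Rothe diagram outside the dominant component (r is the 3 of a 132 pattern).
  Box : ∀ {n} → (Fin n → ℕ) → Fin n → Set
  Box f r = ∃ λ k → ∃ λ r′ → k Fin.< r × r Fin.< r′ × f k < f r′ × f r′ < f r

  -- Some later row has such a box in a column to the right of one of the dots in rows ≤ r.
  Open : ∀ {n} → (Fin n → ℕ) → Fin n → Set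
  Open f r = ∃ λ k → ∃ λ r′ → ∃ λ r″ →
    k Fin.≤ r × r Fin.< r′ × r′ Fin.< r″ × f k < f r″ × f r″ < f r′

  box? : ∀ {n} (f : Fin n → ℕ) r → Dec (Box f r)
  box? f r = Fin.any? λ k → Fin.any? λ r′ →
    (k Fin.<? r) ×-dec (r Fin.<? r′) ×-dec (f k ℕ.<? f r′) ×-dec (f r′ ℕ.<? f r)

  open? : ∀ {n} (f : Fin n → ℕ) r → Dec (Open f r)
  open? f r = Fin.any? λ k → Fin.any? λ r′ → Fin.any? λ r″ →
    (k Fin.≤? r) ×-dec (r Fin.<? r′) ×-dec (r′ Fin.<? r″) ×-dec (f k ℕ.<? f r″) ×-dec (f r″ ℕ.<? f r′)

  label : ∀ {n} → (Fin n → ℕ) → Fin n → Label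
  label f r = does (box? f r) , does (open? f r)

  -- Values are counted from 0, which absorbs the -1 in λ_r.
  minUpTo : ∀ {n} → (Fin n → ℕ) → Fin n → ℕ
  minUpTo f zero = f zero
  minUpTo f (suc r) = f zero ⊓ minUpTo (f ∘ suc) r

  labels : ∀ {n} → (Fin n → ℕ) → Vec Label n
  labels f = tabulate (label f)

  code : ∀ {n} → (Fin n → ℕ) → Vec ℕ n
  code f = tabulate (minUpTo f)

  minUpTo-≤ : ∀ {n} (f : Fin n → ℕ) r k → k Fin.≤ r → minUpTo f r ≤ f k
  minUpTo-≤ f zero zero _ = ℕ.≤-refl
  minUpTo-≤ f (suc r) zero _ = ℕ.m⊓n≤m _ _
  minUpTo-≤ f (suc r) (suc k) (s≤s k≤r) = ℕ.≤-trans (ℕ.m⊓n≤n (f zero) _) (minUpTo-≤ (f ∘ suc) r k k≤r)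

  minUpTo-attained : ∀ {n} (f : Fin n → ℕ) r → ∃ λ k → k Fin.≤ r × f k ≡ minUpTo f r
  minUpTo-attained f zero = zero , z≤n , refl
  minUpTo-attained f (suc r) with ℕ.≤-total (f zero) (minUpTo (f ∘ suc) r) | minUpTo-attained (f ∘ suc) r
  ... | inj₁ le | _ = zero , z≤n , sym (ℕ.m≤n⇒m⊓n≡m le)
  ... | inj₂ ge | k , k≤r , e = suc k , s≤s k≤r , trans e (sym (ℕ.m≥n⇒m⊓n≡n ge))

  move-tabulate : ∀ {m} (k : Fin m) e (L′ L : Fin (suc m) → Label) (c′ c : Fin (suc m) → ℕ) {β κ l} →
    (∀ r → r ≢ inject₁ k → r ≢ suc k → L′ r ≡ L r) → (∀ r → r ≢ inject₁ k → c′ r ≡ c r) →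
    L′ (inject₁ k) ≡ (β , κ) → L′ (suc k) ≡ (false , κ) →
    L (inject₁ k) ≡ (false , β ∨ κ) → L (suc k) ≡ (β , κ) →
    c′ (inject₁ k) ≡ suc l → c (inject₁ k) ≡ l → c (suc k) ≡ l →
    Step k e (tabulate L′) (tabulate c′) (tabulate L) (tabulate c)
  move-tabulate zero e L′ L c′ c eqL eqc p₁ p₂ p₃ p₄ q₁ q₂ q₃
    rewrite p₁ | p₂ | p₃ | p₄ | q₁ | eqc (suc zero) (λ ()) | q₂ | q₃
      | tabulate-cong (λ r → eqL (suc (suc r)) (λ ()) (λ ()))
      | tabulate-cong (λ r → eqc (suc (suc r)) (λ ())) = move _ _
  move-tabulate (suc k) e L′ L c′ c eqL eqc p₁ p₂ p₃ p₄ q₁ q₂ q₃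
    rewrite sym (eqL zero (λ ()) (λ ())) | eqc zero (λ ()) =
    there (move-tabulate k _ (L′ ∘ suc) (L ∘ suc) (c′ ∘ suc) (c ∘ suc)
      (λ r a b → eqL (suc r) (a ∘ Fin.suc-injective) (b ∘ Fin.suc-injective))
      (λ r a → eqc (suc r) (a ∘ Fin.suc-injective))
      p₁ p₂ p₃ p₄ q₁ q₂ q₃)

  -- The hypotheses on `e` and on the row before `k` say that no block is open on arrival at `k`, as
  -- `create` demands.
  create-tabulate : ∀ {m} (k : Fin m) e (L′ L : Fin (suc m) → Label) (c′ c : Fin (suc m) → ℕ) {κ l} →
    (∀ r → r ≢ inject₁ k → r ≢ suc k → L′ r ≡ L r) → (∀ r → r ≢ inject₁ k → c′ r ≡ c r) →
    (toℕ k ≡ 0 → e ≡ false) → (∀ r → suc (toℕ r) ≡ toℕ k → proj₂ (L′ r) ≡ false) →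
    L′ (inject₁ k) ≡ (false , false) → L′ (suc k) ≡ (false , κ) →
    L (inject₁ k) ≡ (false , true) → L (suc k) ≡ (true , κ) →
    c′ (inject₁ k) ≡ suc (suc l) → c (inject₁ k) ≡ l → c (suc k) ≡ l →
    Step k e (tabulate L′) (tabulate c′) (tabulate L) (tabulate c)
  create-tabulate zero e L′ L c′ c eqL eqc he hp p₁ p₂ p₃ p₄ q₁ q₂ q₃
    rewrite he refl | p₁ | p₂ | p₃ | p₄ | q₁ | eqc (suc zero) (λ ()) | q₂ | q₃
      | tabulate-cong (λ r → eqL (suc (suc r)) (λ ()) (λ ()))
      | tabulate-cong (λ r → eqc (suc (suc r)) (λ ())) = create _
  create-tabulate (suc k) e L′ L c′ c eqL eqc he hp p₁ p₂ p₃ p₄ q₁ q₂ q₃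
    rewrite sym (eqL zero (λ ()) (λ ())) | eqc zero (λ ()) =
    there (create-tabulate k _ (L′ ∘ suc) (L ∘ suc) (c′ ∘ suc) (c ∘ suc)
      (λ r a b → eqL (suc r) (a ∘ Fin.suc-injective) (b ∘ Fin.suc-injective))
      (λ r a → eqc (suc r) (a ∘ Fin.suc-injective))
      (λ e → hp zero (cong suc (sym e))) (λ r e → hp (suc r) (cong suc e))
      p₁ p₂ p₃ p₄ q₁ q₂ q₃)

  module Adjacent {m} (k : Fin m) where

    i j : Fin (suc m)
    i = inject₁ k
    j = suc k

    toℕi : toℕ i ≡ toℕ k
    toℕi = Fin.toℕ-inject₁ k

    i<j : i Fin.< j
    i<j = s≤s (ℕ.≤-reflexive toℕi)

    i≢j : i ≢ j
    i≢j e = ℕ.<-irrefl (cong toℕ e) i<j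

    τ : Fin (suc m) → Fin (suc m)
    τ = transpose i j ⟨$⟩ʳ_

    data View (x : Fin (suc m)) : Set where
      is-i : x ≡ i → τ x ≡ j → View x
      is-j : x ≡ j → τ x ≡ i → View x
      other : x ≢ i → x ≢ j → τ x ≡ x → View x

    view : ∀ x → View x
    view x with x Fin.≟ i in ei
    ... | yes x≡i = is-i x≡i h
      where
      h : τ x ≡ j
      h rewrite ei = refl
    ... | no x≢i with x Fin.≟ j in ej
    ...   | yes x≡j = is-j x≡j h
      where
      h : τ x ≡ i
      h rewrite ei | ej = refl
    ...   | no x≢j = other x≢i x≢j h
      where
      h : τ x ≡ x
      h rewrite ei | ej = refl

    τi : τ i ≡ j
    τi with view i
    ... | is-i _ e = e
    ... | is-j e _ = contradiction e i≢j
    ... | other ne _ _ = contradiction refl ne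

    τj : τ j ≡ i
    τj with view j
    ... | is-i e _ = contradiction (sym e) i≢j
    ... | is-j _ e = e
    ... | other _ ne _ = contradiction refl ne

    τ-other : ∀ {x} → x ≢ i → x ≢ j → τ x ≡ x
    τ-other {x} a b with view x
    ... | is-i e _ = contradiction e a
    ... | is-j e _ = contradiction e b
    ... | other _ _ e = e

    τ-involutive : ∀ x → τ (τ x) ≡ x
    τ-involutive x with view x
    ... | is-i refl e = trans (cong τ e) τj
    ... | is-j refl e = trans (cong τ e) τi
    ... | other _ _ e = trans (cong τ e) e

    ≢⇒≢ℕ : ∀ {x y : Fin (suc m)} → x ≢ y → toℕ x ≢ toℕ y
    ≢⇒≢ℕ ne e = ne (Fin.toℕ-injective e)

    i<⇒j≤ : ∀ {x : Fin (suc m)} → i Fin.< x → j Fin.≤ x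
    i<⇒j≤ {x} lt = ℕ.≤-trans (ℕ.≤-reflexive (cong suc (sym toℕi))) lt

    <j⇒≤i : ∀ {x : Fin (suc m)} → x Fin.< j → x Fin.≤ i
    <j⇒≤i (s≤s le) = ℕ.≤-trans le (ℕ.≤-reflexive (sym toℕi))

    i<∧≢j⇒j< : ∀ {x : Fin (suc m)} → i Fin.< x → x ≢ j → j Fin.< x
    i<∧≢j⇒j< lt ne = ℕ.≤∧≢⇒< (i<⇒j≤ lt) (≢⇒≢ℕ (ne ∘ sym))

    <j∧≢i⇒<i : ∀ {x : Fin (suc m)} → x Fin.< j → x ≢ i → x Fin.< i
    <j∧≢i⇒<i lt ne = ℕ.≤∧≢⇒< (<j⇒≤i lt) (≢⇒≢ℕ ne)

    ≤∧≢i⇒τ≤ : ∀ {x r : Fin (suc m)} → r ≢ i → x Fin.≤ r → τ x Fin.≤ r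
    ≤∧≢i⇒τ≤ {x} {r} r≢i le with view x
    ... | is-i refl e = subst (Fin._≤ r) (sym e) (i<⇒j≤ (ℕ.≤∧≢⇒< le (≢⇒≢ℕ (r≢i ∘ sym))))
    ... | is-j refl e = subst (Fin._≤ r) (sym e) (ℕ.≤-trans (ℕ.<⇒≤ i<j) le)
    ... | other _ _ e = subst (Fin._≤ r) (sym e) le

    <∧≢i⇒<τ : ∀ {x r : Fin (suc m)} → r ≢ i → r Fin.< x → r Fin.< τ x
    <∧≢i⇒<τ {x} {r} r≢i lt with view x
    ... | is-i refl e = subst (r Fin.<_) (sym e) (ℕ.<-trans lt i<j)
    ... | is-j refl e = subst (r Fin.<_) (sym e) (<j∧≢i⇒<i lt r≢i)
    ... | other _ _ e = subst (r Fin.<_) (sym e) lt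

    τ-mono-< : ∀ {x y} → x Fin.< y → ¬ (x ≡ i × y ≡ j) → τ x Fin.< τ y
    τ-mono-< {x} {y} lt no-ij with view x
    ... | other x≢i _ e = subst (Fin._< τ y) (sym e) (<∧≢i⇒<τ x≢i lt)
    ... | is-i refl e rewrite e | τ-other {y} (λ y≡i → ℕ.<-irrefl (cong toℕ (sym y≡i)) lt) (λ y≡j → no-ij (refl , y≡j))
        = i<∧≢j⇒j< lt (λ y≡j → no-ij (refl , y≡j))
    ... | is-j refl e rewrite e | τ-other {y} (λ y≡i → ℕ.<-asym i<j (subst (j Fin.<_) y≡i lt)) (λ y≡j → ℕ.<-irrefl (cong toℕ (sym y≡j)) lt)
        = ℕ.<-trans i<j lt

    module Transfer (g h : Fin (suc m) → ℕ) (g≡hτ : ∀ x → g x ≡ h (τ x)) where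

      <-transfer : ∀ {x y} → g x < g y → h (τ x) < h (τ y)
      <-transfer {x} {y} = subst₂ _<_ (g≡hτ x) (g≡hτ y)

      box : ∀ r → r ≢ i → r ≢ j → Box g r → Box h r
      box r r≢i r≢j (k , r′ , k<r , r<r′ , v , v′) =
        τ k , τ r′ , subst (τ k Fin.<_) τr (τ-mono-< k<r (r≢j ∘ proj₂)) , <∧≢i⇒<τ r≢i r<r′ ,
        <-transfer v , subst (λ z → h (τ r′) < h z) τr (<-transfer v′)
        where
        τr : τ r ≡ r
        τr = τ-other r≢i r≢j

      -- The witnesses are carried along by τ. Only a witness whose last two rows are i and j
      -- themselves would be lost, and the hypothesis excludes it.
      openRow : (∀ k → k Fin.< i → g k < g j → g j < g i → ⊥) → ∀ r → r ≢ i → Open g r → Open h r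
      openRow bad r r≢i (k , r′ , r″ , k≤r , r<r′ , r′<r″ , v , v′) =
        τ k , τ r′ , τ r″ , ≤∧≢i⇒τ≤ r≢i k≤r , <∧≢i⇒<τ r≢i r<r′ ,
        τ-mono-< r′<r″ (λ { (refl , refl) → bad k (ℕ.≤-<-trans k≤r r<r′) v v′ }) ,
        <-transfer v , <-transfer v′

      min : ∀ r → r ≢ i → minUpTo h r ≤ minUpTo g r
      min r r≢i with minUpTo-attained g r
      ... | k , k≤r , e = ℕ.≤-trans (minUpTo-≤ h r (τ k) (≤∧≢i⇒τ≤ r≢i k≤r))
                                    (ℕ.≤-reflexive (trans (sym (g≡hτ k)) e))

  -- Without an earlier ascent the values decrease up to position `k`. It is in this form, as a
  -- strict minimum of the prefix, that the choice of the first ascent enters.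
  descending-prefix : ∀ {m} (f : Fin (suc m) → ℕ) → Injective _≡_ _≡_ f → (k : Fin m) →
    (∀ k′ → k′ Fin.< k → ¬ (f (inject₁ k′) < f (suc k′))) →
    ∀ x → x Fin.< inject₁ k → f (inject₁ k) < f x
  descending-prefix f inj zero d x ()
  descending-prefix f inj (suc zero) d zero _ =
    ℕ.≤∧≢⇒< (ℕ.≮⇒≥ (d zero z<s)) (λ e → contradiction (inj e) λ ())
  descending-prefix f inj (suc (suc k)) d zero _ =
    ℕ.<-trans (descending-prefix (f ∘ suc) (Fin.suc-injective ∘ inj) (suc k) (λ k′ lt → d (suc k′) (s<s lt)) zero z<s)
      (ℕ.≤∧≢⇒< (ℕ.≮⇒≥ (d zero z<s)) (λ e → contradiction (inj e) λ ()))
  descending-prefix f inj (suc k) d (suc x) (s≤s lt) =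
    descending-prefix (f ∘ suc) (Fin.suc-injective ∘ inj) k (λ k′ lt → d (suc k′) (s<s lt)) x lt

  -- Avoidance of 1432 and 1423 at once: the last two entries may come in either order.
  No14 : ∀ {n} → (Fin n → ℕ) → Set
  No14 f = ∀ p q r s → p Fin.< q → q Fin.< r → q Fin.< s → r ≢ s →
           f p < f r → f r < f q → f p < f s → f s < f q → ⊥

  No13254 : ∀ {n} → (Fin n → ℕ) → Set
  No13254 f = ∀ p q r s t → p Fin.< q → q Fin.< r → r Fin.< s → s Fin.< t →
              f p < f r → f r < f q → f q < f t → f t < f s → ⊥

  module FirstAscent {m} (f f′ : Fin (suc m) → ℕ) (k : Fin m)
    (f′≡fτ : ∀ x → f′ x ≡ f (Adjacent.τ k x)) (inj : Injective _≡_ _≡_ f)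
    (ascent : f (inject₁ k) < f (suc k)) (first : ∀ k′ → k′ Fin.< k → ¬ (f (inject₁ k′) < f (suc k′))) where

    open Adjacent k

    f≡f′τ : ∀ x → f x ≡ f′ (τ x)
    f≡f′τ x = sym (trans (f′≡fτ (τ x)) (cong f (τ-involutive x)))

    a b : ℕ
    a = f i
    b = f j

    f′i : f′ i ≡ b
    f′i = trans (f′≡fτ i) (cong f τi)

    f′j : f′ j ≡ a
    f′j = trans (f′≡fτ j) (cong f τj)

    a<prefix : ∀ {x : Fin (suc m)} → x Fin.< i → a < f x
    a<prefix = descending-prefix f inj k first _

    a≤f : ∀ {x : Fin (suc m)} → x Fin.≤ j → a ≤ f x
    a≤f {x} le with view x
    ... | is-i refl _ = ℕ.≤-refl
    ... | is-j refl _ = ℕ.<⇒≤ ascent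
    ... | other x≢i x≢j _ = ℕ.<⇒≤ (a<prefix (<j∧≢i⇒<i (ℕ.≤∧≢⇒< le (≢⇒≢ℕ x≢j)) x≢i))

    a<f′ : ∀ {x : Fin (suc m)} → x Fin.≤ i → a < f′ x
    a<f′ {x} le with view x
    ... | is-i refl _ = subst (a <_) (sym f′i) ascent
    ... | is-j refl _ = contradiction le (ℕ.<⇒≱ i<j)
    ... | other x≢i _ e = subst (a <_) (trans (sym (cong f e)) (sym (f′≡fτ x)))
                                (a<prefix (ℕ.≤∧≢⇒< le (≢⇒≢ℕ x≢i)))

    a≤f′ : ∀ {x : Fin (suc m)} → x Fin.≤ j → a ≤ f′ x
    a≤f′ {x} le = subst (a ≤_) (sym (f′≡fτ x)) (a≤f (≤∧≢i⇒τ≤ (i≢j ∘ sym) le))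

    later : ∀ {x : Fin (suc m)} → j Fin.< x → f′ x ≡ f x
    later {x} lt = trans (f′≡fτ x) (cong f (τ-other
      (λ { refl → ℕ.<-asym lt i<j }) (λ { refl → ℕ.<-irrefl refl lt })))

    f′-injective : Injective _≡_ _≡_ f′
    f′-injective {x} {y} e = trans (sym (τ-involutive x)) (trans (cong τ
      (inj (trans (sym (f′≡fτ x)) (trans e (f′≡fτ y))))) (τ-involutive y))

    module F = Transfer f f′ f≡f′τ
    module F′ = Transfer f′ f f′≡fτ

    bad : ∀ k → k Fin.< i → f k < f j → f j < f i → ⊥
    bad _ _ _ v = ℕ.<-asym v ascent

    bad′ : ∀ k → k Fin.< i → f′ k < f′ j → f′ j < f′ i → ⊥
    bad′ k lt v _ = ℕ.<-asym (a<f′ (ℕ.<⇒≤ lt)) (subst (f′ k <_) f′j v)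

    openSame : ∀ r → r ≢ i → does (open? f′ r) ≡ does (open? f r)
    openSame r r≢i = does-⇔ (mk⇔ (F′.openRow bad′ r r≢i) (F.openRow bad r r≢i)) (open? f′ r) (open? f r)

    labelSame : ∀ r → r ≢ i → r ≢ j → label f′ r ≡ label f r
    labelSame r r≢i r≢j = cong₂ _,_
      (does-⇔ (mk⇔ (F′.box r r≢i r≢j) (F.box r r≢i r≢j)) (box? f′ r) (box? f r)) (openSame r r≢i)

    codeSame : ∀ r → r ≢ i → minUpTo f′ r ≡ minUpTo f r
    codeSame r r≢i = ℕ.≤-antisym (F.min r r≢i) (F′.min r r≢i)

    code-i : minUpTo f i ≡ a
    code-i with minUpTo-attained f i
    ... | x , x≤i , e = ℕ.≤-antisym (minUpTo-≤ f i i ℕ.≤-refl)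
                          (subst (a ≤_) e (a≤f (ℕ.≤-trans x≤i (ℕ.<⇒≤ i<j))))

    code-j : minUpTo f j ≡ a
    code-j with minUpTo-attained f j
    ... | x , x≤j , e = ℕ.≤-antisym (minUpTo-≤ f j i (ℕ.<⇒≤ i<j)) (subst (a ≤_) e (a≤f x≤j))

    box-i : does (box? f i) ≡ false
    box-i = dec-false (box? f i) λ { (x , r′ , x<i , _ , v , v′) →
      ℕ.<-asym (a<prefix x<i) (ℕ.<-trans v v′) }

    box′-j : does (box? f′ j) ≡ false
    box′-j = dec-false (box? f′ j) λ { (x , r′ , x<j , _ , v , v′) →
      ℕ.≤⇒≯ (a≤f′ (ℕ.<⇒≤ x<j)) (subst (f′ x <_) f′j (ℕ.<-trans v v′)) }

    -- The second witness row is either j, which then has a box, or lies beyond j. Conversely, a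
    -- first witness among the rows up to j can be replaced by i, whose value a is the least there.
    open-i : does (open? f i) ≡ does (box? f j) ∨ does (open? f′ j)
    open-i = trans (does-⇔ (mk⇔ to from) (open? f i) (box? f j ⊎-dec open? f j))
                   (cong (does (box? f j) ∨_) (sym (openSame j (i≢j ∘ sym))))
      where
      to : Open f i → Box f j ⊎ Open f j
      to (x , r′ , r″ , x≤i , i<r′ , r′<r″ , v , v′) with view r′
      ... | is-i refl _ = contradiction i<r′ (ℕ.<-irrefl refl)
      ... | is-j refl _ = inj₁ (x , r″ , ℕ.≤-<-trans x≤i i<j , r′<r″ , v , v′)
      ... | other _ r′≢j _ = inj₂ (x , r′ , r″ , ℕ.≤-trans x≤i (ℕ.<⇒≤ i<j) , i<∧≢j⇒j< i<r′ r′≢j , r′<r″ , v , v′)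
      from : Box f j ⊎ Open f j → Open f i
      from (inj₁ (x , r″ , x<j , j<r″ , v , v′)) = x , j , r″ , <j⇒≤i x<j , i<j , j<r″ , v , v′
      from (inj₂ (x , r′ , r″ , x≤j , j<r′ , r′<r″ , v , v′)) =
        i , r′ , r″ , ℕ.≤-refl , ℕ.<-trans i<j j<r′ , r′<r″ , ℕ.≤-<-trans (a≤f x≤j) v , v′

  module AvoidingAscent {m} (f f′ : Fin (suc m) → ℕ) (k : Fin m)
    (f′≡fτ : ∀ x → f′ x ≡ f (Adjacent.τ k x)) (inj : Injective _≡_ _≡_ f)
    (ascent : f (inject₁ k) < f (suc k)) (first : ∀ k′ → k′ Fin.< k → ¬ (f (inject₁ k′) < f (suc k′)))
    (surj : ∀ r q → q < f r → ∃ λ x → f x ≡ q) (no14 : No14 f) (no13254 : No13254 f) where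

    open Adjacent k
    open FirstAscent f f′ k f′≡fτ inj ascent first

    μ : ℕ
    μ = minUpTo f′ i

    a<μ : a < μ
    a<μ with minUpTo-attained f′ i
    ... | x , x≤i , e = subst (a <_) e (a<f′ x≤i)

    μ≤b : μ ≤ b
    μ≤b = subst (μ ≤_) f′i (minUpTo-≤ f′ i i ℕ.≤-refl)

    μ≤f′ : ∀ {x : Fin (suc m)} → x Fin.≤ i → μ ≤ f′ x
    μ≤f′ = minUpTo-≤ f′ i _

    -- These rows correspond to the boxes that w has in row j outside the dominant component: the
    -- columns between a and b whose dots come later. Avoidance leaves at most one.
    Missing : Fin (suc m) → Set
    Missing r = j Fin.< r × a < f′ r × f′ r < b

    missing-unique : ∀ {r s} → Missing r → Missing s → r ≡ s
    missing-unique {r} {s} (j<r , v₁ , v₂) (j<s , u₁ , u₂) with r Fin.≟ s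
    ... | yes e = e
    ... | no ne = ⊥-elim (no14 i j r s i<j j<r j<s ne (subst (a <_) (later j<r) v₁) (subst (_< b) (later j<r) v₂)
                            (subst (a <_) (later j<s) u₁) (subst (_< b) (later j<s) u₂))

    -- The value `q` is attained somewhere; not in the rows up to i, whose values are at least μ,
    -- and not in row j, which holds a.
    missing : ∀ q → a < q → q < μ → ∃ λ r → Missing r × f′ r ≡ q
    missing q a<q q<μ with surj j q (ℕ.<-≤-trans q<μ μ≤b)
    ... | x , refl = τ x , (j<τx , subst (a <_) (f≡f′τ x) a<q , subst (_< b) (f≡f′τ x) (ℕ.<-≤-trans q<μ μ≤b)) , sym (f≡f′τ x)
      where
      i<τx : i Fin.< τ x
      i<τx = ℕ.≰⇒> λ le → ℕ.<⇒≱ q<μ (subst (μ ≤_) (sym (f≡f′τ x)) (μ≤f′ le))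
      j<τx : j Fin.< τ x
      j<τx = i<∧≢j⇒j< i<τx λ e → ℕ.<-irrefl (trans (sym f′j) (trans (cong f′ (sym e)) (sym (f≡f′τ x)))) a<q

    box-j⇒missing : Box f j → ∃ Missing
    box-j⇒missing (x , r , x<j , j<r , v , v′) = r , j<r ,
      subst (a <_) (sym (later j<r)) (ℕ.≤-<-trans (a≤f (ℕ.<⇒≤ x<j)) v) , subst (_< b) (sym (later j<r)) v′

    missing⇒box-j : ∃ Missing → Box f j
    missing⇒box-j (r , j<r , v , v′) =
      i , r , i<j , j<r , subst (a <_) (later j<r) v , subst (_< b) (later j<r) v′

    after-i : ∀ {x r : Fin (suc m)} → x Fin.≤ i → i Fin.< r → f′ x < f′ r → j Fin.< r
    after-i x≤i i<r v = i<∧≢j⇒j< i<r λ { refl → ℕ.<-asym (a<f′ x≤i) (subst (_ <_) f′j v) }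

    box′-i⇒missing : Box f′ i → ∃ λ r → Missing r × μ < f′ r
    box′-i⇒missing (x , r , x<i , i<r , v , v′) = r ,
      (after-i (ℕ.<⇒≤ x<i) i<r v , ℕ.<-trans (a<f′ (ℕ.<⇒≤ x<i)) v , subst (f′ r <_) f′i v′) ,
      ℕ.≤-<-trans (μ≤f′ (ℕ.<⇒≤ x<i)) v

    -- The values strictly between a and μ are taken in later rows and are less than b; two of them would
    -- complete a pattern 1423 or 1432, hence μ ≤ a + 2.
    step : Step k false (labels f′) (code f′) (labels f) (code f)
    step with ℕ.<-cmp μ (suc (suc a))
    -- Here λ drops by exactly one in row i: one factor x_i, and a box of row i, if there is one,
    -- moves to row j.
    ... | tri< (s≤s μ≤1+a) _ _ =
      move-tabulate k false (label f′) (label f) (minUpTo f′) (minUpTo f)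
        labelSame codeSame (cong (does (box? f′ i) ,_) (does-⇔ (mk⇔ open′⇒ open′⇐) (open? f′ i) (open? f′ j)))
        (cong (_, does (open? f′ j)) box′-j)
        (cong₂ _,_ box-i (trans open-i (cong (_∨ does (open? f′ j)) (sym box≡))))
        (cong₂ _,_ (sym box≡) (sym (openSame j (i≢j ∘ sym)))) μ≡ code-i code-j
      where
      μ≡ : μ ≡ suc a
      μ≡ = ℕ.≤-antisym μ≤1+a a<μ
      above : ∀ {r} → i Fin.< r → a < f′ r → μ < f′ r
      above i<r v with minUpTo-attained f′ i
      ... | x , x≤i , e = ℕ.≤∧≢⇒< (subst (_≤ f′ _) (sym μ≡) v) λ e′ →
        ℕ.<⇒≱ i<r (ℕ.≤-trans (ℕ.≤-reflexive (cong toℕ (sym (f′-injective (trans e e′))))) x≤i)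
      open′⇒ : Open f′ i → Open f′ j
      open′⇒ (x , r′ , r″ , x≤i , i<r′ , r′<r″ , v , v′) =
        x , r′ , r″ , ℕ.≤-trans x≤i (ℕ.<⇒≤ i<j) , after-i x≤i i<r′ (ℕ.<-trans v v′) , r′<r″ , v , v′
      open′⇐ : Open f′ j → Open f′ i
      open′⇐ (x , r′ , r″ , x≤j , j<r′ , r′<r″ , v , v′) with minUpTo-attained f′ i
      ... | y , y≤i , e = y , r′ , r″ , y≤i , ℕ.<-trans i<j j<r′ , r′<r″ ,
        subst (_< f′ r″) (sym e) (above (ℕ.<-trans i<j (ℕ.<-trans j<r′ r′<r″)) (ℕ.≤-<-trans (a≤f′ x≤j) v)) , v′
      missing⇒box′-i : ∃ Missing → Box f′ i
      missing⇒box′-i (r , j<r , v , v′) with minUpTo-attained f′ i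
      ... | y , y≤i , e = y , r , ℕ.≤∧≢⇒< y≤i y≢i , i<r , subst (_< f′ r) (sym e) (above i<r v) , subst (f′ r <_) (sym f′i) v′
        where
        i<r : i Fin.< r
        i<r = ℕ.<-trans i<j j<r
        y≢i : toℕ y ≢ toℕ i
        y≢i y≡i = ℕ.<-asym v′ (subst (_< f′ r) (trans (sym e) (trans (cong f′ (Fin.toℕ-injective y≡i)) f′i)) (above i<r v))
      box≡ : does (box? f′ i) ≡ does (box? f j)
      box≡ = does-⇔ (mk⇔ (λ b → let r , M , _ = box′-i⇒missing b in missing⇒box-j (r , M))
                         (missing⇒box′-i ∘ box-j⇒missing)) (box? f′ i) (box? f j)
    -- Here λ drops by two. The value a + 1 is taken by a single later row `q`, and its column gives
    -- the box of row j with which the new block begins.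
    ... | tri≈ _ μ≡ _ =
      create-tabulate k false (label f′) (label f) (minUpTo f′) (minUpTo f)
        labelSame codeSame (λ _ → refl)
        (λ r e → dec-false (open? f′ r) (closed r e))
        (cong₂ _,_ (dec-false (box? f′ i) no-box) (dec-false (open? f′ i) no-open))
        (cong (_, does (open? f′ j)) box′-j)
        (cong₂ _,_ box-i (trans open-i (cong (_∨ does (open? f′ j)) box-j)))
        (cong₂ _,_ box-j (sym (openSame j (i≢j ∘ sym)))) μ≡ code-i code-j
      where
      gap : ∃ λ r → Missing r × f′ r ≡ suc a
      gap = missing (suc a) ℕ.≤-refl (ℕ.≤-reflexive (sym μ≡))
      q = proj₁ gap
      Mq : Missing q
      Mq = proj₁ (proj₂ gap)
      f′q<μ : f′ q < μ
      f′q<μ = subst₂ _<_ (sym (proj₂ (proj₂ gap))) (sym μ≡) ℕ.≤-refl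
      box-j : does (box? f j) ≡ true
      box-j = dec-true (box? f j) (missing⇒box-j (q , Mq))
      no-missing : ∀ {r} → Missing r → μ < f′ r → ⊥
      no-missing {r} M v = ℕ.<-asym f′q<μ (subst (λ z → μ < f′ z) (missing-unique M Mq) v)
      no-box : ¬ Box f′ i
      no-box b = let r , M , v = box′-i⇒missing b in no-missing M v
      -- Let rows r < s witness a later box. If the value in row s is below b, then s is a second
      -- missing row besides `q`. If it is above b, rows i, j, q, r, s form 13254 when q precedes r,
      -- and rows i, r, q, s form 1432 or 1423 when r precedes q.
      no-open : ¬ Open f′ i
      no-open (x , r , s , x≤i , i<r , r<s , v , v′) with ℕ.<-cmp (f′ s) b
      ... | tri< s<b _ _ = no-missing (j<s , ℕ.<-trans (a<f′ x≤i) v , s<b) (ℕ.≤-<-trans (μ≤f′ x≤i) v)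
        where j<s = ℕ.<-trans (after-i x≤i i<r (ℕ.<-trans v v′)) r<s
      ... | tri≈ _ e _ = ℕ.<-irrefl (cong toℕ (f′-injective (trans f′i (sym e)))) (ℕ.<-trans i<r r<s)
      ... | tri> _ _ b<s with ℕ.<-cmp (toℕ q) (toℕ r)
      ...   | tri≈ _ q≡r _ = ℕ.<-asym (ℕ.<-trans b<s v′) (subst (λ z → f′ z < b) (Fin.toℕ-injective q≡r) (proj₂ (proj₂ Mq)))
      ...   | tri< q<r _ _ = no13254 i j q r s i<j (proj₁ Mq) q<r r<s
                (subst (a <_) (later (proj₁ Mq)) (proj₁ (proj₂ Mq)))
                (subst (_< b) (later (proj₁ Mq)) (proj₂ (proj₂ Mq)))
                (subst (b <_) (later j<s) b<s) (subst₂ _<_ (later j<s) (later j<r) v′)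
        where
        j<r = after-i x≤i i<r (ℕ.<-trans v v′)
        j<s = ℕ.<-trans j<r r<s
      ...   | tri> _ _ r<q = no14 i r q s (ℕ.<-trans i<j j<r) r<q r<s
                (λ { q≡s → ℕ.<-asym b<s (subst (λ z → f′ z < b) q≡s (proj₂ (proj₂ Mq))) })
                (subst (a <_) (later (proj₁ Mq)) (proj₁ (proj₂ Mq)))
                (subst₂ _<_ (later (proj₁ Mq)) (later j<r) (ℕ.<-trans (proj₂ (proj₂ Mq)) (ℕ.<-trans b<s v′)))
                (subst (a <_) (later j<s) (ℕ.<-trans ascent b<s))
                (subst₂ _<_ (later j<s) (later j<r) v′)
        where
        j<r = after-i x≤i i<r (ℕ.<-trans v v′)
        j<s = ℕ.<-trans j<r r<s
      -- If the row before i were open, the box it waits for would lie in row i or further down;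
      -- both have just been excluded.
      closed : ∀ p → suc (toℕ p) ≡ toℕ k → ¬ Open f′ p
      closed p e (x , r , s , x≤p , p<r , r<s , v , v′) with toℕ r ℕ.≟ toℕ i
      ... | yes r≡i with refl ← Fin.toℕ-injective r≡i =
        no-box (x , s , ℕ.≤-<-trans x≤p p<r , r<s , v , v′)
      ... | no r≢i = no-open (x , r , s , ℕ.≤-trans x≤p (ℕ.≤-trans (ℕ.n≤1+n _) (ℕ.≤-reflexive (trans e (sym toℕi)))) ,
              ℕ.≤∧≢⇒< (ℕ.≤-trans (ℕ.≤-reflexive (trans toℕi (sym e))) p<r) (r≢i ∘ sym) , r<s , v , v′)
    ... | tri> _ _ a+2<μ = ⊥-elim (ℕ.1+n≢n (trans (sym e₂) (trans (cong f′ (missing-unique M₂ M₁)) e₁)))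
      where
      g₁ = missing (suc a) ℕ.≤-refl (ℕ.<-trans ℕ.≤-refl a+2<μ)
      g₂ = missing (suc (suc a)) (ℕ.n≤1+n _) a+2<μ
      M₁ = proj₁ (proj₂ g₁)
      M₂ = proj₁ (proj₂ g₂)
      e₁ = proj₂ (proj₂ g₁)
      e₂ = proj₂ (proj₂ g₂)

-- Pattern transfer, termination, and the formula for the coefficients of 𝔊_w.

module GrothendieckCoefficients where

  open DividedDifferences
  open ScanPolynomials
  open FirstAscents
  open import Data.Nat using (_≤_; _<_)
  open import Data.Fin using (#_)
  open import Data.Fin.Permutation using (Permutation′; _⟨$⟩ʳ_; _⟨$⟩ˡ_; _∘ₚ_; transpose; inverseʳ; inverseˡ)
  open import Data.List as List using (List)
  open import Data.Vec.Properties using (tabulate-cong)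
  open import Data.Empty using (⊥)
  open import Function using (flip)
  open import Function.Bundles using (Equivalence)
  open import Level using (0ℓ)
  open import Function.Definitions using (Injective)
  open import Relation.Binary.Core using (Rel)
  open import Relation.Binary.Definitions using (Transitive; tri<; tri≈; tri>)
  open import Relation.Nullary.Decidable using (_×-dec_; _→-dec_; dec-false; from-yes)

  consecutive⇒monotone : ∀ {m} (R : Rel ℕ 0ℓ) → Transitive R → (g : Fin (suc m) → ℕ) →
    (∀ x → R (g (inject₁ x)) (g (suc x))) → ∀ {x y} → x Fin.< y → R (g x) (g y)
  consecutive⇒monotone R tr g h {zero} {suc zero} _ = h zero
  consecutive⇒monotone R tr g h {zero} {suc (suc y)} _ =
    tr (h zero) (consecutive⇒monotone R tr (g ∘ suc) (h ∘ suc) z<s)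
  consecutive⇒monotone {suc m} R tr g h {suc x} {suc y} (s≤s lt) =
    consecutive⇒monotone R tr (g ∘ suc) (h ∘ suc) lt

  -- σ inverts τ, that is, it lists the positions by increasing value. Then only neighbouring
  -- positions and neighbouring values need to be compared, and transitivity gives the rest.
  contains : ∀ {n m} (w : Permutation′ n) (τ : Vec (Fin (suc m)) (suc m)) (σ : Fin (suc m) → Fin (suc m)) →
    (∀ a → σ (lookup τ a) ≡ a) → (ι : Fin (suc m) → Fin n) →
    (∀ x → ι (inject₁ x) Fin.< ι (suc x)) →
    (∀ x → oneLine w (ι (σ (inject₁ x))) < oneLine w (ι (σ (suc x)))) → Contains w τ
  contains w τ σ στ ι inc incσ =
    ι , (λ a b → consecutive⇒monotone _<_ ℕ.<-trans (toℕ ∘ ι) inc) , λ a b → mk⇔ (reflect a b) (values a b)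
    where
    value : Fin _ → ℕ
    value c = oneLine w (ι (σ c))
    value-mono : ∀ {c d} → c Fin.< d → value c < value d
    value-mono = consecutive⇒monotone _<_ ℕ.<-trans value incσ
    value-τ : ∀ a → value (lookup τ a) ≡ oneLine w (ι a)
    value-τ a = cong (oneLine w ∘ ι) (στ a)
    values : ∀ a b → lookup τ a Fin.< lookup τ b → oneLine w (ι a) < oneLine w (ι b)
    values a b lt = subst₂ _<_ (value-τ a) (value-τ b) (value-mono lt)
    reflect : ∀ a b → oneLine w (ι a) < oneLine w (ι b) → lookup τ a Fin.< lookup τ b
    reflect a b lt with Fin.<-cmp (lookup τ a) (lookup τ b)
    ... | tri< τa<τb _ _ = τa<τb
    ... | tri≈ _ e _ = contradiction (trans (sym (value-τ a)) (trans (cong value e) (value-τ b))) (ℕ.<⇒≢ lt)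
    ... | tri> _ _ τb<τa = contradiction (values b a τb<τa) (ℕ.<-asym lt)

  oneLine-injective : ∀ {n} (w : Permutation′ n) → Injective _≡_ _≡_ (oneLine w)
  oneLine-injective w e = trans (sym (inverseˡ w)) (trans (cong (w ⟨$⟩ˡ_) (Fin.toℕ-injective e)) (inverseˡ w))

  oneLine-surjective : ∀ {n} (w : Permutation′ n) r q → q < oneLine w r → ∃ λ x → oneLine w x ≡ q
  oneLine-surjective w r q q<wr = w ⟨$⟩ˡ Fin.fromℕ< q<n , trans (cong toℕ (inverseʳ w)) (Fin.toℕ-fromℕ< q<n)
    where q<n = ℕ.<-trans q<wr (Fin.toℕ<n (w ⟨$⟩ʳ r))

  module Avoid14 {n} (w : Permutation′ n) (av : Avoids w p1432) (av′ : Avoids w p1423)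
    {p q : Fin n} (p<q : p Fin.< q) where

    sorted : ∀ r s → q Fin.< r → r Fin.< s → oneLine w p < oneLine w r → oneLine w r < oneLine w q →
             oneLine w p < oneLine w s → oneLine w s < oneLine w q → ⊥
    sorted r s q<r r<s pr rq ps sq with ℕ.<-cmp (oneLine w r) (oneLine w s)
    ... | tri≈ _ e _ = contradiction (oneLine-injective w e) λ { refl → ℕ.<-irrefl refl r<s }
    ... | tri< rs _ _ = av′ (contains w p1423 (lookup (# 0 ∷ # 2 ∷ # 3 ∷ # 1 ∷ []))
        (λ { zero → refl ; (suc zero) → refl ; (suc (suc zero)) → refl ; (suc (suc (suc zero))) → refl })
        (lookup (p ∷ q ∷ r ∷ s ∷ []))
        (λ { zero → p<q ; (suc zero) → q<r ; (suc (suc zero)) → r<s })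
        (λ { zero → pr ; (suc zero) → rs ; (suc (suc zero)) → sq }))
    ... | tri> _ _ sr = av (contains w p1432 (lookup (# 0 ∷ # 3 ∷ # 2 ∷ # 1 ∷ []))
        (λ { zero → refl ; (suc zero) → refl ; (suc (suc zero)) → refl ; (suc (suc (suc zero))) → refl })
        (lookup (p ∷ q ∷ r ∷ s ∷ []))
        (λ { zero → p<q ; (suc zero) → q<r ; (suc (suc zero)) → r<s })
        (λ { zero → ps ; (suc zero) → sr ; (suc (suc zero)) → rq }))

  avoids⇒No14 : ∀ {n} (w : Permutation′ n) → Avoids w p1432 → Avoids w p1423 → No14 (oneLine w)
  avoids⇒No14 w av av′ p q r s p<q q<r q<s r≢s pr rq ps sq with Fin.<-cmp r s
  ... | tri≈ _ e _ = r≢s e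
  ... | tri< r<s _ _ = sorted r s q<r r<s pr rq ps sq
    where
    open Avoid14 w av av′ p<q
  ... | tri> _ _ s<r = sorted s r q<s s<r ps sq pr rq
    where
    open Avoid14 w av av′ p<q

  avoids⇒No13254 : ∀ {n} (w : Permutation′ n) → Avoids w p13254 → No13254 (oneLine w)
  avoids⇒No13254 w av p q r s t p<q q<r r<s s<t pr rq qt ts =
    av (contains w p13254 (lookup (# 0 ∷ # 2 ∷ # 1 ∷ # 4 ∷ # 3 ∷ []))
      (λ { zero → refl ; (suc zero) → refl ; (suc (suc zero)) → refl ; (suc (suc (suc zero))) → refl
         ; (suc (suc (suc (suc zero)))) → refl })
      (lookup (p ∷ q ∷ r ∷ s ∷ t ∷ []))
      (λ { zero → p<q ; (suc zero) → q<r ; (suc (suc zero)) → r<s ; (suc (suc (suc zero))) → s<t })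
      (λ { zero → pr ; (suc zero) → rq ; (suc (suc zero)) → qt ; (suc (suc (suc zero))) → ts }))

  -- Holds for the three patterns because each begins with its least entry, which takes part in no
  -- inversion and so precedes and undercuts all of them.
  Guarded : ∀ {k} → Vec (Fin k) k → Set
  Guarded τ = ∀ a b → a Fin.< b → lookup τ b Fin.< lookup τ a →
              ∃ λ c → c Fin.< a × lookup τ c Fin.< lookup τ b

  guarded? : ∀ {k} (τ : Vec (Fin k) k) → Dec (Guarded τ)
  guarded? τ = Fin.all? λ a → Fin.all? λ b → (a Fin.<? b) →-dec (lookup τ b Fin.<? lookup τ a) →-dec
    (Fin.any? λ c → (c Fin.<? a) ×-dec (lookup τ c Fin.<? lookup τ b))

  IsFirstAscent : ∀ {m} → Permutation′ (suc m) → Fin m → Set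
  IsFirstAscent w k = oneLine w (inject₁ k) < oneLine w (suc k) ×
                      (∀ k′ → k′ Fin.< k → ¬ (oneLine w (inject₁ k′) < oneLine w (suc k′)))

  swapped : ∀ {m} → Permutation′ (suc m) → Fin m → Permutation′ (suc m)
  swapped w k = transpose (inject₁ k) (suc k) ∘ₚ w

  -- An occurrence using the new descent would need a smaller entry before it, in the descending prefix.
  avoids-swapped : ∀ {m l} (w : Permutation′ (suc m)) (k : Fin m) (τ : Vec (Fin l) l) → Guarded τ →
    IsFirstAscent w k → Avoids w τ → Avoids (swapped w k) τ
  avoids-swapped w k pat guarded (ascent , first) av (ι , mono , iso) = av
    (τ ∘ ι , (λ a b a<b → τ-mono-< (mono a b a<b) (no-ij a b a<b)) , iso)
    where
    open Adjacent k
    open FirstAscent (oneLine w) (oneLine (swapped w k)) k (λ _ → refl) (oneLine-injective w) ascent first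
    no-ij : ∀ a b → a Fin.< b → ¬ (ι a ≡ i × ι b ≡ j)
    no-ij x y x<y (ex , ey) with guarded x y x<y (Equivalence.to (iso y x)
      (subst₂ (λ u v → oneLine (swapped w k) u < oneLine (swapped w k) v) (sym ey) (sym ex)
        (subst₂ _<_ (sym f′j) (sym f′i) ascent)))
    ... | z , z<x , τz<τy = ℕ.<-asym
      (a<f′ (subst (ι z Fin.≤_) ex (ℕ.<⇒≤ (mono z x z<x))))
      (subst (oneLine (swapped w k) (ι z) <_) (trans (cong (oneLine (swapped w k)) ey) f′j)
        (Equivalence.from (iso z y) τz<τy))

  step-swapped : ∀ {m} (w : Permutation′ (suc m)) (k : Fin m) → IsFirstAscent w k →
    Avoids w p1432 → Avoids w p1423 → Avoids w p13254 →
    Step k false (labels (oneLine (swapped w k))) (code (oneLine (swapped w k)))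
                 (labels (oneLine w)) (code (oneLine w))
  step-swapped w k (ascent , first) av₁ av₂ av₃ = AvoidingAscent.step
    (oneLine w) (oneLine (swapped w k)) k (λ _ → refl) (oneLine-injective w) ascent first
    (oneLine-surjective w) (avoids⇒No14 w av₁ av₂) (avoids⇒No13254 w av₃)

  countAbove : ∀ {n} → ℕ → (Fin n → ℕ) → ℕ
  countAbove {zero} c f = 0
  countAbove {suc n} c f = (if c <ᵇ f zero then 1 else 0) ℕ.+ countAbove c (f ∘ suc)

  -- The number of swaps that separate w from w₀. Each first-ascent swap lowers it, so it bounds the
  -- fuel that is needed.
  noninversions : ∀ {n} → (Fin n → ℕ) → ℕ
  noninversions {zero} f = 0
  noninversions {suc n} f = countAbove (f zero) (f ∘ suc) ℕ.+ noninversions (f ∘ suc)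

  countAbove-≤ : ∀ {n} c (f : Fin n → ℕ) → countAbove c f ≤ n
  countAbove-≤ {zero} c f = z≤n
  countAbove-≤ {suc n} c f with c <ᵇ f zero
  ... | true = s≤s (countAbove-≤ c (f ∘ suc))
  ... | false = ℕ.m≤n⇒m≤1+n (countAbove-≤ c (f ∘ suc))

  noninversions-≤ : ∀ {n} (f : Fin n → ℕ) → noninversions f ≤ n ℕ.* n
  noninversions-≤ {zero} f = z≤n
  noninversions-≤ {suc n} f = ℕ.m≤n⇒m≤1+n (ℕ.+-mono-≤ (countAbove-≤ (f zero) (f ∘ suc))
    (ℕ.≤-trans (noninversions-≤ (f ∘ suc)) (ℕ.*-monoʳ-≤ n (ℕ.n≤1+n n))))

  countAbove-cong : ∀ {n} c {f g : Fin n → ℕ} → f ≗ g → countAbove c f ≡ countAbove c g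
  countAbove-cong {zero} c e = refl
  countAbove-cong {suc n} c e =
    cong₂ (λ x y → (if c <ᵇ x then 1 else 0) ℕ.+ y) (e zero) (countAbove-cong c (e ∘ suc))

  noninversions-cong : ∀ {n} {f g : Fin n → ℕ} → f ≗ g → noninversions f ≡ noninversions g
  noninversions-cong {zero} e = refl
  noninversions-cong {suc n} {f} {g} e = cong₂ ℕ._+_
    (trans (countAbove-cong (f zero) (e ∘ suc)) (cong (λ c → countAbove c (g ∘ suc)) (e zero)))
    (noninversions-cong (e ∘ suc))

  record SwappedAt {m} (k : Fin m) (f f′ : Fin (suc m) → ℕ) : Set where
    field
      fst : f′ (inject₁ k) ≡ f (suc k)
      snd : f′ (suc k) ≡ f (inject₁ k)
      rest : ∀ r → r ≢ inject₁ k → r ≢ suc k → f′ r ≡ f r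

  SwappedAt-suc : ∀ {m} {k : Fin m} {f f′} → SwappedAt (suc k) f f′ → SwappedAt k (f ∘ suc) (f′ ∘ suc)
  SwappedAt-suc S = record
    { fst = S.fst ; snd = S.snd
    ; rest = λ r a b → S.rest (suc r) (a ∘ Fin.suc-injective) (b ∘ Fin.suc-injective) }
    where module S = SwappedAt S

  swap-front : ∀ x y z → x ℕ.+ (y ℕ.+ z) ≡ y ℕ.+ (x ℕ.+ z)
  swap-front x y z = trans (sym (ℕ.+-assoc x y z)) (trans (cong (ℕ._+ z) (ℕ.+-comm x y)) (ℕ.+-assoc y x z))

  countAbove-swap : ∀ {m} c (k : Fin m) {f f′} → SwappedAt k f f′ → countAbove c f′ ≡ countAbove c f
  countAbove-swap {suc m} c zero {f} {f′} S
    rewrite SwappedAt.fst S | SwappedAt.snd S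
      | countAbove-cong c (λ r → SwappedAt.rest S (suc (suc r)) (λ ()) (λ ())) =
    swap-front (if c <ᵇ f (suc zero) then 1 else 0) (if c <ᵇ f zero then 1 else 0) _
  countAbove-swap {suc m} c (suc k) {f} S
    rewrite SwappedAt.rest S zero (λ ()) (λ ()) =
    cong ((if c <ᵇ f zero then 1 else 0) ℕ.+_) (countAbove-swap c k (SwappedAt-suc S))

  noninversions-swap : ∀ {m} (k : Fin m) {f f′} → SwappedAt k f f′ → f (inject₁ k) < f (suc k) →
                       noninversions f′ < noninversions f
  noninversions-swap {suc m} zero {f} {f′} S lt
    rewrite SwappedAt.fst S | SwappedAt.snd S
      | countAbove-cong (f zero) (λ r → SwappedAt.rest S (suc (suc r)) (λ ()) (λ ()))
      | countAbove-cong (f (suc zero)) (λ r → SwappedAt.rest S (suc (suc r)) (λ ()) (λ ()))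
      | noninversions-cong (λ r → SwappedAt.rest S (suc (suc r)) (λ ()) (λ ()))
    with f zero <ᵇ f (suc zero) | ℕ.<⇒<ᵇ lt | f (suc zero) <ᵇ f zero in e
  ... | true | _ | false = s≤s (ℕ.≤-reflexive (swap-front (countAbove (f (suc zero)) (λ r → f (suc (suc r)))) (countAbove (f zero) (λ r → f (suc (suc r)))) _))
  ... | true | _ | true = contradiction (ℕ.<ᵇ⇒< _ _ (subst Data.Bool.T (sym e) _)) (ℕ.<-asym lt)
  noninversions-swap {suc m} (suc k) {f} {f′} S lt
    rewrite SwappedAt.rest S zero (λ ()) (λ ()) | countAbove-swap (f zero) k (SwappedAt-suc S) =
    ℕ.+-monoʳ-< (countAbove (f zero) (f ∘ suc)) (noninversions-swap k (SwappedAt-suc S) lt)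

  swapped-SwappedAt : ∀ {m} (w : Permutation′ (suc m)) k → SwappedAt k (oneLine w) (oneLine (swapped w k))
  swapped-SwappedAt w k = record
    { fst = cong (oneLine w) τi ; snd = cong (oneLine w) τj ; rest = λ r a b → cong (oneLine w) (τ-other a b) }
    where open Adjacent k

  NoAscent : ∀ {m} → Permutation′ (suc m) → Set
  NoAscent w = ∀ x → ¬ (oneLine w (inject₁ x) < oneLine w (suc x))

  firstAscent-view : ∀ {m} (w : Permutation′ (suc m)) →
    (firstAscent w (adjacent (suc m)) ≡ nothing × NoAscent w)
    ⊎ (∃ λ k → firstAscent w (adjacent (suc m)) ≡ just (inject₁ k , suc k) × IsFirstAscent w k)
  firstAscent-view {m} w = go (λ x → x)
    where
    pair : Fin m → Fin (suc m) × Fin (suc m)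
    pair k = inject₁ k , suc k
    Ascent : Fin m → Set
    Ascent k = oneLine w (inject₁ k) < oneLine w (suc k)
    go : ∀ {p} (h : Fin p → Fin m) → let fa = firstAscent w (List.map pair (List.tabulate h)) in
         (fa ≡ nothing × (∀ x → ¬ Ascent (h x)))
         ⊎ (∃ λ x → fa ≡ just (pair (h x)) × Ascent (h x) × (∀ y → y Fin.< x → ¬ Ascent (h y)))
    go {zero} h = inj₁ (refl , λ ())
    go {suc p} h with (w ⟨$⟩ʳ inject₁ (h zero)) Fin.<? (w ⟨$⟩ʳ suc (h zero))
    ... | yes asc = inj₂ (zero , refl , asc , λ y ())
    ... | no nasc with go (h ∘ suc)
    ...   | inj₁ (e , none) = inj₁ (e , λ { zero → nasc ; (suc x) → none x })
    ...   | inj₂ (x , e , asc , before) =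
      inj₂ (suc x , e , asc , λ { zero _ → nasc ; (suc y) (s≤s lt) → before y lt })

  grothFuel-nothing : ∀ {n} fuel (w : Permutation′ n) → firstAscent w (adjacent n) ≡ nothing →
    grothFuel fuel w ≡ (staircase n , 1ℤ) List.∷ List.[]
  grothFuel-nothing fuel w e rewrite e = refl

  grothFuel-just : ∀ {n} fuel (w : Permutation′ n) {i j} → firstAscent w (adjacent n) ≡ just (i , j) →
    grothFuel (suc fuel) w ≡ isobaric i j (grothFuel fuel (transpose i j ∘ₚ w))
  grothFuel-just fuel w e rewrite e = refl

  -- A strictly decreasing sequence loses at least one per row. Squeezed between m at the start and
  -- 0 at the end, it has the value m - r in row r, which identifies w₀.
  descending-lower : ∀ {m} (f : Fin (suc m) → ℕ) → (∀ x → f (suc x) < f (inject₁ x)) → ∀ r → m ≤ f r ℕ.+ toℕ r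
  descending-lower {zero} f d r = z≤n
  descending-lower {suc m} f d zero = subst (suc m ≤_) (sym (ℕ.+-identityʳ (f zero)))
    (ℕ.≤-trans (s≤s (subst (m ≤_) (ℕ.+-identityʳ (f (suc zero))) (descending-lower (f ∘ suc) (d ∘ suc) zero))) (d zero))
  descending-lower {suc m} f d (suc r) =
    subst (suc m ≤_) (sym (ℕ.+-suc (f (suc r)) (toℕ r))) (s≤s (descending-lower (f ∘ suc) (d ∘ suc) r))

  descending-upper : ∀ {m} (f : Fin (suc m) → ℕ) → (∀ x → f (suc x) < f (inject₁ x)) → ∀ r → f r ℕ.+ toℕ r ≤ f zero
  descending-upper f d zero = ℕ.≤-reflexive (ℕ.+-identityʳ (f zero))
  descending-upper {suc m} f d (suc r) = subst (_≤ f zero) (sym (ℕ.+-suc (f (suc r)) (toℕ r)))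
    (ℕ.≤-trans (s≤s (descending-upper (f ∘ suc) (d ∘ suc) r)) (d zero))

  -- Without boxes and open blocks both outcomes of a row have the same continuation, so the
  -- coefficient at the upper exponent is a difference of equal terms.
  scan-unlabelled : ∀ {n} (ls : Vec ℕ n) α →
    scan 0 (tabulate {n = n} (λ _ → false , false)) ls α ≡ monomial ls 1ℤ α
  scan-unlabelled [] [] = refl
  scan-unlabelled {suc n} (l ∷ ls) (a ∷ α) = trans (digit-diagonal l a _) (cong (if l ≡ᵇ a then_else 0ℤ) (scan-unlabelled ls α))
    where
    digit-diagonal : ∀ l a x → digit l a x x ≡ (if l ≡ᵇ a then x else 0ℤ)
    digit-diagonal zero zero x = refl
    digit-diagonal zero (suc zero) x = ℤ.+-inverseʳ x
    digit-diagonal zero (suc (suc a)) x = refl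
    digit-diagonal (suc l) zero x = refl
    digit-diagonal (suc l) (suc a) x = digit-diagonal l a x

  module _ {m} (w : Permutation′ (suc m)) (noAscent : NoAscent w) where

    private
      f = oneLine w

    descent : ∀ x → f (suc x) < f (inject₁ x)
    descent x = ℕ.≤∧≢⇒< (ℕ.≮⇒≥ (noAscent x)) λ e →
      ℕ.<-irrefl (cong toℕ (sym (oneLine-injective w e))) (s≤s (ℕ.≤-reflexive (Fin.toℕ-inject₁ x)))

    descending : ∀ {x y} → x Fin.< y → f y < f x
    descending = consecutive⇒monotone ℕ._>_ (flip ℕ.<-trans) f descent

    labels-longest : labels f ≡ tabulate (λ _ → false , false)
    labels-longest = tabulate-cong λ r → cong₂ _,_
      (dec-false (box? f r) λ { (x , y , x<r , r<y , v , _) → ℕ.<-asym v (descending (ℕ.<-trans x<r r<y)) })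
      (dec-false (open? f r) λ { (x , y , z , x≤r , r<y , y<z , v , _) →
        ℕ.<-asym v (descending (ℕ.≤-<-trans x≤r (ℕ.<-trans r<y y<z))) })

    code-longest : code f ≡ staircase (suc m)
    code-longest = tabulate-cong λ r → trans (min r) (value r)
      where
      min : ∀ r → minUpTo f r ≡ f r
      min r with minUpTo-attained f r
      ... | x , x≤r , e with toℕ x ℕ.≟ toℕ r
      ...   | yes x≡r = trans (sym e) (cong f (Fin.toℕ-injective x≡r))
      ...   | no x≢r = contradiction (subst (_≤ f r) (sym e) (minUpTo-≤ f r r ℕ.≤-refl))
                         (ℕ.<⇒≱ (descending (ℕ.≤∧≢⇒< x≤r x≢r)))
      value : ∀ r → f r ≡ m ∸ toℕ r
      value r = trans (sym (ℕ.m+n∸n≡m (f r) (toℕ r))) (cong (_∸ toℕ r) (ℕ.≤-antisym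
        (ℕ.≤-trans (descending-upper f descent r) (ℕ.≤-pred (Fin.toℕ<n (w ⟨$⟩ʳ zero))))
        (descending-lower f descent r)))

  -- By induction both sides are images under π_k of the same coefficient function, and uniqueness
  -- in the isobaric relation identifies them.
  coeff-grothFuel : ∀ {m} fuel (w : Permutation′ (suc m)) → noninversions (oneLine w) ≤ fuel →
    Avoids w p1432 → Avoids w p1423 → Avoids w p13254 → ∀ α →
    coeff (grothFuel fuel w) α ≡ scan 0 (labels (oneLine w)) (code (oneLine w)) α
  coeff-grothFuel {m} fuel w bound av₁ av₂ av₃ α with firstAscent-view w
  ... | inj₁ (e , noAscent) = begin
    coeff (grothFuel fuel w) α                               ≡⟨ cong (λ p → coeff p α) (grothFuel-nothing fuel w e) ⟩
    coeff ((staircase (suc m) , 1ℤ) List.∷ List.[]) α         ≡⟨ coeff-∷ (staircase (suc m)) 1ℤ List.[] α ⟩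
    monomial (staircase (suc m)) 1ℤ α ℤ.+ 0ℤ                  ≡⟨ ℤ.+-identityʳ _ ⟩
    monomial (staircase (suc m)) 1ℤ α                         ≡⟨ scan-unlabelled (staircase (suc m)) α ⟨
    scan 0 (tabulate (λ _ → false , false)) (staircase (suc m)) α
      ≡⟨ cong₂ (λ L l → scan 0 L l α) (labels-longest w noAscent) (code-longest w noAscent) ⟨
    scan 0 (labels (oneLine w)) (code (oneLine w)) α ∎
    where open ≡-Reasoning
  coeff-grothFuel {m} zero w bound av₁ av₂ av₃ α | inj₂ (k , e , first) =
    contradiction (ℕ.<-≤-trans (noninversions-swap k (swapped-SwappedAt w k) (proj₁ first)) bound) λ ()
  coeff-grothFuel {m} (suc fuel) w bound av₁ av₂ av₃ α | inj₂ (k , e , first) =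
    trans (cong (λ p → coeff p α) (grothFuel-just fuel w e))
      (IsIsobaric-unique k
        (IsIsobaric-cong k (coeff-grothFuel fuel (swapped w k)
            (ℕ.≤-pred (ℕ.<-≤-trans (noninversions-swap k (swapped-SwappedAt w k) (proj₁ first)) bound))
            (avoids-swapped w k p1432 (from-yes (guarded? p1432)) first av₁)
            (avoids-swapped w k p1423 (from-yes (guarded? p1423)) first av₂)
            (avoids-swapped w k p13254 (from-yes (guarded? p13254)) first av₃))
          (λ _ → refl) (isobaric-isIsobaric k (grothFuel fuel (swapped w k))))
        (Step-isobaric 0 (λ _ → refl) (step-swapped w k first av₁ av₂ av₃)) α)

  coeff-𝔊 : ∀ {n} (w : Permutation′ n) → Avoids w p1432 → Avoids w p1423 → Avoids w p13254 → ∀ α →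
    coeff (𝔊 w) α ≡ scan 0 (labels (oneLine w)) (code (oneLine w)) α
  coeff-𝔊 {zero} w _ _ _ [] = refl
  coeff-𝔊 {suc m} w = coeff-grothFuel (suc m ℕ.* suc m) w (noninversions-≤ (oneLine w))

-- Closed labellings and the signs of the coefficients.

module SignedScan where

  open DividedDifferences
  open ScanPolynomials
  open FirstAscents
  open import Data.Bool.Properties using (∨-zeroʳ)
  open import Data.Nat using (_≤_; _<_)
  open import Data.Integer using (_+_; _-_; -_)
  open import Data.Integer.Tactic.RingSolver using (solve-∀)
  open import Data.List using ([]; _∷_)
  open import Relation.Nullary.Decidable using (dec-true)

  active : Label → Bool
  active (β , κ) = β ∨ κ

  width : Label → ℕ
  width L = if active L then 1 else 0

  -- Every open block is eventually closed; the flag tells whether a block is open at the start.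
  Closed : ∀ {n} → Bool → Vec Label n → Set
  Closed e [] = e ≡ false
  Closed e (L ∷ Ls) = (e ≡ true → active L ≡ true) × Closed (proj₂ L) Ls

  Closed-tabulate : ∀ {n} e (L : Fin n → Label) →
    (e ≡ true → ∃ λ r → toℕ r ≡ 0 × active (L r) ≡ true) →
    (∀ r → proj₂ (L r) ≡ true → ∃ λ r′ → toℕ r′ ≡ suc (toℕ r) × active (L r′) ≡ true) →
    Closed e (tabulate L)
  Closed-tabulate {zero} false L h₀ h = refl
  Closed-tabulate {zero} true L h₀ h with h₀ refl
  ... | () , _
  Closed-tabulate {suc n} e L h₀ h = head , Closed-tabulate (proj₂ (L zero)) (L ∘ suc) (λ e → first (h zero e))
    λ r e → rest r (h (suc r) e)
    where
    head : e ≡ true → active (L zero) ≡ true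
    head e≡ with h₀ e≡
    ... | zero , _ , a = a
    first : (∃ λ r′ → toℕ r′ ≡ 1 × active (L r′) ≡ true) → ∃ λ r → toℕ r ≡ 0 × active (L (suc r)) ≡ true
    first (suc r , e , a) = r , ℕ.suc-injective e , a
    rest : ∀ r → (∃ λ r′ → toℕ r′ ≡ suc (suc (toℕ r)) × active (L r′) ≡ true) →
           ∃ λ r′ → toℕ r′ ≡ suc (toℕ r) × active (L (suc r′)) ≡ true
    rest r (suc r′ , e , a) = r′ , ℕ.suc-injective e , a

  -- If row r is open, the row y of the box it waits for is either the next row, which is then
  -- active through its box, or lies beyond it, and then the next row is open too.
  labels-closed : ∀ {n} (f : Fin n → ℕ) → Closed false (labels f)
  labels-closed {n} f = Closed-tabulate false (label f) (λ ()) λ r → next-active r (open? f r)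
    where
    next-active : ∀ r (o : Dec (Open f r)) → does o ≡ true →
                  ∃ λ r′ → toℕ r′ ≡ suc (toℕ r) × active (label f r′) ≡ true
    next-active r (yes (x , y , z , x≤r , r<y , y<z , v , v′)) _ = r⁺ , toℕr⁺ , is-active
      where
      r⁺<n = ℕ.≤-<-trans r<y (Fin.toℕ<n y)
      r⁺ = Fin.fromℕ< r⁺<n
      toℕr⁺ : toℕ r⁺ ≡ suc (toℕ r)
      toℕr⁺ = Fin.toℕ-fromℕ< r⁺<n
      x<r⁺ : x Fin.< r⁺
      x<r⁺ = subst (toℕ x <_) (sym toℕr⁺) (s≤s x≤r)
      is-active : active (label f r⁺) ≡ true
      is-active with toℕ y ℕ.≟ toℕ r⁺
      ... | yes e = cong (_∨ does (open? f r⁺)) (dec-true (box? f r⁺)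
            (x , z , x<r⁺ , subst (_< toℕ z) e y<z , v , subst (λ u → f z < f u) (Fin.toℕ-injective e) v′))
      ... | no ne = trans (cong (does (box? f r⁺) ∨_) (dec-true (open? f r⁺)
            (x , y , z , ℕ.<⇒≤ x<r⁺ , ℕ.≤∧≢⇒< (subst (_≤ toℕ y) (sym toℕr⁺) r<y) (ne ∘ sym) , y<z , v , v′)))
            (∨-zeroʳ _)

  -- Runs of the scan that never fail. A success counts only in an active row: in a row outside all
  -- blocks the two outcomes have equal continuations, so the upper coefficient is zero.
  data Feasible : ∀ {n} → ℕ → Vec Label n → Vec ℕ n → Exp n → Set where
    [] : ∀ {s} → Feasible s [] [] []
    keep : ∀ {n s t L l} {Ls : Vec Label n} {ls α} → next L s ≡ just t → Feasible t Ls ls α →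
           Feasible s (L ∷ Ls) (l ∷ ls) (l ∷ α)
    bump : ∀ {n s t L l} {Ls : Vec Label n} {ls α} → active L ≡ true → next L (suc s) ≡ just t →
           Feasible t Ls ls α → Feasible s (L ∷ Ls) (l ∷ ls) (suc l ∷ α)

  data PickView (l : ℕ) : ℕ → Set₁ where
    isLow : PickView l l
    isHigh : PickView l (suc l)
    isOut : ∀ {a} → (∀ {A : Set} (o x y : A) → pick o l a x y ≡ o) → PickView l a

  pick-low : ∀ {A : Set} (o : A) l x y → pick o l l x y ≡ x
  pick-low o zero x y = refl
  pick-low o (suc l) x y = pick-low o l x y

  pick-high : ∀ {A : Set} (o : A) l x y → pick o l (suc l) x y ≡ y
  pick-high o zero x y = refl
  pick-high o (suc l) x y = pick-high o l x y

  pickView : ∀ l a → PickView l a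
  pickView zero zero = isLow
  pickView zero (suc zero) = isHigh
  pickView zero (suc (suc a)) = isOut λ _ _ _ → refl
  pickView (suc l) zero = isOut λ _ _ _ → refl
  pickView (suc l) (suc a) with pickView l a
  ... | isLow = isLow
  ... | isHigh = isHigh
  ... | isOut h = isOut h

  bit : Bool → ℕ
  bit b = if b then 1 else 0

  -- Boxes in the rest of the current block, and in the blocks after it.
  boxes later : ∀ {n} → Vec Label n → ℕ
  boxes [] = 0
  boxes ((β , κ) ∷ Ls) = bit β ℕ.+ (if κ then boxes Ls else 0)
  later [] = 0
  later ((β , κ) ∷ Ls) = if κ then later Ls else boxes Ls ℕ.+ later Ls

  -- Absolute value of scan: once the surplus covers the remaining boxes, the rest of the block
  -- contributes a factor 1; before that, the two terms of a digit have opposite signs.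
  abs : ∀ {n} → ℕ → Vec Label n → Vec ℕ n → Exp n → ℕ
  abs? : ∀ {n} → Maybe ℕ → Vec Label n → Vec ℕ n → Exp n → ℕ
  abs s [] [] [] = 1
  abs s (L ∷ Ls) (l ∷ ls) (a ∷ α) = pick 0 l a (abs? (next L s) Ls ls α)
    (if s <ᵇ boxes (L ∷ Ls) then abs? (next L (suc s)) Ls ls α ℕ.+ abs? (next L s) Ls ls α else 0)
  abs? nothing Ls ls α = 0
  abs? (just s) Ls ls α = abs s Ls ls α

  scan-saturated : ∀ {n} s (Ls : Vec Label n) ls α → boxes Ls ≤ s → scan (suc s) Ls ls α ≡ scan s Ls ls α
  scan-next-saturated : ∀ {n} s L (Ls : Vec Label n) ls α → boxes (L ∷ Ls) ≤ s →
    scan? (next L (suc s)) Ls ls α ≡ scan? (next L s) Ls ls α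
  scan-saturated s [] [] [] _ = refl
  scan-saturated s (L ∷ Ls) (l ∷ ls) (a ∷ α) le =
    cong₂ (digit l a) (scan-next-saturated s L Ls ls α le) (scan-next-saturated (suc s) L Ls ls α (ℕ.m≤n⇒m≤1+n le))
  scan-next-saturated s (false , false) Ls ls α le = refl
  scan-next-saturated s (false , true) Ls ls α le = scan-saturated s Ls ls α le
  scan-next-saturated (suc s) (true , false) Ls ls α le = refl
  scan-next-saturated (suc s) (true , true) Ls ls α (s≤s le) = scan-saturated s Ls ls α le

  signed : ℕ → ℕ → ℤ
  signed zero z = ℤ.+ z
  signed (suc e) z = - signed e z

  signed-0 : ∀ e → signed e 0 ≡ 0ℤ
  signed-0 zero = refl
  signed-0 (suc e) = cong -_ (signed-0 e)

  signed-+ : ∀ e x y → signed e (x ℕ.+ y) ≡ signed e x + signed e y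
  signed-+ zero x y = refl
  signed-+ (suc e) x y = trans (cong -_ (signed-+ e x y)) (ℤ.neg-distrib-+ (signed e x) _)

  excess : ∀ {n} → Vec ℕ n → Exp n → ℕ
  excess [] [] = 0
  excess (l ∷ ls) (a ∷ α) = (a ∸ l) ℕ.+ excess ls α

  ∸-suc : ∀ {s r} → s < r → r ∸ s ≡ suc (r ∸ suc s)
  ∸-suc {zero} {suc r} _ = refl
  ∸-suc {suc s} {suc r} (s≤s lt) = ∸-suc lt

  -- The sign depends on the successes taken plus the boxes still unpaid; it is positive where the
  -- two balance. As long as boxes are unpaid, one more unit of surplus changes the parity, so the
  -- difference in an upper digit adds absolute values.
  scan-signed : ∀ {n} s (Ls : Vec Label n) ls α →
    scan s Ls ls α ≡ signed (excess ls α ℕ.+ ((boxes Ls ∸ s) ℕ.+ later Ls)) (abs s Ls ls α)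
  scan-next-signed : ∀ {n} s L (Ls : Vec Label n) ls α →
    scan? (next L s) Ls ls α ≡
    signed (excess ls α ℕ.+ ((boxes (L ∷ Ls) ∸ s) ℕ.+ later (L ∷ Ls))) (abs? (next L s) Ls ls α)
  scan-next-signed s (false , false) Ls ls α rewrite ℕ.0∸n≡0 s = scan-signed 0 Ls ls α
  scan-next-signed s (false , true) Ls ls α = scan-signed s Ls ls α
  scan-next-signed zero (true , κ) Ls ls α = sym (signed-0 (excess ls α ℕ.+ (boxes ((true , κ) ∷ Ls) ℕ.+ _)))
  scan-next-signed (suc s) (true , false) Ls ls α rewrite ℕ.0∸n≡0 s = scan-signed 0 Ls ls α
  scan-next-signed (suc s) (true , true) Ls ls α = scan-signed s Ls ls α
  scan-signed s [] [] [] rewrite ℕ.0∸n≡0 s = refl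
  scan-signed s (L ∷ Ls) (l ∷ ls) (a ∷ α) with pickView l a
  ... | isOut h = trans (h 0ℤ _ _) (sym (trans (cong (signed e) (h 0 _ _)) (signed-0 e)))
    where e = excess (l ∷ ls) (a ∷ α) ℕ.+ ((boxes (L ∷ Ls) ∸ s) ℕ.+ later (L ∷ Ls))
  ... | isLow rewrite pick-low 0ℤ l (scan? (next L s) Ls ls α) (scan? (next L (suc s)) Ls ls α - scan? (next L s) Ls ls α)
      | pick-low 0 l (abs? (next L s) Ls ls α)
          (if s <ᵇ boxes (L ∷ Ls) then abs? (next L (suc s)) Ls ls α ℕ.+ abs? (next L s) Ls ls α else 0)
      | ℕ.n∸n≡0 l = scan-next-signed s L Ls ls α
  ... | isHigh rewrite pick-high 0ℤ l (scan? (next L s) Ls ls α) (scan? (next L (suc s)) Ls ls α - scan? (next L s) Ls ls α)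
      | pick-high 0 l (abs? (next L s) Ls ls α)
          (if s <ᵇ boxes (L ∷ Ls) then abs? (next L (suc s)) Ls ls α ℕ.+ abs? (next L s) Ls ls α else 0)
      | ℕ.m+n∸n≡m 1 l
      with s <ᵇ boxes (L ∷ Ls) in lt
  ... | false = begin
    scan? (next L (suc s)) Ls ls α - scan? (next L s) Ls ls α
      ≡⟨ cong (_- scan? (next L s) Ls ls α) (scan-next-saturated s L Ls ls α (ℕ.≮⇒≥ (λ v → subst Data.Bool.T lt (ℕ.<⇒<ᵇ v)))) ⟩
    scan? (next L s) Ls ls α - scan? (next L s) Ls ls α ≡⟨ ℤ.+-inverseʳ (scan? (next L s) Ls ls α) ⟩
    0ℤ ≡⟨ signed-0 (suc (excess ls α ℕ.+ ((boxes (L ∷ Ls) ∸ s) ℕ.+ later (L ∷ Ls)))) ⟨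
    signed (suc (excess ls α ℕ.+ ((boxes (L ∷ Ls) ∸ s) ℕ.+ later (L ∷ Ls)))) 0 ∎
    where open ≡-Reasoning
  ... | true = begin
    scan? (next L (suc s)) Ls ls α - scan? (next L s) Ls ls α
      ≡⟨ cong₂ _-_ (scan-next-signed (suc s) L Ls ls α) (scan-next-signed s L Ls ls α) ⟩
    signed e₁ A₁ - signed e₀ A₀ ≡⟨ cong (λ e → signed e₁ A₁ - signed e A₀) e₀≡ ⟩
    signed e₁ A₁ - - signed e₁ A₀ ≡⟨ double-neg (signed e₁ A₁) (signed e₁ A₀) ⟩
    - - (signed e₁ A₁ + signed e₁ A₀) ≡⟨ cong (λ z → - - z) (signed-+ e₁ A₁ A₀) ⟨
    - - signed e₁ (A₁ ℕ.+ A₀) ≡⟨ cong (λ e → - signed e (A₁ ℕ.+ A₀)) e₀≡ ⟨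
    - signed e₀ (A₁ ℕ.+ A₀) ∎
    where
    open ≡-Reasoning
    A₁ = abs? (next L (suc s)) Ls ls α
    A₀ = abs? (next L s) Ls ls α
    e₁ = excess ls α ℕ.+ ((boxes (L ∷ Ls) ∸ suc s) ℕ.+ later (L ∷ Ls))
    e₀ = excess ls α ℕ.+ ((boxes (L ∷ Ls) ∸ s) ℕ.+ later (L ∷ Ls))
    e₀≡ : e₀ ≡ suc e₁
    e₀≡ = trans (cong (λ z → excess ls α ℕ.+ (z ℕ.+ later (L ∷ Ls)))
                   (∸-suc (ℕ.<ᵇ⇒< s _ (subst Data.Bool.T (sym lt) _))))
                (ℕ.+-suc (excess ls α) _)
    double-neg : ∀ x y → x - - y ≡ - - (x + y)
    double-neg = solve-∀

-- Nonzero coefficients are those at feasible exponents.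

module FeasibleExponents where

  open DividedDifferences
  open ScanPolynomials
  open FirstAscents
  open SignedScan
  open import Data.Nat using (_≤_; _<_)
  open import Data.Integer using (_+_)
  open import Data.List using ([]; _∷_)

  top : ∀ {n} → Vec Label n → Vec ℕ n → Exp n
  top [] [] = []
  top (L ∷ Ls) (l ∷ ls) = width L ℕ.+ l ∷ top Ls ls

  next-mono : ∀ L {s s′ t} → s ≤ s′ → next L s ≡ just t → ∃ λ t′ → t ≤ t′ × next L s′ ≡ just t′
  next-mono (false , false) le refl = 0 , z≤n , refl
  next-mono (false , true) le refl = _ , le , refl
  next-mono (true , false) (s≤s le) refl = 0 , z≤n , refl
  next-mono (true , true) (s≤s le) refl = _ , le , refl

  feasible-≤top : ∀ {n s} {Ls : Vec Label n} {ls α} → Feasible s Ls ls α → α ≤ᵥ top Ls ls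
  feasible-≤top [] = []
  feasible-≤top (keep _ F) = ℕ.m≤n+m _ _ ∷ feasible-≤top F
  feasible-≤top (bump {L = L} a _ F) rewrite a = ℕ.≤-refl ∷ feasible-≤top F

  -- Additional successes, like additional initial surplus, only raise the later surpluses.
  feasible-up : ∀ {n s s′} {Ls : Vec Label n} {ls α β} → s ≤ s′ → Feasible s Ls ls α →
                α ≤ᵥ β → β ≤ᵥ top Ls ls → Feasible s′ Ls ls β
  feasible-up le [] [] [] = []
  feasible-up {s′ = s′} {L ∷ Ls} {β = b ∷ β} le (keep {l = l} e F) (l≤b ∷ α≤β) (b≤ ∷ β≤) with ℕ.m≤n⇒m<n∨m≡n l≤b
  ... | inj₂ refl = let t′ , t≤t′ , e′ = next-mono L le e in keep e′ (feasible-up t≤t′ F α≤β β≤)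
  ... | inj₁ l<b with active L in act
  ...   | false = contradiction b≤ (ℕ.<⇒≱ l<b)
  ...   | true with refl ← ℕ.≤-antisym l<b b≤ =
    let t′ , t≤t′ , e′ = next-mono L (ℕ.m≤n⇒m≤1+n le) e in bump act e′ (feasible-up t≤t′ F α≤β β≤)
  feasible-up {s′ = s′} {L ∷ Ls} le (bump {l = l} act e F) (l≤b ∷ α≤β) (b≤ ∷ β≤) rewrite act with refl ← ℕ.≤-antisym l≤b b≤ =
    let t′ , t≤t′ , e′ = next-mono L (s≤s le) e in bump act e′ (feasible-up t≤t′ F α≤β β≤)

  feasible-digit : ∀ {n s t L l} {Ls : Vec Label n} {ls α} c → c ≤ width L → next L (c ℕ.+ s) ≡ just t →
                   Feasible t Ls ls α → Feasible s (L ∷ Ls) (l ∷ ls) (c ℕ.+ l ∷ α)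
  feasible-digit zero _ e F = keep e F
  feasible-digit {L = L} (suc c) c≤ e F with active L in act | c≤
  ... | true | s≤s z≤n = bump act e F

  feasible-suc : ∀ {n s} {Ls : Vec Label n} {ls α} → Feasible s Ls ls α → Feasible (suc s) Ls ls α
  feasible-suc F = feasible-up (ℕ.n≤1+n _) F (PW.refl ℕ.≤-refl) (feasible-≤top F)

  feasible-saturated : ∀ {n s} {Ls : Vec Label n} {ls α} → boxes Ls ≤ s →
                       Feasible (suc s) Ls ls α → Feasible s Ls ls α
  feasible-saturated le [] = []
  feasible-saturated {Ls = (false , false) ∷ Ls} le (keep refl F) = keep refl F
  feasible-saturated {Ls = (false , true) ∷ Ls} le (keep refl F) = keep refl (feasible-saturated le F)
  feasible-saturated {s = suc s} {(true , false) ∷ Ls} le (keep refl F) = keep refl F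
  feasible-saturated {s = suc s} {(true , true) ∷ Ls} (s≤s le) (keep refl F) = keep refl (feasible-saturated le F)
  feasible-saturated {Ls = (false , true) ∷ Ls} le (bump _ refl F) =
    bump refl refl (feasible-saturated (ℕ.m≤n⇒m≤1+n le) F)
  feasible-saturated {s = suc s} {(true , false) ∷ Ls} le (bump _ refl F) = bump refl refl F
  feasible-saturated {s = suc s} {(true , true) ∷ Ls} (s≤s le) (bump _ refl F) =
    bump refl refl (feasible-saturated (ℕ.m≤n⇒m≤1+n le) F)

  -- Minimal exponents in the rest of the current block.
  data Flat : ∀ {n} → Vec Label n → Vec ℕ n → Exp n → Set where
    [] : Flat [] [] []
    continue : ∀ {n β l} {Ls : Vec Label n} {ls α} → Flat Ls ls α → Flat ((β , true) ∷ Ls) (l ∷ ls) (l ∷ α)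
    close : ∀ {n β l} {Ls : Vec Label n} {ls α} → Feasible 0 Ls ls α → Flat ((β , false) ∷ Ls) (l ∷ ls) (l ∷ α)

  flat-head : ∀ {n L l a} {Ls : Vec Label n} {ls α} → Flat (L ∷ Ls) (l ∷ ls) (a ∷ α) → a ≡ l
  flat-head (continue _) = refl
  flat-head (close _) = refl

  flat⇒feasible : ∀ {n s} {Ls : Vec Label n} {ls α} → boxes Ls ≤ s → Flat Ls ls α → Feasible s Ls ls α
  flat⇒feasible le [] = []
  flat⇒feasible {Ls = (false , true) ∷ Ls} le (continue F) = keep refl (flat⇒feasible le F)
  flat⇒feasible {Ls = (true , true) ∷ Ls} (s≤s le) (continue F) = keep refl (flat⇒feasible le F)
  flat⇒feasible {Ls = (false , false) ∷ Ls} le (close F) = keep refl F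
  flat⇒feasible {Ls = (true , false) ∷ Ls} (s≤s le) (close F) = keep refl F

  -- A block can end only in an active row that does not continue, which is a row with a box.
  closed⇒boxes>0 : ∀ {n} (Ls : Vec Label n) → Closed true Ls → 0 < boxes Ls
  closed⇒boxes>0 ((true , κ) ∷ Ls) _ = z<s
  closed⇒boxes>0 ((false , true) ∷ Ls) (_ , C) = closed⇒boxes>0 Ls C
  closed⇒boxes>0 ((false , false) ∷ Ls) (a , _) with a refl
  ... | ()

  -- With one unit less, a run that takes no success in the rest of the block fails, and it fails
  -- only at the final box, in the last row of the block. Any success taken on the way replaces the
  -- missing unit in time.
  flat-or-feasible : ∀ {n t e} {Ls : Vec Label n} {ls α} → Closed e Ls → boxes Ls ≡ suc t →
                     Feasible (suc t) Ls ls α → Flat Ls ls α ⊎ Feasible t Ls ls α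
  flat-or-feasible {Ls = (true , false) ∷ Ls} C refl (keep refl F) = inj₁ (close F)
  flat-or-feasible {Ls = (true , false) ∷ Ls} C refl (bump _ refl F) = inj₂ (bump refl refl F)
  flat-or-feasible {Ls = (false , true) ∷ Ls} (_ , C) e (keep refl F) with flat-or-feasible C e F
  ... | inj₁ Z = inj₁ (continue Z)
  ... | inj₂ F′ = inj₂ (keep refl F′)
  flat-or-feasible {Ls = (false , true) ∷ Ls} (_ , C) e (bump _ refl F) =
    inj₂ (bump refl refl (feasible-saturated (ℕ.≤-reflexive e) F))
  flat-or-feasible {t = zero} {Ls = (true , true) ∷ Ls} (_ , C) e F =
    contradiction (ℕ.suc-injective e) (ℕ.>⇒≢ (closed⇒boxes>0 Ls C))
  flat-or-feasible {t = suc t} {Ls = (true , true) ∷ Ls} (_ , C) e (keep refl F)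
    with flat-or-feasible C (ℕ.suc-injective e) F
  ... | inj₁ Z = inj₁ (continue Z)
  ... | inj₂ F′ = inj₂ (keep refl F′)
  flat-or-feasible {t = suc t} {Ls = (true , true) ∷ Ls} (_ , C) e (bump _ refl F) =
    inj₂ (bump refl refl (feasible-saturated (ℕ.≤-reflexive (ℕ.suc-injective e)) F))

  abs-bump : ∀ {n} → ℕ → Label → Vec Label n → Vec ℕ n → Exp n → ℕ
  abs-bump s L Ls ls α =
    if s <ᵇ boxes (L ∷ Ls) then abs? (next L (suc s)) Ls ls α ℕ.+ abs? (next L s) Ls ls α else 0

  abs-bump-unsaturated : ∀ {n} s L (Ls : Vec Label n) ls α → s < boxes (L ∷ Ls) →
    abs-bump s L Ls ls α ≡ abs? (next L (suc s)) Ls ls α ℕ.+ abs? (next L s) Ls ls α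
  abs-bump-unsaturated s L Ls ls α lt with s <ᵇ boxes (L ∷ Ls) | ℕ.<⇒<ᵇ lt
  ... | true | _ = refl

  abs-bump-saturated : ∀ {n} s L (Ls : Vec Label n) ls α → boxes (L ∷ Ls) ≤ s → abs-bump s L Ls ls α ≡ 0
  abs-bump-saturated s L Ls ls α le with s <ᵇ boxes (L ∷ Ls) in lt
  ... | true = contradiction (ℕ.<ᵇ⇒< s _ (subst Data.Bool.T (sym lt) _)) (ℕ.≤⇒≯ le)
  ... | false = refl

  sum>0 : ∀ x {y} → 0 < x ℕ.+ y → 0 < x ⊎ 0 < y
  sum>0 zero p = inj₂ p
  sum>0 (suc x) p = inj₁ z<s

  -- In a saturated block no outcome matters any more, and the constant factor 1 has only the
  -- minimal exponents in its support.
  abs>0⇒flat : ∀ {n e} s (Ls : Vec Label n) ls α → Closed e Ls → boxes Ls ≤ s → 0 < abs s Ls ls α → Flat Ls ls α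
  abs>0⇒feasible : ∀ {n e} s (Ls : Vec Label n) ls α → Closed e Ls → s < boxes Ls ⊎ e ≡ false →
                   0 < abs s Ls ls α → Feasible s Ls ls α
  abs?>0⇒feasible : ∀ {n} s β (Ls : Vec Label n) ls α → Closed true Ls → s < boxes ((β , true) ∷ Ls) →
    0 < abs? (next (β , true) s) Ls ls α → ∃ λ t → next (β , true) s ≡ just t × Feasible t Ls ls α

  abs>0⇒flat s [] [] [] C le p = []
  abs>0⇒flat s (L ∷ Ls) (l ∷ ls) (a ∷ α) C le p with pickView l a
  ... | isOut h = contradiction p (subst (λ z → ¬ 0 < z) (sym (h 0 _ _)) λ ())
  ... | isHigh = contradiction p (subst (λ z → ¬ 0 < z)
                 (sym (trans (pick-high 0 l _ (abs-bump s L Ls ls α)) (abs-bump-saturated s L Ls ls α le))) λ ())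
  ... | isLow = go L s C le (subst (0 <_) (pick-low 0 l (abs? (next L s) Ls ls α) _) p)
    where
    go : ∀ L s → Closed _ (L ∷ Ls) → boxes (L ∷ Ls) ≤ s → 0 < abs? (next L s) Ls ls α → Flat (L ∷ Ls) (l ∷ ls) (l ∷ α)
    go (false , false) s (_ , C) le p = close (abs>0⇒feasible 0 Ls ls α C (inj₂ refl) p)
    go (false , true) s (_ , C) le p = continue (abs>0⇒flat s Ls ls α C le p)
    go (true , false) (suc s) (_ , C) le p = close (abs>0⇒feasible 0 Ls ls α C (inj₂ refl) p)
    go (true , true) (suc s) (_ , C) (s≤s le) p = continue (abs>0⇒flat s Ls ls α C le p)

  abs?>0⇒feasible s false Ls ls α C lt p = s , refl , abs>0⇒feasible s Ls ls α C (inj₁ lt) p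
  abs?>0⇒feasible (suc s) true Ls ls α C (s≤s lt) p = s , refl , abs>0⇒feasible s Ls ls α C (inj₁ lt) p

  abs>0⇒feasible s Ls ls α C b p with s ℕ.<? boxes Ls
  abs>0⇒feasible s Ls ls α C b p | no s≮ = flat⇒feasible (ℕ.≮⇒≥ s≮) (abs>0⇒flat s Ls ls α C (ℕ.≮⇒≥ s≮) p)
  abs>0⇒feasible s (L ∷ Ls) (l ∷ ls) (a ∷ α) C b p | yes lt with pickView l a
  ... | isOut h = contradiction p (subst (λ z → ¬ 0 < z) (sym (h 0 _ _)) λ ())
  ... | isLow = go L s C lt (subst (0 <_) (pick-low 0 l (abs? (next L s) Ls ls α) _) p)
    where
    go : ∀ L s → Closed _ (L ∷ Ls) → s < boxes (L ∷ Ls) → 0 < abs? (next L s) Ls ls α → Feasible s (L ∷ Ls) (l ∷ ls) (l ∷ α)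
    go (β , true) s (_ , C) lt p = let t , e , F = abs?>0⇒feasible s β Ls ls α C lt p in keep e F
    go (true , false) (suc s) (_ , C) lt p = keep refl (abs>0⇒feasible 0 Ls ls α C (inj₂ refl) p)
  ... | isHigh = go L s C lt (subst (0 <_) (trans (pick-high 0 l _ (abs-bump s L Ls ls α)) (abs-bump-unsaturated s L Ls ls α lt)) p)
    where
    go : ∀ L s → Closed _ (L ∷ Ls) → s < boxes (L ∷ Ls) → 0 < abs? (next L (suc s)) Ls ls α ℕ.+ abs? (next L s) Ls ls α →
         Feasible s (L ∷ Ls) (l ∷ ls) (suc l ∷ α)
    go (true , false) zero (_ , C) lt p =
      bump refl refl (abs>0⇒feasible 0 Ls ls α C (inj₂ refl) (subst (0 <_) (ℕ.+-identityʳ _) p))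
    go (true , false) (suc s) _ (s≤s ()) p
    go (β , true) s (_ , C) lt p with sum>0 (abs? (next (β , true) (suc s)) Ls ls α) p
    ... | inj₂ p₀ with abs?>0⇒feasible s β Ls ls α C lt p₀
    ...   | t , e , F = down β s e F
      where
      down : ∀ β s {t} → next (β , true) s ≡ just t → Feasible t Ls ls α → Feasible s ((β , true) ∷ Ls) (l ∷ ls) (suc l ∷ α)
      down false s refl F = bump refl refl (feasible-suc F)
      down true (suc s) refl F = bump refl refl (feasible-suc F)
    go (false , true) s (_ , C) lt p | inj₁ p₁ with ℕ.m≤n⇒m<n∨m≡n lt
    ...   | inj₁ lt′ = bump refl refl (abs>0⇒feasible (suc s) Ls ls α C (inj₁ lt′) p₁)
    ...   | inj₂ e = bump refl refl (flat⇒feasible (ℕ.≤-reflexive (sym e)) (abs>0⇒flat (suc s) Ls ls α C (ℕ.≤-reflexive (sym e)) p₁))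
    go (true , true) s (_ , C) (s≤s le) p | inj₁ p₁ with ℕ.m≤n⇒m<n∨m≡n le
    ...   | inj₁ lt′ = bump refl refl (abs>0⇒feasible s Ls ls α C (inj₁ lt′) p₁)
    ...   | inj₂ e = bump refl refl (flat⇒feasible (ℕ.≤-reflexive (sym e)) (abs>0⇒flat s Ls ls α C (ℕ.≤-reflexive (sym e)) p₁))

  flat⇒abs>0 : ∀ {n e} s (Ls : Vec Label n) ls α → Closed e Ls → boxes Ls ≤ s → Flat Ls ls α → 0 < abs s Ls ls α
  -- In an open block that is already saturated only the flat exponents survive, so the claim is
  -- made for states short of surplus and for the initial state between blocks.
  feasible⇒abs>0 : ∀ {n e} s (Ls : Vec Label n) ls α → Closed e Ls → s < boxes Ls ⊎ (e ≡ false × s ≡ 0) →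
                   Feasible s Ls ls α → 0 < abs s Ls ls α

  flat⇒abs>0 s [] [] [] C le Z = z<s
  flat⇒abs>0 s (L ∷ Ls) (l ∷ ls) (a ∷ α) C le Z with refl ← flat-head Z =
    subst (0 <_) (sym (pick-low 0 l _ (abs-bump s L Ls ls α))) (go L s C le Z)
    where
    go : ∀ L s → Closed _ (L ∷ Ls) → boxes (L ∷ Ls) ≤ s → Flat (L ∷ Ls) (l ∷ ls) (l ∷ α) → 0 < abs? (next L s) Ls ls α
    go (false , false) s (_ , C) le (close F) = feasible⇒abs>0 0 Ls ls α C (inj₂ (refl , refl)) F
    go (true , false) (suc s) (_ , C) le (close F) = feasible⇒abs>0 0 Ls ls α C (inj₂ (refl , refl)) F
    go (false , true) s (_ , C) le (continue Z) = flat⇒abs>0 s Ls ls α C le Z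
    go (true , true) (suc s) (_ , C) (s≤s le) (continue Z) = flat⇒abs>0 s Ls ls α C le Z

  feasible⇒abs>0 s Ls ls α C b F with s ℕ.<? boxes Ls
  feasible⇒abs>0 s [] [] [] C b F | no s≮ = z<s
  feasible⇒abs>0 s Ls ls α C (inj₁ lt) F | no s≮ = contradiction lt s≮
  feasible⇒abs>0 s ((false , true) ∷ Ls) (l ∷ ls) (a ∷ α) (_ , C) (inj₂ (refl , refl)) F | no s≮ =
    contradiction (closed⇒boxes>0 Ls C) s≮
  feasible⇒abs>0 s ((true , κ) ∷ Ls) (l ∷ ls) (a ∷ α) C (inj₂ (refl , refl)) F | no s≮ = contradiction z<s s≮
  feasible⇒abs>0 s ((false , false) ∷ Ls) (l ∷ ls) (.l ∷ α) (_ , C) (inj₂ (refl , refl)) (keep refl F) | no s≮ =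
    subst (0 <_) (sym (pick-low 0 l _ (abs-bump s (false , false) Ls ls α)))
      (feasible⇒abs>0 0 Ls ls α C (inj₂ (refl , refl)) F)
  feasible⇒abs>0 s (L ∷ Ls) (l ∷ ls) (.l ∷ α) C b (keep e F) | yes lt =
    subst (0 <_) (sym (pick-low 0 l _ (abs-bump s L Ls ls α))) (go L s C lt e F)
    where
    go : ∀ L s {t} → Closed _ (L ∷ Ls) → s < boxes (L ∷ Ls) → next L s ≡ just t → Feasible t Ls ls α → 0 < abs? (next L s) Ls ls α
    go (true , false) (suc s) (_ , C) lt refl F = feasible⇒abs>0 0 Ls ls α C (inj₂ (refl , refl)) F
    go (false , true) s (_ , C) lt refl F = feasible⇒abs>0 s Ls ls α C (inj₁ lt) F
    go (true , true) (suc s) (_ , C) (s≤s lt) refl F = feasible⇒abs>0 s Ls ls α C (inj₁ lt) F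
  feasible⇒abs>0 s (L ∷ Ls) (l ∷ ls) (.(suc l) ∷ α) C b (bump _ e F) | yes lt =
    subst (0 <_) (sym (trans (pick-high 0 l _ (abs-bump s L Ls ls α)) (abs-bump-unsaturated s L Ls ls α lt))) (go L s C lt e F)
    where
    go : ∀ L s {t} → Closed _ (L ∷ Ls) → s < boxes (L ∷ Ls) → next L (suc s) ≡ just t → Feasible t Ls ls α →
         0 < abs? (next L (suc s)) Ls ls α ℕ.+ abs? (next L s) Ls ls α
    go (true , false) s (_ , C) lt refl F = ℕ.<-≤-trans (feasible⇒abs>0 0 Ls ls α C (inj₂ (refl , refl)) F) (ℕ.m≤m+n _ _)
    go (false , true) s (_ , C) lt refl F with ℕ.m≤n⇒m<n∨m≡n lt
    ... | inj₁ lt′ = ℕ.<-≤-trans (feasible⇒abs>0 (suc s) Ls ls α C (inj₁ lt′) F) (ℕ.m≤m+n _ _)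
    -- A success makes the state saturated, so the first summand is nonzero only at flat exponents;
    -- every other feasible exponent is caught by the second summand, where the surplus is one unit
    -- smaller.
    ... | inj₂ e with flat-or-feasible C (sym e) F
    ...   | inj₁ Z = ℕ.<-≤-trans (flat⇒abs>0 (suc s) Ls ls α C (ℕ.≤-reflexive (sym e)) Z) (ℕ.m≤m+n _ _)
    ...   | inj₂ F′ = ℕ.<-≤-trans (feasible⇒abs>0 s Ls ls α C (inj₁ lt) F′) (ℕ.m≤n+m _ (abs (suc s) Ls ls α))
    go (true , true) s (_ , C) (s≤s le) refl F with ℕ.m≤n⇒m<n∨m≡n le
    ... | inj₁ lt′ = ℕ.<-≤-trans (feasible⇒abs>0 s Ls ls α C (inj₁ lt′) F) (ℕ.m≤m+n _ _)
    go (true , true) zero (_ , C) (s≤s le) refl F | inj₂ e = contradiction (sym e) (ℕ.>⇒≢ (closed⇒boxes>0 Ls C))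
    go (true , true) (suc s) (_ , C) (s≤s le) refl F | inj₂ e with flat-or-feasible C (sym e) F
    ...   | inj₁ Z = ℕ.<-≤-trans (flat⇒abs>0 (suc s) Ls ls α C (ℕ.≤-reflexive (sym e)) Z) (ℕ.m≤m+n _ _)
    ...   | inj₂ F′ = ℕ.<-≤-trans (feasible⇒abs>0 s Ls ls α C (inj₁ le) F′) (ℕ.m≤n+m _ (abs (suc s) Ls ls α))

  signed≡0 : ∀ e x → signed e x ≡ 0ℤ → x ≡ 0
  signed≡0 zero zero _ = refl
  signed≡0 (suc e) x p = signed≡0 e x (ℤ.neg-injective p)

  scan≢0⇒feasible : ∀ {n} {Ls : Vec Label n} {ls α} → Closed false Ls → scan 0 Ls ls α ≢ 0ℤ → Feasible 0 Ls ls α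
  scan≢0⇒feasible {Ls = Ls} {ls} {α} C ne = abs>0⇒feasible 0 Ls ls α C (inj₂ refl) (ℕ.n≢0⇒n>0 λ z →
    ne (trans (scan-signed 0 Ls ls α) (trans (cong (signed e) z) (signed-0 e))))
    where e = excess ls α ℕ.+ ((boxes Ls ∸ 0) ℕ.+ later Ls)

  feasible⇒scan≢0 : ∀ {n} {Ls : Vec Label n} {ls α} → Closed false Ls → Feasible 0 Ls ls α → scan 0 Ls ls α ≢ 0ℤ
  feasible⇒scan≢0 {Ls = Ls} {ls} {α} C F z = ℕ.>⇒≢ (feasible⇒abs>0 0 Ls ls α C (inj₂ (refl , refl)) F)
    (signed≡0 (excess ls α ℕ.+ ((boxes Ls ∸ 0) ℕ.+ later Ls)) _ (trans (sym (scan-signed 0 Ls ls α)) z))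

-- Degree, intervals and the sum of all coefficients.

module SupportProperties where

  open DividedDifferences
  open ScanPolynomials
  open FirstAscents
  open SignedScan
  open FeasibleExponents
  open import Data.Nat using (_≤_; _<_; _⊔_)
  open import Data.Integer using (_+_; _-_; -_)
  open import Data.Integer.Tactic.RingSolver using (solve-∀)
  open import Data.List as List using (List; []; _∷_; _++_; upTo; applyUpTo; concatMap; foldr; map)
  import Data.List.Properties as List
  open import Data.Vec.Properties using (≡-dec)

  degreeOver : ∀ {n} → Poly n → Poly n → ℕ
  degreeOver f [] = 0
  degreeOver f ((β , _) ∷ p) with coeff f β ℤ.≟ 0ℤ
  ... | yes _ = degreeOver f p
  ... | no _ = ∣ β ∣ ⊔ degreeOver f p

  mutual
    degree≡degreeOver : ∀ {n} (f : Poly n) → degree f ≡ degreeOver f f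
    degree≡degreeOver [] = refl
    degree≡degreeOver ((β , c) ∷ p) with coeff ((β , c) ∷ p) β ℤ.≟ 0ℤ
    ... | yes _ with (β , c) List.∷ p
    ...   | f = go≡degreeOver f p
    degree≡degreeOver ((β , c) ∷ p) | no _ with (β , c) List.∷ p
    ...   | f = cong (∣ β ∣ ⊔_) (go≡degreeOver f p)

    -- The left-hand side is the local function of degree, which has no name outside Defs.
    go≡degreeOver : ∀ {n} (f p : Poly n) → _ ≡ degreeOver f p
    go≡degreeOver f [] = refl
    go≡degreeOver f ((β , c) ∷ p) with coeff f β ℤ.≟ 0ℤ
    ... | yes _ = go≡degreeOver f p
    ... | no _ = cong (∣ β ∣ ⊔_) (go≡degreeOver f p)

  ≤-degreeOver : ∀ {n} (f p : Poly n) β → InSupp f β → InSupp p β → ∣ β ∣ ≤ degreeOver f p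
  ≤-degreeOver f [] β _ p∋β = contradiction refl p∋β
  ≤-degreeOver f ((γ , c) ∷ p) β f∋β p∋β with ≡-dec ℕ._≟_ γ β
  ≤-degreeOver f ((γ , c) ∷ p) β f∋β p∋β | yes refl with coeff f γ ℤ.≟ 0ℤ
  ... | yes z = contradiction z f∋β
  ... | no _ = ℕ.m≤m⊔n ∣ γ ∣ _
  ≤-degreeOver f ((γ , c) ∷ p) β f∋β p∋β | no _ with coeff f γ ℤ.≟ 0ℤ
  ... | yes _ = ≤-degreeOver f p β f∋β p∋β
  ... | no _ = ℕ.≤-trans (≤-degreeOver f p β f∋β p∋β) (ℕ.m≤n⊔m ∣ γ ∣ _)

  degreeOver-attained : ∀ {n} (f p : Poly n) →
    degreeOver f p ≡ 0 ⊎ ∃ λ γ → InSupp f γ × degreeOver f p ≡ ∣ γ ∣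
  degreeOver-attained f [] = inj₁ refl
  degreeOver-attained f ((γ , c) ∷ p) with coeff f γ ℤ.≟ 0ℤ
  ... | yes _ = degreeOver-attained f p
  ... | no f∋γ with ℕ.≤-total (degreeOver f p) ∣ γ ∣
  ...   | inj₁ le = inj₂ (γ , f∋γ , ℕ.m≥n⇒m⊔n≡m le)
  ...   | inj₂ ge with degreeOver-attained f p
  ...     | inj₁ z = inj₂ (γ , f∋γ , ℕ.m≥n⇒m⊔n≡m (subst (_≤ ∣ γ ∣) (sym z) z≤n))
  ...     | inj₂ (δ , f∋δ , e) = inj₂ (δ , f∋δ , trans (ℕ.m≤n⇒m⊔n≡n ge) e)

  support≤degree : ∀ {n} (f : Poly n) β → InSupp f β → ∣ β ∣ ≤ degree f
  support≤degree f β f∋β = subst (∣ β ∣ ≤_) (sym (degree≡degreeOver f)) (≤-degreeOver f f β f∋β f∋β)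

  degree-attained : ∀ {n} (f : Poly n) → degree f ≡ 0 ⊎ ∃ λ γ → InSupp f γ × degree f ≡ ∣ γ ∣
  degree-attained f rewrite degree≡degreeOver f = degreeOver-attained f f

  sum-mono : ∀ {n} {α β : Exp n} → α ≤ᵥ β → ∣ α ∣ ≤ ∣ β ∣
  sum-mono [] = z≤n
  sum-mono (a≤b ∷ α≤β) = ℕ.+-mono-≤ a≤b (sum-mono α≤β)

  ≤ᵥ-sum-≡ : ∀ {n} {α β : Exp n} → α ≤ᵥ β → ∣ α ∣ ≡ ∣ β ∣ → α ≡ β
  ≤ᵥ-sum-≡ [] _ = refl
  ≤ᵥ-sum-≡ {α = a ∷ α} {b ∷ β} (a≤b ∷ α≤β) e with ℕ.m≤n⇒m<n∨m≡n a≤b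
  ... | inj₁ a<b = contradiction e (ℕ.<⇒≢ (ℕ.+-mono-<-≤ a<b (sum-mono α≤β)))
  ... | inj₂ refl = cong (a ∷_) (≤ᵥ-sum-≡ α≤β (ℕ.+-cancelˡ-≡ a _ _ e))

  increment-below : ∀ {n} {α τ : Exp n} → α ≤ᵥ τ → ∣ α ∣ < ∣ τ ∣ →
                    ∃ λ β → α ≤ᵥ β × β ≤ᵥ τ × ∣ β ∣ ≡ suc ∣ α ∣
  increment-below {α = a ∷ α} {t ∷ τ} (a≤t ∷ α≤τ) lt with ℕ.m≤n⇒m<n∨m≡n a≤t
  ... | inj₁ a<t = suc a ∷ α , ℕ.n≤1+n a ∷ PW.refl ℕ.≤-refl , a<t ∷ α≤τ , refl
  ... | inj₂ refl =
    let β , α≤β , β≤τ , e = increment-below α≤τ (ℕ.+-cancelˡ-< a _ _ lt)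
    in a ∷ β , ℕ.≤-refl ∷ α≤β , ℕ.≤-refl ∷ β≤τ , trans (cong (a ℕ.+_) e) (ℕ.+-suc a _)

  sumℤ : List ℤ → ℤ
  sumℤ = foldr _+_ 0ℤ

  sumℤ-++ : ∀ xs ys → sumℤ (xs ++ ys) ≡ sumℤ xs + sumℤ ys
  sumℤ-++ [] ys = sym (ℤ.+-identityˡ _)
  sumℤ-++ (x ∷ xs) ys = trans (cong (x +_) (sumℤ-++ xs ys)) (sym (ℤ.+-assoc x _ _))

  sumℤ-map-concatMap : ∀ {A B : Set} (F : B → ℤ) (h : A → List B) xs →
    sumℤ (map F (concatMap h xs)) ≡ sumℤ (map (λ a → sumℤ (map F (h a))) xs)
  sumℤ-map-concatMap F h [] = refl
  sumℤ-map-concatMap F h (x ∷ xs) = begin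
    sumℤ (map F (h x ++ concatMap h xs))             ≡⟨ cong sumℤ (List.map-++ F (h x) _) ⟩
    sumℤ (map F (h x) ++ map F (concatMap h xs))     ≡⟨ sumℤ-++ (map F (h x)) _ ⟩
    sumℤ (map F (h x)) + sumℤ (map F (concatMap h xs)) ≡⟨ cong (sumℤ (map F (h x)) +_) (sumℤ-map-concatMap F h xs) ⟩
    sumℤ (map (λ a → sumℤ (map F (h a))) (x ∷ xs))   ∎
    where open ≡-Reasoning

  sumℤ-0 : ∀ {A : Set} (xs : List A) → sumℤ (map (λ _ → 0ℤ) xs) ≡ 0ℤ
  sumℤ-0 [] = refl
  sumℤ-0 (x ∷ xs) = trans (ℤ.+-identityˡ _) (sumℤ-0 xs)

  sumℤ-- : ∀ {A : Set} (F G : A → ℤ) xs → sumℤ (map (λ a → F a - G a) xs) ≡ sumℤ (map F xs) - sumℤ (map G xs)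
  sumℤ-- F G [] = refl
  sumℤ-- F G (x ∷ xs) = trans (cong (F x - G x +_) (sumℤ-- F G xs)) (h (F x) (G x) _ _)
    where
    h : ∀ a b c d → a - b + (c - d) ≡ a + c - (b + d)
    h = solve-∀

  sumℤ-digit : ∀ {A : Set} l a (F G : A → ℤ) xs →
    sumℤ (map (λ x → digit l a (F x) (G x)) xs) ≡ digit l a (sumℤ (map F xs)) (sumℤ (map G xs))
  sumℤ-digit zero zero F G xs = refl
  sumℤ-digit zero (suc zero) F G xs = sumℤ-- G F xs
  sumℤ-digit zero (suc (suc a)) F G xs = sumℤ-0 xs
  sumℤ-digit (suc l) zero F G xs = sumℤ-0 xs
  sumℤ-digit (suc l) (suc a) F G xs = sumℤ-digit l a F G xs

  -- Evaluation at x = 1: (1 - x) e₀ + x e₁ becomes e₁. In an inactive row the range ends at `l`,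
  -- and e₀ remains.
  sumℤ-digits : ∀ l L x y → sumℤ (applyUpTo (λ a → digit l a x y) (suc (width L ℕ.+ l))) ≡ (if active L then y else x)
  sumℤ-digits zero L x y with active L
  ... | true = h x y
    where
    h : ∀ x y → x + (y - x + 0ℤ) ≡ y
    h = solve-∀
  ... | false = ℤ.+-identityʳ x
  sumℤ-digits (suc l) L x y rewrite ℕ.+-suc (width L) l = trans (ℤ.+-identityˡ _) (sumℤ-digits l L x y)

  -- The scan polynomial takes the value 1 at (1, …, 1): with every Bernoulli variable equal to 1
  -- the surplus never runs out.
  sum-scan : ∀ {n} s (Ls : Vec Label n) ls → sumℤ (map (scan s Ls ls) (below (top Ls ls))) ≡ 1ℤ
  sum-scan s [] [] = refl
  sum-scan s (L ∷ Ls) (l ∷ ls) = begin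
    sumℤ (map (scan s (L ∷ Ls) (l ∷ ls)) (below (top (L ∷ Ls) (l ∷ ls))))
      ≡⟨ sumℤ-map-concatMap (scan s (L ∷ Ls) (l ∷ ls)) (λ a → map (a ∷_) B) (upTo N) ⟩
    sumℤ (map (λ a → sumℤ (map (scan s (L ∷ Ls) (l ∷ ls)) (map (a ∷_) B))) (upTo N))
      ≡⟨ cong sumℤ (List.map-cong inner (upTo N)) ⟩
    sumℤ (map (λ a → digit l a (S (next L s)) (S (next L (suc s)))) (upTo N))
      ≡⟨ cong sumℤ (List.map-upTo (λ a → digit l a (S (next L s)) (S (next L (suc s)))) N) ⟩
    sumℤ (applyUpTo (λ a → digit l a (S (next L s)) (S (next L (suc s)))) N)
      ≡⟨ sumℤ-digits l L _ _ ⟩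
    (if active L then S (next L (suc s)) else S (next L s)) ≡⟨ final L ⟩
    1ℤ ∎
    where
    open ≡-Reasoning
    B = below (top Ls ls)
    N = suc (width L ℕ.+ l)
    S : Maybe ℕ → ℤ
    S t = sumℤ (map (scan? t Ls ls) B)
    inner : ∀ a → sumℤ (map (scan s (L ∷ Ls) (l ∷ ls)) (map (a ∷_) B)) ≡ digit l a (S (next L s)) (S (next L (suc s)))
    inner a = trans (cong sumℤ (sym (List.map-∘ B)))
                    (sumℤ-digit l a (scan? (next L s) Ls ls) (scan? (next L (suc s)) Ls ls) B)
    final : ∀ L → (if active L then S (next L (suc s)) else S (next L s)) ≡ 1ℤ
    final (false , false) = sum-scan 0 Ls ls
    final (false , true) = sum-scan (suc s) Ls ls
    final (true , false) = sum-scan 0 Ls ls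
    final (true , true) = sum-scan s Ls ls

  toℤᵥ-cancel-≤ : ∀ {n} {α β : Exp n} → toℤᵥ α ≤ℤᵥ toℤᵥ β → α ≤ᵥ β
  toℤᵥ-cancel-≤ {α = []} {[]} [] = []
  toℤᵥ-cancel-≤ {α = a ∷ α} {b ∷ β} (p ∷ ps) = ℤ.drop‿+≤+ p ∷ toℤᵥ-cancel-≤ ps

  ≥toℤᵥ⇒toℤᵥ : ∀ {n} (α : Exp n) {β : Vec ℤ n} → toℤᵥ α ≤ℤᵥ β → ∃ λ β′ → toℤᵥ β′ ≡ β
  ≥toℤᵥ⇒toℤᵥ [] [] = [] , refl
  ≥toℤᵥ⇒toℤᵥ (a ∷ α) (_∷_ {y = ℤ.+ b} p ps) =
    let β′ , e = ≥toℤᵥ⇒toℤᵥ α ps in b ∷ β′ , cong (ℤ.+ b ∷_) e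

  module ScanSupport {n} (f : Poly n) (Ls : Vec Label n) (ls : Vec ℕ n) (closed : Closed false Ls)
    (coeff≡scan : ∀ α → coeff f α ≡ scan 0 Ls ls α) where

    supp⇒feasible : ∀ {α} → InSupp f α → Feasible 0 Ls ls α
    supp⇒feasible {α} p = scan≢0⇒feasible closed (subst (_≢ 0ℤ) (coeff≡scan α) p)

    feasible⇒supp : ∀ {α} → Feasible 0 Ls ls α → InSupp f α
    feasible⇒supp {α} F = subst (_≢ 0ℤ) (sym (coeff≡scan α)) (feasible⇒scan≢0 closed F)

    supp-up : ∀ {α β} → InSupp f α → α ≤ᵥ β → β ≤ᵥ top Ls ls → InSupp f β
    supp-up p α≤β β≤top = feasible⇒supp (feasible-up z≤n (supp⇒feasible p) α≤β β≤top)

    supp≤top : ∀ {α} → InSupp f α → α ≤ᵥ top Ls ls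
    supp≤top p = feasible-≤top (supp⇒feasible p)

    -- Below `top` the support is closed upwards, so any coordinate in which α falls short of `top`
    -- may be raised. One exists because an exponent of full degree also lies below `top`.
    supp-increment : ∀ α → InSupp f α → ∣ α ∣ < degree f →
      Σ (Exp n) λ β → InSupp f β × (α <ᵥ β) × (∣ β ∣ ≡ suc ∣ α ∣)
    supp-increment α p lt with degree-attained f
    ... | inj₁ z = contradiction (subst (∣ α ∣ <_) z lt) λ ()
    ... | inj₂ (γ , f∋γ , e) =
      let β , α≤β , β≤top , e′ = increment-below (supp≤top p)
            (ℕ.<-≤-trans (subst (∣ α ∣ <_) e lt) (sum-mono (supp≤top f∋γ)))
      in β , supp-up p α≤β β≤top , (α≤β , λ α≡β → ℕ.1+n≢n (trans (sym e′) (cong ∣_∣ (sym α≡β)))) , e′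

    supp-interval : ∀ (α γ : Exp n) (β : Vec ℤ n) → InSupp f α → InSupp f γ →
      toℤᵥ α ≤ℤᵥ β → β ≤ℤᵥ toℤᵥ γ → InSuppℤ f β
    supp-interval α γ β f∋α f∋γ α≤β β≤γ with ≥toℤᵥ⇒toℤᵥ α α≤β
    ... | β′ , refl = β′ , refl , supp-up f∋α (toℤᵥ-cancel-≤ α≤β)
                        (PW.trans ℕ.≤-trans (toℤᵥ-cancel-≤ β≤γ) (supp≤top f∋γ))

    -- The only exponent of full degree is `top`, so the sum runs over the whole support and is the
    -- value at (1, ..., 1).
    supp-sum : ∀ (β : Exp n) → InSupp f β → ∣ β ∣ ≡ degree f → foldr _+_ 0ℤ (map (coeff f) (below β)) ≡ 1ℤ
    supp-sum β f∋β e =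
      subst (λ τ → sumℤ (map (coeff f) (below τ)) ≡ 1ℤ) (sym β≡top)
        (trans (cong sumℤ (List.map-cong coeff≡scan (below (top Ls ls)))) (sum-scan 0 Ls ls))
      where
      f∋top : InSupp f (top Ls ls)
      f∋top = supp-up f∋β (supp≤top f∋β) (PW.refl ℕ.≤-refl)
      β≡top : β ≡ top Ls ls
      β≡top = ≤ᵥ-sum-≡ (supp≤top f∋β) (ℕ.≤-antisym (sum-mono (supp≤top f∋β))
                (subst (∣ top Ls ls ∣ ≤_) (sym e) (support≤degree f _ f∋top)))

-- The polytope: from row-by-row inequalities to bounds on subsets, and back.

module Polytope where

  open ScanPolynomials
  open SignedScan
  open FeasibleExponents
  open LinearInequalities
  open import Data.Integer using (_+_; _-_; -_; _*_; _≤_; _⊔_)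
  open import Data.Integer.Tactic.RingSolver using (solve-∀)
  open import Data.Fin.Subset using (Subset; inside; outside) renaming (⊥ to ∅)
  open import Data.Unit using (⊤; tt)

  *-monoˡ-nonneg : ∀ {t a b} → 0ℤ ≤ t → a ≤ b → t * a ≤ t * b
  *-monoˡ-nonneg {t} p le = ℤ.*-monoˡ-≤-nonNeg t {{ℤ.nonNegative p}} le

  bitℤ : Bool → ℤ
  bitℤ b = ℤ.+ bit b

  widthℤ : Label → ℤ
  widthℤ L = ℤ.+ width L

  widthℤ≤1 : ∀ L → widthℤ L ≤ 1ℤ
  widthℤ≤1 L with active L
  ... | true = ℤ.≤-refl
  ... | false = ℤ.+≤+ z≤n

  continued : {A : Set} → A → Label → A → A
  continued o (β , κ) s = if κ then s else o

  surplus : ℤ → ℤ → Label → ℕ → ℤ → ℤ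
  surplus τ s L l x = s + (x - τ * ℤ.+ l) - τ * bitℤ (proj₁ L)

  -- The linear system behind Feasible, with all right-hand sides scaled by τ.
  InPolytope : ∀ {n} → ℤ → ℤ → Vec Label n → Vec ℕ n → Vec ℤ n → Set
  InPolytope τ s [] [] [] = ⊤
  InPolytope τ s (L ∷ Ls) (l ∷ ls) (x ∷ xs) =
    τ * ℤ.+ l ≤ x × x ≤ τ * ℤ.+ l + τ * widthℤ L × 0ℤ ≤ surplus τ s L l x ×
    InPolytope τ (continued 0ℤ L (surplus τ s L l x)) Ls ls xs

  polytope-+ : ∀ {n} τ τ′ s s′ (Ls : Vec Label n) ls {xs ys} → InPolytope τ s Ls ls xs → InPolytope τ′ s′ Ls ls ys →
               InPolytope (τ + τ′) (s + s′) Ls ls (zipWith _+_ xs ys)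
  polytope-+ τ τ′ s s′ [] [] {[]} {[]} _ _ = tt
  polytope-+ τ τ′ s s′ (L ∷ Ls) (l ∷ ls) {x ∷ xs} {y ∷ ys} (p₁ , p₂ , p₃ , p) (q₁ , q₂ , q₃ , q) =
    lower-+ τ τ′ (ℤ.+ l) x y p₁ q₁ , upper-+ τ τ′ (ℤ.+ l) (widthℤ L) x y p₂ q₂ ,
    subst (0ℤ ≤_) (sym split) (ℤ.+-mono-≤ p₃ q₃) ,
    subst (λ s → InPolytope (τ + τ′) s Ls ls (zipWith _+_ xs ys)) (continued-+ L split)
      (polytope-+ τ τ′ _ _ Ls ls p q)
    where
    eq : ∀ τ τ′ s s′ x y l b → s + s′ + (x + y - (τ + τ′) * l) - (τ + τ′) * b ≡
         s + (x - τ * l) - τ * b + (s′ + (y - τ′ * l) - τ′ * b)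
    eq = solve-∀
    split = eq τ τ′ s s′ x y (ℤ.+ l) (bitℤ (proj₁ L))
    continued-+ : ∀ L {a b c} → c ≡ a + b → continued 0ℤ L a + continued 0ℤ L b ≡ continued 0ℤ L c
    continued-+ (β , true) e = sym e
    continued-+ (β , false) e = refl

  polytope-scale : ∀ {n} t τ s (Ls : Vec Label n) ls {xs} → 0ℤ ≤ t → InPolytope τ s Ls ls xs →
                   InPolytope (t * τ) (t * s) Ls ls (Vec.map (t *_) xs)
  polytope-scale t τ s [] [] {[]} 0≤t _ = tt
  polytope-scale t τ s (L ∷ Ls) (l ∷ ls) {x ∷ xs} 0≤t (p₁ , p₂ , p₃ , p) =
    subst (_≤ t * x) (sym (ℤ.*-assoc t τ (ℤ.+ l))) (*-monoˡ-nonneg 0≤t p₁) ,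
    subst (t * x ≤_) (eq₁ t τ (ℤ.+ l) (widthℤ L)) (*-monoˡ-nonneg 0≤t p₂) ,
    subst₂ _≤_ (ℤ.*-zeroʳ t) eq₂′ (*-monoˡ-nonneg 0≤t p₃) ,
    subst (λ s → InPolytope (t * τ) s Ls ls (Vec.map (t *_) xs)) (continued-* L eq₂′)
      (polytope-scale t τ _ Ls ls 0≤t p)
    where
    eq₁ : ∀ t τ l w → t * (τ * l + τ * w) ≡ t * τ * l + t * τ * w
    eq₁ = solve-∀
    eq₂ : ∀ t τ s l b x → t * (s + (x - τ * l) - τ * b) ≡ t * s + (t * x - t * τ * l) - t * τ * b
    eq₂ = solve-∀
    eq₂′ = eq₂ t τ s (ℤ.+ l) (bitℤ (proj₁ L)) x
    continued-* : ∀ L {a b} → t * a ≡ b → t * continued 0ℤ L a ≡ continued 0ℤ L b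
    continued-* (β , true) e = e
    continued-* (β , false) e = ℤ.*-zeroʳ t

  polytope-0 : ∀ {n} (Ls : Vec Label n) ls → InPolytope 0ℤ 0ℤ Ls ls (replicate n 0ℤ)
  polytope-0 [] [] = tt
  polytope-0 (L ∷ Ls) (l ∷ ls) =
    ℤ.≤-refl , ℤ.≤-refl , ℤ.≤-refl , subst (λ s → InPolytope 0ℤ s Ls ls (replicate _ 0ℤ)) (continued-0 L) (polytope-0 Ls ls)
    where
    continued-0 : ∀ L → 0ℤ ≡ continued 0ℤ L 0ℤ
    continued-0 (β , true) = refl
    continued-0 (β , false) = refl

  next-surplus : ∀ L u s {t} → next L (u ℕ.+ s) ≡ just t → ∃ λ r → u ℕ.+ s ≡ r ℕ.+ bit (proj₁ L) × t ≡ continued 0 L r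
  next-surplus (false , false) u s refl = u ℕ.+ s , sym (ℕ.+-identityʳ _) , refl
  next-surplus (false , true) u s refl = u ℕ.+ s , sym (ℕ.+-identityʳ _) , refl
  next-surplus (true , κ) u s e with u ℕ.+ s
  next-surplus (true , false) u s refl | suc r = r , ℕ.+-comm 1 r , refl
  next-surplus (true , true) u s refl | suc r = r , ℕ.+-comm 1 r , refl

  polytope-digit : ∀ {n} u s {t} L l (Ls : Vec Label n) ls xs → u ℕ.≤ width L → next L (u ℕ.+ s) ≡ just t →
    InPolytope 1ℤ (ℤ.+ t) Ls ls xs → InPolytope 1ℤ (ℤ.+ s) (L ∷ Ls) (l ∷ ls) (ℤ.+ (u ℕ.+ l) ∷ xs)
  polytope-digit u s {t} L l Ls ls xs u≤w e p with next-surplus L u s e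
  ... | r , us≡ , t≡ =
    subst (_≤ ℤ.+ (u ℕ.+ l)) (sym (ℤ.*-identityˡ (ℤ.+ l))) (ℤ.+≤+ (ℕ.m≤n+m l u)) ,
    upper-digit (ℤ.+ u) (widthℤ L) (ℤ.+ l) (ℤ.+≤+ u≤w) ,
    subst (0ℤ ≤_) r≡ (ℤ.+≤+ z≤n) ,
    subst (λ s → InPolytope 1ℤ s Ls ls xs) (trans (cong ℤ.+_ t≡) (continued-cast L r≡)) p
    where
    arith : ∀ r s u l b → u + s ≡ r + b → r ≡ s + (u + l - 1ℤ * l) - 1ℤ * b
    arith r s u l b e = trans (h₁ r b) (trans (cong (_- b) (sym e)) (h₂ s u l b))
      where
      h₁ : ∀ r b → r ≡ r + b - b
      h₁ = solve-∀
      h₂ : ∀ s u l b → u + s - b ≡ s + (u + l - 1ℤ * l) - 1ℤ * b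
      h₂ = solve-∀
    r≡ : ℤ.+ r ≡ surplus 1ℤ (ℤ.+ s) L l (ℤ.+ (u ℕ.+ l))
    r≡ = arith (ℤ.+ r) (ℤ.+ s) (ℤ.+ u) (ℤ.+ l) (bitℤ (proj₁ L)) (cong ℤ.+_ us≡)
    continued-cast : ∀ L {x} → ℤ.+ r ≡ x → ℤ.+ continued 0 L r ≡ continued 0ℤ L x
    continued-cast (β , true) e = e
    continued-cast (β , false) e = refl

  feasible⇒polytope : ∀ {n s} {Ls : Vec Label n} {ls α} → Feasible s Ls ls α → InPolytope 1ℤ (ℤ.+ s) Ls ls (toℤᵥ α)
  feasible⇒polytope [] = tt
  feasible⇒polytope {s = s} (keep {L = L} {l} e F) = polytope-digit 0 s L l _ _ _ z≤n e (feasible⇒polytope F)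
  feasible⇒polytope {s = s} (bump {L = L} {l} a e F) =
    polytope-digit 1 s L l _ _ _ (ℕ.≤-reflexive (sym (cong bit a))) e (feasible⇒polytope F)

  outsideℤ : Bool → ℤ
  outsideℤ i = if i then 0ℤ else 1ℤ

  select : Bool → ℤ → ℤ
  select i x = if i then x else 0ℤ

  sumIn : ∀ {n} → Subset n → Vec ℤ n → ℤ
  sumIn [] [] = 0ℤ
  sumIn (i ∷ I) (x ∷ xs) = select i x + sumIn I xs

  -- The number of units that the boxes of the current block force into I; the later blocks contribute
  -- deficits. The recursion is that of the largest value of (boxes − rows outside I) over initial segments.
  deficit deficits : ∀ {n} → Vec Label n → Subset n → ℤ
  deficit [] [] = 0ℤ
  deficit (L ∷ Ls) (i ∷ I) = 0ℤ ⊔ (bitℤ (proj₁ L) - outsideℤ i + continued 0ℤ L (deficit Ls I))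
  deficits [] [] = 0ℤ
  deficits ((β , κ) ∷ Ls) (i ∷ I) = if κ then deficits Ls I else deficits Ls I + deficit Ls I

  lowers : ∀ {n} → Vec ℕ n → Vec ℤ n
  lowers = toℤᵥ

  widths : ∀ {n} → Vec Label n → Vec ℤ n
  widths = Vec.map widthℤ

  lowerBound upperBound : ∀ {n} → Vec Label n → Vec ℕ n → Subset n → ℤ
  lowerBound Ls ls I = sumIn I (lowers ls) + (deficits Ls I + deficit Ls I)
  upperBound Ls ls I = sumIn I (lowers ls) + sumIn I (widths Ls)

  deficit-nonneg : ∀ {n} (Ls : Vec Label n) I → 0ℤ ≤ deficit Ls I
  deficit-nonneg [] [] = ℤ.≤-refl
  deficit-nonneg (L ∷ Ls) (i ∷ I) = ℤ.i≤i⊔j 0ℤ _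

  sumIn-∅ : ∀ {n} (xs : Vec ℤ n) → sumIn ∅ xs ≡ 0ℤ
  sumIn-∅ [] = refl
  sumIn-∅ (x ∷ xs) = trans (ℤ.+-identityˡ _) (sumIn-∅ xs)

  deficit-∅ : ∀ {n} (Ls : Vec Label n) → deficit Ls ∅ ≡ 0ℤ
  deficit-∅ [] = refl
  deficit-∅ ((false , false) ∷ Ls) = refl
  deficit-∅ ((true , false) ∷ Ls) = refl
  deficit-∅ ((false , true) ∷ Ls) rewrite deficit-∅ Ls = refl
  deficit-∅ ((true , true) ∷ Ls) rewrite deficit-∅ Ls = refl

  deficits-∅ : ∀ {n} (Ls : Vec Label n) → deficits Ls ∅ ≡ 0ℤ
  deficits-∅ [] = refl
  deficits-∅ ((β , true) ∷ Ls) = deficits-∅ Ls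
  deficits-∅ ((β , false) ∷ Ls) = cong₂ _+_ (deficits-∅ Ls) (deficit-∅ Ls)

  polytope⇒upper : ∀ {n} τ s (Ls : Vec Label n) ls {xs} → InPolytope τ s Ls ls xs → ∀ I →
                   sumIn I xs ≤ τ * upperBound Ls ls I
  polytope⇒upper τ s [] [] {[]} _ [] = ℤ.≤-reflexive (sym (ℤ.*-zeroʳ τ))
  polytope⇒upper τ s (L ∷ Ls) (l ∷ ls) {x ∷ xs} (_ , p₂ , _ , p) (i ∷ I) =
    step i (polytope⇒upper τ _ Ls ls p I)
    where
    step : ∀ i → sumIn I xs ≤ τ * upperBound Ls ls I →
           sumIn (i ∷ I) (x ∷ xs) ≤ τ * upperBound (L ∷ Ls) (l ∷ ls) (i ∷ I)
    step true q = upper-in τ x (ℤ.+ l) (widthℤ L) (sumIn I (lowers ls)) (sumIn I (widths Ls)) (sumIn I xs) p₂ q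
    step false q = upper-out τ (sumIn I (lowers ls)) (sumIn I (widths Ls)) (sumIn I xs) q

  -- The incoming surplus `s` helps the current block only: one bound omits `s` and the deficit of
  -- that block, the other includes both. In the maximum that defines `deficit`, the alternative 0
  -- follows from the former bound and the other alternative from the bounds on the tail.
  polytope⇒lower : ∀ {n} τ s (Ls : Vec Label n) ls {xs} → 0ℤ ≤ τ → 0ℤ ≤ s → InPolytope τ s Ls ls xs → ∀ I →
    τ * (sumIn I (lowers ls) + deficits Ls I) ≤ sumIn I xs × τ * lowerBound Ls ls I ≤ sumIn I xs + s
  polytope⇒lower τ s [] [] {[]} 0≤τ 0≤s _ [] =
    ℤ.≤-reflexive (ℤ.*-zeroʳ τ) , subst₂ _≤_ (sym (ℤ.*-zeroʳ τ)) (sym (ℤ.+-identityˡ s)) 0≤s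
  polytope⇒lower τ s (L@(β , κ) ∷ Ls) (l ∷ ls) {x ∷ xs} 0≤τ 0≤s (p₁ , p₂ , p₃ , p) (i ∷ I) =
    main κ p₃ p
    where
    low = sumIn I (lowers ls)
    M = deficit Ls I
    R = deficits Ls I
    X = sumIn I xs
    b = bitℤ β
    o = outsideℤ i
    li = select i (ℤ.+ l)
    xi = select i x
    S = surplus τ s L l x
    digit≤τ : x - τ * ℤ.+ l ≤ τ
    digit≤τ = unit-digit τ x (ℤ.+ l) (widthℤ L) p₂ (*-monoˡ-nonneg 0≤τ (widthℤ≤1 L))
    F₁ : ∀ i → τ * select i (ℤ.+ l) ≤ select i x
    F₁ true = p₁
    F₁ false = ℤ.≤-reflexive (ℤ.*-zeroʳ τ)
    -- A row outside I absorbs at most τ units above its lower bound; this is the amount that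
    -- `outsideℤ` takes off the demand on I.
    F₂ : ∀ i → x - τ * ℤ.+ l ≤ select i x - τ * select i (ℤ.+ l) + τ * outsideℤ i
    F₂ true = digit-in τ x (ℤ.+ l)
    F₂ false = digit-out τ (x - τ * ℤ.+ l) digit≤τ
    main : ∀ κ → 0ℤ ≤ S → InPolytope τ (continued 0ℤ (β , κ) S) Ls ls xs →
      τ * (sumIn (i ∷ I) (lowers (l ∷ ls)) + deficits ((β , κ) ∷ Ls) (i ∷ I)) ≤ sumIn (i ∷ I) (x ∷ xs) ×
      τ * lowerBound ((β , κ) ∷ Ls) (l ∷ ls) (i ∷ I) ≤ sumIn (i ∷ I) (x ∷ xs) + s
    main true p₃ p with polytope⇒lower τ S Ls ls 0≤τ p₃ p I
    ... | A , B = A′ , B′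
      where
      A′ : τ * (li + low + R) ≤ xi + X
      A′ = lower-extend τ li low R xi X A (F₁ i)
      B′ : τ * (li + low + (R + (0ℤ ⊔ (b - o + M)))) ≤ xi + X + s
      B′ with ℤ.⊔-sel 0ℤ (b - o + M)
      ... | inj₁ e = subst (λ z → τ * (li + low + (R + z)) ≤ xi + X + s) (sym e)
                       (lower-zero τ (xi + X) s (li + low) R A′ 0≤s)
      ... | inj₂ e = subst (λ z → τ * (li + low + (R + z)) ≤ xi + X + s) (sym e)
                       (lower-open τ s x li (ℤ.+ l) low R M b o xi X B (F₂ i))
    main false p₃ p with polytope⇒lower τ 0ℤ Ls ls 0≤τ ℤ.≤-refl p I
    ... | _ , B = A′ , B′
      where
      A′ : τ * (li + low + (R + M)) ≤ xi + X
      A′ = lower-extend₀ τ li low (R + M) xi X B (F₁ i)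
      B′ : τ * (li + low + (R + M + (0ℤ ⊔ (b - o + 0ℤ)))) ≤ xi + X + s
      B′ with ℤ.⊔-sel 0ℤ (b - o + 0ℤ)
      ... | inj₁ e = subst (λ z → τ * (li + low + (R + M + z)) ≤ xi + X + s) (sym e)
                       (lower-zero τ (xi + X) s (li + low) (R + M) A′ 0≤s)
      ... | inj₂ e = subst (λ z → τ * (li + low + (R + M + z)) ≤ xi + X + s) (sym e)
                       (lower-close τ s x li (ℤ.+ l) low (R + M) b o xi X B p₃ (F₂ i))

  -- The singleton of the first row yields the conditions on that row. The tail inherits its bounds
  -- from sets that omit the first row, or that contain it when a surplus is handed on.
  bounds⇒polytope′ : ∀ {n} τ s (Ls : Vec Label n) ls xs → 0ℤ ≤ τ →
    (∀ I → τ * (sumIn I (lowers ls) + deficits Ls I) ≤ sumIn I xs) →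
    (∀ I → τ * lowerBound Ls ls I ≤ sumIn I xs + s) → (∀ I → sumIn I xs ≤ τ * upperBound Ls ls I) →
    InPolytope τ s Ls ls xs
  bounds⇒polytope′ τ s [] [] [] 0≤τ hA hB hC = tt
  bounds⇒polytope′ τ s (L@(β , κ) ∷ Ls) (l ∷ ls) (x ∷ xs) 0≤τ hA hB hC =
    p₁ (deficits-head κ) (hA (inside ∷ ∅)) , p₂ (hC (inside ∷ ∅)) , p₃ (deficits-head κ) (hB (inside ∷ ∅)) , tail κ hA hB
    where
    b = bitℤ β
    b≤ : ∀ κ I → b + continued 0ℤ (β , κ) (deficit Ls I) ≤ deficit ((β , κ) ∷ Ls) (inside ∷ I)
    b≤ κ I = ℤ.≤-trans (ℤ.≤-reflexive (h b (continued 0ℤ (β , κ) (deficit Ls I)))) (ℤ.i≤j⊔i 0ℤ (b - 0ℤ + continued 0ℤ (β , κ) (deficit Ls I)))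
      where
      h : ∀ b m → b + m ≡ b - 0ℤ + m
      h = solve-∀
    deficits-head : ∀ κ → deficits ((β , κ) ∷ Ls) (inside ∷ ∅) ≡ 0ℤ
    deficits-head true = deficits-∅ Ls
    deficits-head false = cong₂ _+_ (deficits-∅ Ls) (deficit-∅ Ls)
    p₁ : ∀ {R} → R ≡ 0ℤ → τ * (ℤ.+ l + sumIn ∅ (lowers ls) + R) ≤ x + sumIn ∅ xs → τ * ℤ.+ l ≤ x
    p₁ refl p rewrite sumIn-∅ (lowers ls) | sumIn-∅ xs = single-lower τ x (ℤ.+ l) p
    p₂ : x + sumIn ∅ xs ≤ τ * (ℤ.+ l + sumIn ∅ (lowers ls) + (widthℤ L + sumIn ∅ (widths Ls))) → x ≤ τ * ℤ.+ l + τ * widthℤ L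
    p₂ p rewrite sumIn-∅ (lowers ls) | sumIn-∅ xs | sumIn-∅ (widths Ls) = single-upper τ x (ℤ.+ l) (widthℤ L) p
    continued-∅ : ∀ L → continued 0ℤ L (deficit Ls ∅) ≡ 0ℤ
    continued-∅ (β , true) = deficit-∅ Ls
    continued-∅ (β , false) = refl
    p₃ : ∀ {R} → R ≡ 0ℤ → τ * (ℤ.+ l + sumIn ∅ (lowers ls) + (R + deficit (L ∷ Ls) (inside ∷ ∅))) ≤ x + sumIn ∅ xs + s →
         0ℤ ≤ surplus τ s L l x
    p₃ refl p rewrite sumIn-∅ (lowers ls) | sumIn-∅ xs =
      single-surplus τ s x (ℤ.+ l) b _ p (*-monoˡ-nonneg 0≤τ (subst (_≤ deficit (L ∷ Ls) (inside ∷ ∅))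
        (trans (cong (b +_) (continued-∅ L)) (ℤ.+-identityʳ b)) (b≤ κ ∅)))
    C′ : ∀ I → sumIn I xs ≤ τ * upperBound Ls ls I
    C′ I = tail-upper τ (sumIn I (lowers ls)) (sumIn I (widths Ls)) (sumIn I xs) (hC (outside ∷ I))
    S = surplus τ s L l x
    tail : ∀ κ → (∀ I → τ * (sumIn I (lowers (l ∷ ls)) + deficits ((β , κ) ∷ Ls) I) ≤ sumIn I (x ∷ xs)) →
      (∀ I → τ * lowerBound ((β , κ) ∷ Ls) (l ∷ ls) I ≤ sumIn I (x ∷ xs) + s) →
      InPolytope τ (continued 0ℤ (β , κ) S) Ls ls xs
    tail true hA hB = bounds⇒polytope′ τ S Ls ls xs 0≤τ
      (λ I → tail-lower τ (sumIn I (lowers ls)) (deficits Ls I) (sumIn I xs) (hA (outside ∷ I)))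
      (λ I → tail-open τ s x (ℤ.+ l) (sumIn I (lowers ls)) (deficits Ls I) (deficit Ls I) b _ (sumIn I xs) (hB (inside ∷ I)) (*-monoˡ-nonneg 0≤τ (b≤ true I))) C′
    tail false hA hB = bounds⇒polytope′ τ 0ℤ Ls ls xs 0≤τ
      (λ I → drop-nonneg τ (sumIn I (lowers ls)) (deficits Ls I) (deficit Ls I) (sumIn I xs) (subst (τ * lowerBound Ls ls I ≤_) (ℤ.+-identityʳ _) (B′ I))
        (subst (_≤ τ * deficit Ls I) (ℤ.*-zeroʳ τ) (*-monoˡ-nonneg 0≤τ (deficit-nonneg Ls I))))
      B′ C′
      where
      B′ : ∀ I → τ * lowerBound Ls ls I ≤ sumIn I xs + 0ℤ
      B′ I = tail-close τ (sumIn I (lowers ls)) (deficits Ls I + deficit Ls I) (sumIn I xs) (hA (outside ∷ I))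

  bounds⇒polytope : ∀ {n} τ (Ls : Vec Label n) ls xs → 0ℤ ≤ τ →
    (∀ I → τ * lowerBound Ls ls I ≤ sumIn I xs × sumIn I xs ≤ τ * upperBound Ls ls I) → InPolytope τ 0ℤ Ls ls xs
  bounds⇒polytope τ Ls ls xs 0≤τ h = bounds⇒polytope′ τ 0ℤ Ls ls xs 0≤τ
    (λ I → drop-nonneg τ (sumIn I (lowers ls)) (deficits Ls I) (deficit Ls I) (sumIn I xs) (proj₁ (h I))
      (subst (_≤ τ * deficit Ls I) (ℤ.*-zeroʳ τ) (*-monoˡ-nonneg 0≤τ (deficit-nonneg Ls I))))
    (λ I → subst (τ * lowerBound Ls ls I ≤_) (sym (ℤ.+-identityʳ _)) (proj₁ (h I)))
    (λ I → proj₂ (h I))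

  polytope⇒bounds : ∀ {n} τ (Ls : Vec Label n) ls xs → 0ℤ ≤ τ → InPolytope τ 0ℤ Ls ls xs →
    ∀ I → τ * lowerBound Ls ls I ≤ sumIn I xs × sumIn I xs ≤ τ * upperBound Ls ls I
  polytope⇒bounds τ Ls ls xs 0≤τ p I =
    subst (τ * lowerBound Ls ls I ≤_) (ℤ.+-identityʳ _) (proj₂ (polytope⇒lower τ 0ℤ Ls ls 0≤τ ℤ.≤-refl p I)) ,
    polytope⇒upper τ 0ℤ Ls ls p I

-- Paramodularity of the lower and upper bounds.

module Paramodularity where

  open ScanPolynomials
  open SignedScan
  open LinearInequalities
  open Polytope
  open import Data.Integer using (_+_; _-_; -_; _≤_; _⊔_)
  open import Data.Integer.Tactic.RingSolver using (solve-∀)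
  open import Data.Fin.Subset using (Subset; _∩_; _∪_; _─_) renaming (⊥ to ∅)

  lowerBound-∅ : ∀ {n} (Ls : Vec Label n) ls → lowerBound Ls ls ∅ ≡ 0ℤ
  lowerBound-∅ Ls ls rewrite sumIn-∅ (lowers ls) | deficits-∅ Ls | deficit-∅ Ls = refl

  upperBound-∅ : ∀ {n} (Ls : Vec Label n) ls → upperBound Ls ls ∅ ≡ 0ℤ
  upperBound-∅ Ls ls rewrite sumIn-∅ (lowers ls) | sumIn-∅ (widths Ls) = refl

  sumIn-modular : ∀ {n} (I J : Subset n) xs → sumIn (I ∪ J) xs + sumIn (I ∩ J) xs ≡ sumIn I xs + sumIn J xs
  sumIn-modular [] [] [] = refl
  sumIn-modular (i ∷ I) (j ∷ J) (x ∷ xs) =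
    trans (interchange (select (i ∨ j) x) (sumIn (I ∪ J) xs) (select (i ∧ j) x) _)
    (trans (cong₂ _+_ (head i j) (sumIn-modular I J xs)) (interchange (select i x) (select j x) (sumIn I xs) (sumIn J xs)))
    where
    interchange : ∀ a b c d → a + b + (c + d) ≡ a + c + (b + d)
    interchange = solve-∀
    head : ∀ i j → select (i ∨ j) x + select (i ∧ j) x ≡ select i x + select j x
    head true true = refl
    head true false = refl
    head false true = ℤ.+-comm x 0ℤ
    head false false = refl

  upperBound-submodular : ∀ {n} (Ls : Vec Label n) ls I J →
    upperBound Ls ls (I ∪ J) + upperBound Ls ls (I ∩ J) ≤ upperBound Ls ls I + upperBound Ls ls J
  upperBound-submodular Ls ls I J =
    super-+ (sumIn (I ∪ J) (lowers ls)) (sumIn (I ∩ J) (lowers ls)) (sumIn I (lowers ls)) (sumIn J (lowers ls))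
            (sumIn (I ∪ J) (widths Ls)) (sumIn (I ∩ J) (widths Ls)) (sumIn I (widths Ls)) (sumIn J (widths Ls))
      (ℤ.≤-reflexive (sumIn-modular I J (lowers ls))) (ℤ.≤-reflexive (sumIn-modular I J (widths Ls)))

  _⊑_ : ∀ {n} → Subset n → Subset n → Set
  _⊑_ = Pointwise (λ i j → outsideℤ j ≤ outsideℤ i)

  ⊑-∪ˡ : ∀ {n} (I J : Subset n) → I ⊑ (I ∪ J)
  ⊑-∪ˡ [] [] = []
  ⊑-∪ˡ (true ∷ I) (j ∷ J) = ℤ.≤-refl ∷ ⊑-∪ˡ I J
  ⊑-∪ˡ (false ∷ I) (true ∷ J) = ℤ.+≤+ z≤n ∷ ⊑-∪ˡ I J
  ⊑-∪ˡ (false ∷ I) (false ∷ J) = ℤ.≤-refl ∷ ⊑-∪ˡ I J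

  ⊑-∪ʳ : ∀ {n} (I J : Subset n) → J ⊑ (I ∪ J)
  ⊑-∪ʳ [] [] = []
  ⊑-∪ʳ (true ∷ I) (true ∷ J) = ℤ.≤-refl ∷ ⊑-∪ʳ I J
  ⊑-∪ʳ (true ∷ I) (false ∷ J) = ℤ.+≤+ z≤n ∷ ⊑-∪ʳ I J
  ⊑-∪ʳ (false ∷ I) (j ∷ J) = ℤ.≤-refl ∷ ⊑-∪ʳ I J

  minus : Bool → Bool → Bool
  minus i j = if j then false else i

  _∖_ : ∀ {n} → Subset n → Subset n → Subset n
  _∖_ = zipWith minus

  ─≡∖ : ∀ {n} (I J : Subset n) → I ─ J ≡ I ∖ J
  ─≡∖ I J = zipWith-ext _ minus (λ { i true → refl ; i false → refl }) I J
    where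
    zipWith-ext : ∀ {n} (f g : Bool → Bool → Bool) → (∀ i j → f i j ≡ g i j) →
                  ∀ (I J : Subset n) → zipWith f I J ≡ zipWith g I J
    zipWith-ext f g e [] [] = refl
    zipWith-ext f g e (i ∷ I) (j ∷ J) = cong₂ _∷_ (e i j) (zipWith-ext f g e I J)

  ⊑-∖ : ∀ {n} (I J : Subset n) → (J ∖ I) ⊑ J
  ⊑-∖ [] [] = []
  ⊑-∖ (true ∷ I) (true ∷ J) = ℤ.+≤+ z≤n ∷ ⊑-∖ I J
  ⊑-∖ (true ∷ I) (false ∷ J) = ℤ.≤-refl ∷ ⊑-∖ I J
  ⊑-∖ (false ∷ I) (j ∷ J) = ℤ.≤-refl ∷ ⊑-∖ I J

  continued-mono : ∀ L {a b} → a ≤ b → continued 0ℤ L a ≤ continued 0ℤ L b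
  continued-mono (β , true) p = p
  continued-mono (β , false) p = ℤ.≤-refl

  deficit-mono : ∀ {n} (Ls : Vec Label n) {I J} → I ⊑ J → deficit Ls I ≤ deficit Ls J
  deficit-mono [] [] = ℤ.≤-refl
  deficit-mono (L ∷ Ls) {i ∷ I} {j ∷ J} (p ∷ ps) = ℤ.⊔-monoʳ-≤ 0ℤ
    (deficit-arg-mono (bitℤ (proj₁ L)) (outsideℤ i) (outsideℤ j) _ _ p (continued-mono L (deficit-mono Ls ps)))

  -- The positive part is convex and increasing, so it preserves supermodularity of monotone set
  -- functions. Here `a`, `b`, `c`, `d` are the values at I ∩ J, I, J and I ∪ J.
  positivePart-super : ∀ a b c d → b ≤ d → c ≤ d → b + c ≤ d + a → (0ℤ ⊔ b) + (0ℤ ⊔ c) ≤ (0ℤ ⊔ d) + (0ℤ ⊔ a)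
  positivePart-super a b c d b≤d c≤d p with ℤ.⊔-sel 0ℤ b | ℤ.⊔-sel 0ℤ c
  ... | inj₁ e | _ = subst (λ z → z + (0ℤ ⊔ c) ≤ (0ℤ ⊔ d) + (0ℤ ⊔ a)) (sym e)
    (ℤ.≤-trans (ℤ.≤-reflexive (ℤ.+-comm 0ℤ (0ℤ ⊔ c))) (ℤ.+-mono-≤ (ℤ.⊔-monoʳ-≤ 0ℤ c≤d) (ℤ.i≤i⊔j 0ℤ a)))
  ... | inj₂ _ | inj₁ e = subst (λ z → (0ℤ ⊔ b) + z ≤ (0ℤ ⊔ d) + (0ℤ ⊔ a)) (sym e)
    (ℤ.+-mono-≤ (ℤ.⊔-monoʳ-≤ 0ℤ b≤d) (ℤ.i≤i⊔j 0ℤ a))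
  ... | inj₂ e | inj₂ e′ = subst₂ (λ y z → y + z ≤ (0ℤ ⊔ d) + (0ℤ ⊔ a)) (sym e) (sym e′)
    (ℤ.≤-trans p (ℤ.+-mono-≤ (ℤ.i≤j⊔i 0ℤ d) (ℤ.i≤j⊔i 0ℤ a)))

  outside-modular : ∀ i j → outsideℤ (i ∨ j) + outsideℤ (i ∧ j) ≤ outsideℤ i + outsideℤ j
  outside-modular true true = ℤ.≤-refl
  outside-modular true false = ℤ.≤-refl
  outside-modular false true = ℤ.≤-refl
  outside-modular false false = ℤ.≤-refl

  deficit-super : ∀ {n} (Ls : Vec Label n) I J → deficit Ls I + deficit Ls J ≤ deficit Ls (I ∪ J) + deficit Ls (I ∩ J)
  deficit-super [] [] [] = ℤ.≤-refl
  deficit-super (L ∷ Ls) (i ∷ I) (j ∷ J) = positivePart-super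
    (b - outsideℤ (i ∧ j) + m (I ∩ J)) (b - outsideℤ i + m I) (b - outsideℤ j + m J) (b - outsideℤ (i ∨ j) + m (I ∪ J))
    (deficit-arg-mono b (outsideℤ i) (outsideℤ (i ∨ j)) (m I) _ (PW.head ⊑ˡ) (continued-mono L (deficit-mono Ls (PW.tail ⊑ˡ))))
    (deficit-arg-mono b (outsideℤ j) (outsideℤ (i ∨ j)) (m J) _ (PW.head ⊑ʳ) (continued-mono L (deficit-mono Ls (PW.tail ⊑ʳ))))
    (deficit-arg-super b (outsideℤ i) (outsideℤ j) (outsideℤ (i ∨ j)) (outsideℤ (i ∧ j)) (m I) (m J) (m (I ∪ J)) (m (I ∩ J))
      (outside-modular i j) (rec L))
    where
    b = bitℤ (proj₁ L)
    m = λ I → continued 0ℤ L (deficit Ls I)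
    ⊑ˡ = ⊑-∪ˡ (i ∷ I) (j ∷ J)
    ⊑ʳ = ⊑-∪ʳ (i ∷ I) (j ∷ J)
    rec : ∀ L → continued 0ℤ L (deficit Ls I) + continued 0ℤ L (deficit Ls J) ≤
          continued 0ℤ L (deficit Ls (I ∪ J)) + continued 0ℤ L (deficit Ls (I ∩ J))
    rec (β , true) = deficit-super Ls I J
    rec (β , false) = ℤ.≤-refl

  deficits-super : ∀ {n} (Ls : Vec Label n) I J →
    deficits Ls I + deficits Ls J ≤ deficits Ls (I ∪ J) + deficits Ls (I ∩ J)
  deficits-super [] [] [] = ℤ.≤-refl
  deficits-super ((β , true) ∷ Ls) (i ∷ I) (j ∷ J) = deficits-super Ls I J
  deficits-super ((β , false) ∷ Ls) (i ∷ I) (j ∷ J) =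
    super-+ (deficits Ls I) (deficits Ls J) (deficits Ls (I ∪ J)) (deficits Ls (I ∩ J))
            (deficit Ls I) (deficit Ls J) (deficit Ls (I ∪ J)) (deficit Ls (I ∩ J))
      (deficits-super Ls I J) (deficit-super Ls I J)

  lowerBound-supermodular : ∀ {n} (Ls : Vec Label n) ls I J →
    lowerBound Ls ls I + lowerBound Ls ls J ≤ lowerBound Ls ls (I ∪ J) + lowerBound Ls ls (I ∩ J)
  lowerBound-supermodular Ls ls I J =
    super-+ (sumIn I (lowers ls)) (sumIn J (lowers ls)) (sumIn (I ∪ J) (lowers ls)) (sumIn (I ∩ J) (lowers ls))
      (deficits Ls I + deficit Ls I) (deficits Ls J + deficit Ls J)
      (deficits Ls (I ∪ J) + deficit Ls (I ∪ J)) (deficits Ls (I ∩ J) + deficit Ls (I ∩ J))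
      (ℤ.≤-reflexive (sym (sumIn-modular I J (lowers ls))))
      (super-+ (deficits Ls I) (deficits Ls J) (deficits Ls (I ∪ J)) (deficits Ls (I ∩ J))
               (deficit Ls I) (deficit Ls J) (deficit Ls (I ∪ J)) (deficit Ls (I ∩ J))
         (deficits-super Ls I J) (deficit-super Ls I J))

  sumIn-∖ : ∀ {n} (I J : Subset n) xs → sumIn (I ∖ J) xs + sumIn J xs ≡ sumIn (J ∖ I) xs + sumIn I xs
  sumIn-∖ [] [] [] = refl
  sumIn-∖ (i ∷ I) (j ∷ J) (x ∷ xs) =
    trans (interchange (select (minus i j) x) (sumIn (I ∖ J) xs) (select j x) _)
    (trans (cong₂ _+_ (head i j) (sumIn-∖ I J xs)) (interchange (select (minus j i) x) (select i x) (sumIn (J ∖ I) xs) _))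
    where
    interchange : ∀ a b c d → a + b + (c + d) ≡ a + c + (b + d)
    interchange = solve-∀
    head : ∀ i j → select (minus i j) x + select j x ≡ select (minus j i) x + select i x
    head true true = refl
    head true false = ℤ.+-comm x 0ℤ
    head false true = ℤ.+-comm 0ℤ x
    head false false = refl

  positivePart-lipschitz : ∀ p {q} e → 0ℤ ≤ e → q ≡ p + e → 0ℤ ⊔ q ≤ (0ℤ ⊔ p) + e
  positivePart-lipschitz p e 0≤e refl = ℤ.⊔-lub (ℤ.+-mono-≤ (ℤ.i≤i⊔j 0ℤ p) 0≤e) (ℤ.+-monoˡ-≤ e (ℤ.i≤j⊔i 0ℤ p))

  -- Deleting I ∩ J from J lowers the deficits by at most one per deleted active row, and the number
  -- of these rows is exactly the difference of the two width sums.
  deficits-cross : ∀ {n} (Ls : Vec Label n) I J →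
    deficits Ls J + deficit Ls J + sumIn (I ∖ J) (widths Ls) ≤
    deficits Ls (J ∖ I) + deficit Ls (J ∖ I) + sumIn I (widths Ls)
  deficits-cross [] [] [] = ℤ.≤-refl
  deficits-cross ((β , true) ∷ Ls) (i ∷ I) (j ∷ J) =
    cross-open (deficits Ls J) (deficits Ls (J ∖ I)) (deficit Ls J) (deficit Ls (J ∖ I))
      (sumIn (I ∖ J) (widths Ls)) (sumIn I (widths Ls)) _ _ (outsideℤ j) (outsideℤ (minus j i))
      (select (minus i j) w) (select i w)
      (deficits-cross Ls I J)
      (positivePart-lipschitz (bitℤ β - outsideℤ (minus j i) + deficit Ls (J ∖ I)) _ (ℤ.+-mono-≤ (ℤ.i≤j⇒0≤j-i (outside≤ i j)) (ℤ.i≤j⇒0≤j-i (deficit-mono Ls (⊑-∖ I J))))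
        (lipschitz-arg (bitℤ β) (outsideℤ j) (outsideℤ (minus j i)) (deficit Ls J) (deficit Ls (J ∖ I))))
      (head β i j)
    where
    w = widthℤ (β , true)
    outside≤ : ∀ i j → outsideℤ j ≤ outsideℤ (minus j i)
    outside≤ true true = ℤ.+≤+ z≤n
    outside≤ true false = ℤ.≤-refl
    outside≤ false j = ℤ.≤-refl
    head : ∀ β i j → outsideℤ (minus j i) - outsideℤ j + select (minus i j) (widthℤ (β , true)) ≤ select i (widthℤ (β , true))
    head true true true = ℤ.≤-refl
    head true true false = ℤ.≤-refl
    head true false true = ℤ.≤-refl
    head true false false = ℤ.≤-refl
    head false true true = ℤ.≤-refl
    head false true false = ℤ.≤-refl
    head false false true = ℤ.≤-refl
    head false false false = ℤ.≤-refl
  deficits-cross ((β , false) ∷ Ls) (i ∷ I) (j ∷ J) =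
    cross-close (deficits Ls J + deficit Ls J) (deficits Ls (J ∖ I) + deficit Ls (J ∖ I))
      (sumIn (I ∖ J) (widths Ls)) (sumIn I (widths Ls)) _ _ (select (minus i j) w) (select i w)
      (deficits-cross Ls I J) (head β i j)
    where
    w = widthℤ (β , false)
    head : ∀ β i j → (0ℤ ⊔ (bitℤ β - outsideℤ j + 0ℤ)) + select (minus i j) (widthℤ (β , false)) ≤
                     (0ℤ ⊔ (bitℤ β - outsideℤ (minus j i) + 0ℤ)) + select i (widthℤ (β , false))
    head true true true = ℤ.≤-refl
    head true true false = ℤ.≤-refl
    head true false true = ℤ.≤-refl
    head true false false = ℤ.≤-refl
    head false true true = ℤ.≤-refl
    head false true false = ℤ.≤-refl
    head false false true = ℤ.≤-refl
    head false false false = ℤ.≤-refl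

  bounds-cross : ∀ {n} (Ls : Vec Label n) ls I J →
    upperBound Ls ls (I ─ J) - lowerBound Ls ls (J ─ I) ≤ upperBound Ls ls I - lowerBound Ls ls J
  bounds-cross Ls ls I J rewrite ─≡∖ I J | ─≡∖ J I =
    cross-bounds (sumIn I (lowers ls)) (sumIn J (lowers ls)) (sumIn (I ∖ J) (lowers ls)) (sumIn (J ∖ I) (lowers ls))
      (sumIn I (widths Ls)) (sumIn (I ∖ J) (widths Ls)) (deficits Ls J + deficit Ls J)
      (deficits Ls (J ∖ I) + deficit Ls (J ∖ I))
      (ℤ.≤-reflexive (sumIn-∖ I J (lowers ls))) (deficits-cross Ls I J)

-- Systematic sampling of points with denominator D.

module SystematicSampling where

  open ScanPolynomials
  open SignedScan
  open FeasibleExponents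
  open Polytope using (continued)
  open import Data.Nat using (_+_; _*_; _≤_; _<_; _/_)
  open import Data.Nat.DivMod using (+-distrib-/-∣ʳ; m<n⇒m/n≡0; m*n/n≡m; n/n≡1; /-monoˡ-≤)
  open import Data.Nat.Divisibility using (n∣m*n; ∣-refl)
  open import Data.Nat.Tactic.RingSolver using (solve-∀)

  module Sampling (D : ℕ) {{_ : NonZero D}} where

    -- The polytope dilated by D, in natural numbers: the amount `u` above the lower bound and the
    -- outgoing surplus `S′` are given as data, so that no subtraction occurs.
    data Scaled : ∀ {n} → ℕ → Vec Label n → Vec ℕ n → Vec ℕ n → Set where
      [] : ∀ {S} → Scaled S [] [] []
      row : ∀ {n S L l} {Ls : Vec Label n} {ls xs} u S′ → u ≤ D * width L → S + u ≡ S′ + D * bit (proj₁ L) →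
              Scaled (continued 0 L S′) Ls ls xs → Scaled S (L ∷ Ls) (l ∷ ls) (D * l + u ∷ xs)

    -- Systematic sampling: the differences of the rounded partial sums ⌊(T + x₁ + … + x_r)/D⌋.
    sample : ∀ {n} → ℕ → Vec ℕ n → Exp n
    sample T [] = []
    sample T (x ∷ xs) = ((T + x) / D ∸ T / D) ∷ sample (T + x) xs

    /-unique : ∀ {j} q → j < D → (j + q * D) / D ≡ q
    /-unique {j} q j<D = trans (+-distrib-/-∣ʳ j (n∣m*n q)) (cong₂ _+_ (m<n⇒m/n≡0 j<D) (m*n/n≡m q D))

    -- `s` is the surplus of the sample, `j` the present residue of the shifted partial sum and `j₀`
    -- its residue when the block began. The scaled surplus `S′` is nonnegative and j < D, so `s`
    -- suffices for the box. At the end of a block `j₀` restarts as `j`.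
    advance : ∀ L s S′ j j₀ → j < D → s * D + j ≡ S′ + D * bit (proj₁ L) + j₀ →
              ∃ λ t → next L s ≡ just t × ∃ λ j₀′ → t * D + j ≡ continued 0 L S′ + j₀′
    advance (false , true) s S′ j j₀ j<D e = s , refl , j₀ ,
      trans e (cong (_+ j₀) (trans (cong (S′ +_) (ℕ.*-zeroʳ D)) (ℕ.+-identityʳ S′)))
    advance (false , false) s S′ j j₀ j<D e = 0 , refl , j , refl
    advance (true , κ) zero S′ j j₀ j<D e = contradiction
      (ℕ.≤-trans (ℕ.≤-reflexive (sym (ℕ.*-identityʳ D))) (ℕ.≤-trans (ℕ.m≤n+m (D * 1) S′)
        (ℕ.≤-trans (ℕ.m≤m+n (S′ + D * 1) j₀) (ℕ.≤-reflexive (sym e))))) (ℕ.<⇒≱ j<D)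
    advance (true , false) (suc s) S′ j j₀ j<D e = 0 , refl , j , refl
    advance (true , true) (suc s) S′ j j₀ j<D e = s , refl , j₀ ,
      ℕ.+-cancelˡ-≡ D _ _ (trans (sym (ℕ.+-assoc D (s * D) j)) (trans e (h S′ D j₀)))
      where
      h : ∀ S D j → S + D * 1 + j ≡ D + (S + j)
      h = solve-∀

    -- A residue below D, increased by at most D times the width, overflows at most `width L` times;
    -- the overflow is the digit of the sample.
    carry : ∀ L j u → j < D → u ≤ D * width L → ∃ λ c → ∃ λ j′ → c ≤ width L × j′ < D × j + u ≡ j′ + c * D
    carry L j u j<D u≤ with (j + u) ℕ.<? D
    ... | yes lt = 0 , j + u , z≤n , lt , sym (ℕ.+-identityʳ (j + u))
    ... | no ≮ with active L
    ...   | false = contradiction (subst (_< D) (sym j+u≡j) j<D) ≮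
      where
      j+u≡j : j + u ≡ j
      j+u≡j = trans (cong (j +_) (ℕ.n≤0⇒n≡0 (ℕ.≤-trans u≤ (ℕ.≤-reflexive (ℕ.*-zeroʳ D))))) (ℕ.+-identityʳ j)
    ...   | true = 1 , j + u ∸ D , ℕ.≤-refl ,
      ℕ.+-cancelʳ-< D _ _ (subst (_< D + D) (sym (ℕ.m∸n+n≡m D≤)) (ℕ.+-mono-<-≤ j<D (subst (u ≤_) (ℕ.*-identityʳ D) u≤))) ,
      sym (trans (cong (j + u ∸ D +_) (ℕ.+-identityʳ D)) (ℕ.m∸n+n≡m D≤))
      where
      D≤ : D ≤ j + u
      D≤ = ℕ.≮⇒≥ ≮

    sample-feasible : ∀ {n S} {Ls : Vec Label n} {ls xs} → Scaled S Ls ls xs → ∀ T q j s j₀ →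
      T ≡ j + q * D → j < D → s * D + j ≡ S + j₀ → Feasible s Ls ls (sample T xs)
    sample-feasible [] T q j s j₀ eT j<D e = []
    sample-feasible (row {S = S} {L} {l} {Ls} {ls} {xs} u S′ u≤ eS F) T q j s j₀ refl j<D e
      with carry L j u j<D u≤
    ... | c , j′ , c≤ , j′<D , ec with advance L (c + s) S′ j′ j₀ j′<D (begin
        (c + s) * D + j′ ≡⟨ h₁ c s D j′ ⟩
        s * D + (j′ + c * D) ≡⟨ cong (s * D +_) ec ⟨
        s * D + (j + u)  ≡⟨ ℕ.+-assoc (s * D) j u ⟨
        s * D + j + u    ≡⟨ cong (_+ u) e ⟩
        S + j₀ + u       ≡⟨ h₂ S j₀ u ⟩
        S + u + j₀       ≡⟨ cong (_+ j₀) eS ⟩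
        S′ + D * bit (proj₁ L) + j₀ ∎)
      where
      open ≡-Reasoning
      h₁ : ∀ c s D j → (c + s) * D + j ≡ s * D + (j + c * D)
      h₁ = solve-∀
      h₂ : ∀ S j u → S + j + u ≡ S + u + j
      h₂ = solve-∀
    ...   | t , eq , j₀′ , e′ =
      subst (λ a → Feasible s (L ∷ Ls) (l ∷ ls) (a ∷ sample T′ xs)) (sym head)
        (feasible-digit c c≤ eq (sample-feasible F T′ (q + (c + l)) j′ t j₀′ T′≡ j′<D e′))
      where
      T′ = j + q * D + (D * l + u)
      T′≡ : T′ ≡ j′ + (q + (c + l)) * D
      T′≡ = trans (h₁ j q D l u) (trans (cong (_+ (q + l) * D) ec) (h₂ j′ c q l D))
        where
        h₁ : ∀ j q D l u → j + q * D + (D * l + u) ≡ j + u + (q + l) * D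
        h₁ = solve-∀
        h₂ : ∀ j c q l D → j + c * D + (q + l) * D ≡ j + (q + (c + l)) * D
        h₂ = solve-∀
      head : T′ / D ∸ (j + q * D) / D ≡ c + l
      head = trans (cong₂ _∸_ (trans (cong (_/ D) T′≡) (/-unique (q + (c + l)) j′<D)) (/-unique q j<D))
                   (ℕ.m+n∸m≡n q (c + l))

    sumBelow : (ℕ → ℕ) → ℕ → ℕ
    sumBelow g zero = 0
    sumBelow g (suc k) = g k + sumBelow g k

    sumBelow-cong : ∀ {g h : ℕ → ℕ} → g ≗ h → sumBelow g ≗ sumBelow h
    sumBelow-cong e zero = refl
    sumBelow-cong e (suc k) = cong₂ _+_ (e k) (sumBelow-cong e k)

    sumBelow-shift : ∀ g k → sumBelow (g ∘ suc) k + g 0 ≡ sumBelow g k + g k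
    sumBelow-shift g zero = refl
    sumBelow-shift g (suc k) = begin
      g (suc k) + sumBelow (g ∘ suc) k + g 0   ≡⟨ ℕ.+-assoc (g (suc k)) _ _ ⟩
      g (suc k) + (sumBelow (g ∘ suc) k + g 0) ≡⟨ cong (g (suc k) +_) (sumBelow-shift g k) ⟩
      g (suc k) + (sumBelow g k + g k)         ≡⟨ h (g (suc k)) (sumBelow g k) (g k) ⟩
      g k + sumBelow g k + g (suc k)           ∎
      where
      open ≡-Reasoning
      h : ∀ a b c → a + (b + c) ≡ c + b + a
      h = solve-∀

    sumBelow-0 : ∀ g k → (∀ j → j < k → g j ≡ 0) → sumBelow g k ≡ 0
    sumBelow-0 g zero h = refl
    sumBelow-0 g (suc k) h = cong₂ _+_ (h k ℕ.≤-refl) (sumBelow-0 g k λ j j<k → h j (ℕ.m≤n⇒m≤1+n j<k))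

    sumBelow-∸ : ∀ (g h : ℕ → ℕ) → (∀ j → h j ≤ g j) → ∀ k →
                 sumBelow (λ j → g j ∸ h j) k + sumBelow h k ≡ sumBelow g k
    sumBelow-∸ g h le zero = refl
    sumBelow-∸ g h le (suc k) = trans (arith (g k ∸ h k) (sumBelow (λ j → g j ∸ h j) k) (h k) (sumBelow h k))
      (cong₂ _+_ (ℕ.m∸n+n≡m (le k)) (sumBelow-∸ g h le k))
      where
      arith : ∀ a b c d → a + b + (c + d) ≡ a + c + (b + d)
      arith = solve-∀

    -- Hermite's identity. Passing from T to T + 1 shifts the sum by one place and so replaces ⌊T/D⌋
    -- by ⌊T/D⌋ + 1.
    hermite : ∀ T → sumBelow (λ j → (T + j) / D) D ≡ T
    hermite zero = sumBelow-0 _ D λ j j<D → m<n⇒m/n≡0 j<D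
    hermite (suc T) = ℕ.+-cancelʳ-≡ (T / D) _ _ (begin
      sumBelow (λ j → (suc T + j) / D) D + T / D
        ≡⟨ cong₂ _+_ (sumBelow-cong (λ j → cong (_/ D) (sym (ℕ.+-suc T j))) D) (cong (_/ D) (sym (ℕ.+-identityʳ T))) ⟩
      sumBelow (g ∘ suc) D + g 0 ≡⟨ sumBelow-shift g D ⟩
      sumBelow g D + g D         ≡⟨ cong₂ _+_ (hermite T) (trans (+-distrib-/-∣ʳ T ∣-refl) (cong (T / D +_) (n/n≡1 D))) ⟩
      T + (T / D + 1)            ≡⟨ h T (T / D) ⟩
      suc T + T / D              ∎)
      where
      open ≡-Reasoning
      g = λ j → (T + j) / D
      h : ∀ a b → a + (b + 1) ≡ 1 + a + b
      h = solve-∀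

    sumVec : ∀ {n} → (ℕ → Exp n) → ℕ → Exp n
    sumVec V zero = replicate _ 0
    sumVec V (suc k) = zipWith _+_ (V k) (sumVec V k)

    sumVec-cong : ∀ {n} {V W : ℕ → Exp n} → V ≗ W → sumVec V ≗ sumVec W
    sumVec-cong e zero = refl
    sumVec-cong e (suc k) = cong₂ (zipWith _+_) (e k) (sumVec-cong e k)

    sumVec-∷ : ∀ {n} (h : ℕ → ℕ) (t : ℕ → Exp n) k → sumVec (λ j → h j ∷ t j) k ≡ sumBelow h k ∷ sumVec t k
    sumVec-∷ h t zero = refl
    sumVec-∷ h t (suc k) = cong (zipWith _+_ (h k ∷ t k)) (sumVec-∷ h t k)

    sumVec-[] : ∀ (V : ℕ → Exp 0) k → sumVec V k ≡ []
    sumVec-[] V k with sumVec V k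
    ... | [] = refl

    -- In each coordinate the sum over the shifts is a difference of two instances of Hermite's
    -- identity; hence the D samples average to the given point.
    sum-samples : ∀ {n} T (xs : Vec ℕ n) → sumVec (λ j → sample (T + j) xs) D ≡ xs
    sum-samples T [] = sumVec-[] _ D
    sum-samples T (x ∷ xs) = trans (sumVec-∷ _ _ D) (cong₂ _∷_ head
      (trans (sumVec-cong (λ j → cong (λ z → sample z xs) (swap T j x)) D) (sum-samples (T + x) xs)))
      where
      open ≡-Reasoning
      swap : ∀ T j x → T + j + x ≡ T + x + j
      swap = solve-∀
      head : sumBelow (λ j → (T + j + x) / D ∸ (T + j) / D) D ≡ x
      head = ℕ.+-cancelʳ-≡ T _ _ (begin
        sumBelow (λ j → (T + j + x) / D ∸ (T + j) / D) D + T
          ≡⟨ cong (sumBelow (λ j → (T + j + x) / D ∸ (T + j) / D) D +_) (hermite T) ⟨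
        sumBelow (λ j → (T + j + x) / D ∸ (T + j) / D) D + sumBelow (λ j → (T + j) / D) D
          ≡⟨ sumBelow-∸ (λ j → (T + j + x) / D) (λ j → (T + j) / D) (λ j → /-monoˡ-≤ D (ℕ.m≤m+n (T + j) x)) D ⟩
        sumBelow (λ j → (T + j + x) / D) D
          ≡⟨ sumBelow-cong (λ j → cong (_/ D) (swap T j x)) D ⟩
        sumBelow (λ j → (T + x + j) / D) D ≡⟨ hermite (T + x) ⟩
        T + x ≡⟨ ℕ.+-comm T x ⟩
        x + T ∎)

-- Newton polytopes over the rationals.

module NewtonPolytopes where

  open ScanPolynomials
  open SignedScan
  open FeasibleExponents
  open Polytope
  open Paramodularity
  open SystematicSampling
  open import Data.Integer.Tactic.RingSolver using () renaming (solve-∀ to solveℤ)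
  open import Data.Rational as ℚ using (ℚ; 0ℚ; 1ℚ; _+_; _*_; _-_; -_; _≤_)
  import Data.Rational.Properties as ℚ
  import Data.Rational.Unnormalised as ℚᵘ
  import Data.Rational.Unnormalised.Properties as ℚᵘ
  open import Data.Fin.Subset using (Subset; _∩_; _∪_; _─_)
  open import Data.List as List using (List; []; _∷_; foldr)
  open import Data.List.Relation.Unary.All using (All; []; _∷_)
  open import Level using (0ℓ)
  open import Relation.Nullary.Decidable using (dec⇒maybe)
  import Tactic.RingSolver as RingSolver
  open import Tactic.RingSolver.Core.AlmostCommutativeRing using (AlmostCommutativeRing; fromCommutativeRing)

  ringℚ : AlmostCommutativeRing 0ℓ 0ℓ
  ringℚ = fromCommutativeRing ℚ.+-*-commutativeRing λ x → dec⇒maybe (0ℚ ℚ.≟ x)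

  cast : ℤ → ℚ
  cast z = z ℚ./ 1

  integer : ℤ → ℚᵘ.ℚᵘ
  integer z = ℚᵘ.mkℚᵘ z 0

  toℚᵘ-cast : ∀ z → ℚ.toℚᵘ (cast z) ℚᵘ.≃ integer z
  toℚᵘ-cast z = ℚ.toℚᵘ-fromℚᵘ (integer z)

  cast-+ : ∀ a b → cast (a ℤ.+ b) ≡ cast a + cast b
  cast-+ a b = ℚ.toℚᵘ-injective (begin
    ℚ.toℚᵘ (cast (a ℤ.+ b))                   ≈⟨ toℚᵘ-cast (a ℤ.+ b) ⟩
    integer (a ℤ.+ b)                         ≡⟨ cong₂ (λ x y → integer (x ℤ.+ y)) (ℤ.*-identityʳ a) (ℤ.*-identityʳ b) ⟨
    integer a ℚᵘ.+ integer b                  ≈⟨ ℚᵘ.+-cong (toℚᵘ-cast a) (toℚᵘ-cast b) ⟨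
    ℚ.toℚᵘ (cast a) ℚᵘ.+ ℚ.toℚᵘ (cast b)      ≈⟨ ℚ.toℚᵘ-homo-+ (cast a) (cast b) ⟨
    ℚ.toℚᵘ (cast a + cast b)                  ∎)
    where open ℚᵘ.≃-Reasoning

  cast-* : ∀ a b → cast (a ℤ.* b) ≡ cast a * cast b
  cast-* a b = ℚ.toℚᵘ-injective (begin
    ℚ.toℚᵘ (cast (a ℤ.* b))                   ≈⟨ toℚᵘ-cast (a ℤ.* b) ⟩
    integer a ℚᵘ.* integer b                  ≈⟨ ℚᵘ.*-cong (toℚᵘ-cast a) (toℚᵘ-cast b) ⟨
    ℚ.toℚᵘ (cast a) ℚᵘ.* ℚ.toℚᵘ (cast b)      ≈⟨ ℚ.toℚᵘ-homo-* (cast a) (cast b) ⟨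
    ℚ.toℚᵘ (cast a * cast b)                  ∎)
    where open ℚᵘ.≃-Reasoning

  cast-neg : ∀ a → cast (ℤ.- a) ≡ - cast a
  cast-neg a = ℚ.toℚᵘ-injective (begin
    ℚ.toℚᵘ (cast (ℤ.- a))   ≈⟨ toℚᵘ-cast (ℤ.- a) ⟩
    ℚᵘ.- integer a          ≈⟨ ℚᵘ.-‿cong (toℚᵘ-cast a) ⟨
    ℚᵘ.- ℚ.toℚᵘ (cast a)    ≈⟨ ℚ.toℚᵘ-homo‿- (cast a) ⟨
    ℚ.toℚᵘ (- cast a)       ∎)
    where open ℚᵘ.≃-Reasoning

  cast-- : ∀ a b → cast (a ℤ.- b) ≡ cast a - cast b
  cast-- a b = trans (cast-+ a (ℤ.- b)) (cong (λ z → cast a + z) (cast-neg b))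

  cast-mono : ∀ {a b} → a ℤ.≤ b → cast a ≤ cast b
  cast-mono {a} {b} le = ℚ.toℚᵘ-cancel-≤ (begin
    ℚ.toℚᵘ (cast a) ≃⟨ toℚᵘ-cast a ⟩
    integer a       ≤⟨ ℚᵘ.*≤* (ℤ.*-monoʳ-≤-nonNeg 1ℤ le) ⟩
    integer b       ≃⟨ toℚᵘ-cast b ⟨
    ℚ.toℚᵘ (cast b) ∎)
    where open ℚᵘ.≤-Reasoning

  cast-cancel : ∀ {a b} → cast a ≤ cast b → a ℤ.≤ b
  cast-cancel {a} {b} le = ℤ.*-cancelʳ-≤-pos a b 1ℤ (ℚᵘ.drop-*≤* (begin
    integer a       ≃⟨ toℚᵘ-cast a ⟨
    ℚ.toℚᵘ (cast a) ≤⟨ ℚ.toℚᵘ-mono-≤ le ⟩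
    ℚ.toℚᵘ (cast b) ≃⟨ toℚᵘ-cast b ⟩
    integer b       ∎))
    where open ℚᵘ.≤-Reasoning

  cast-injective : ∀ {a b} → cast a ≡ cast b → a ≡ b
  cast-injective e = ℤ.≤-antisym (cast-cancel (ℚ.≤-reflexive e)) (cast-cancel (ℚ.≤-reflexive (sym e)))

  ↧-*-↥ : ∀ q → cast (ℚ.↧ q) * q ≡ cast (ℚ.↥ q)
  ↧-*-↥ q = ℚ.toℚᵘ-injective (begin
    ℚ.toℚᵘ (cast (ℚ.↧ q) * q)                ≈⟨ ℚ.toℚᵘ-homo-* (cast (ℚ.↧ q)) q ⟩
    ℚ.toℚᵘ (cast (ℚ.↧ q)) ℚᵘ.* ℚ.toℚᵘ q      ≈⟨ ℚᵘ.*-congʳ {ℚ.toℚᵘ q} (toℚᵘ-cast (ℚ.↧ q)) ⟩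
    integer (ℚ.↧ q) ℚᵘ.* ℚ.toℚᵘ q            ≈⟨ h q ⟩
    integer (ℚ.↥ q)                          ≈⟨ toℚᵘ-cast (ℚ.↥ q) ⟨
    ℚ.toℚᵘ (cast (ℚ.↥ q))                    ∎)
    where
    open ℚᵘ.≃-Reasoning
    h : ∀ q → integer (ℚ.↧ q) ℚᵘ.* ℚ.toℚᵘ q ℚᵘ.≃ integer (ℚ.↥ q)
    h q@record{} = ℚᵘ.*≡* (trans (ℤ.*-identityʳ (ℚ.↧ q ℤ.* ℚ.↥ q)) (trans (ℤ.*-comm (ℚ.↧ q) (ℚ.↥ q))
      (cong (ℚ.↥ q ℤ.*_) (cong ℤ.+_ (sym (ℕ.*-identityˡ (ℚ.↧ₙ q)))))))

  ℕtoℚ-positive : ∀ D {{_ : NonZero D}} → ℚ.Positive (ℕtoℚ D)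
  ℕtoℚ-positive D = ℚ.normalize-pos D 1

  Scales : ∀ {n} → ℕ → Vec ℚ n → Vec ℤ n → Set
  Scales D = Pointwise (λ q z → ℕtoℚ D * q ≡ cast z)

  module RingIdentities where
    scale-swap : ∀ D d q → D * d * q ≡ d * (D * q)
    scale-swap = RingSolver.solve-∀ ringℚ

    scale-combine : ∀ D d t a acc → D * d * (t * a + acc) ≡ D * (d * t) * a + d * (D * acc)
    scale-combine = RingSolver.solve-∀ ringℚ

    scale-sum : ∀ D d t T → D * d * (t + T) ≡ D * (d * t) + d * (D * T)
    scale-sum = RingSolver.solve-∀ ringℚ

    add-weight : ∀ p k → p + p * k ≡ p * (1ℚ + k)
    add-weight = RingSolver.solve-∀ ringℚ

  open RingIdentities

  commonDenominator : ∀ {n} (x : Vec ℚ n) → ∃ λ D → NonZero D × ∃ λ X → Scales D x X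
  commonDenominator [] = 1 , _ , [] , []
  commonDenominator (q ∷ x) with commonDenominator x
  ... | D , D≢0 , X , S = D ℕ.* d , ℕ.m*n≢0 D d {{D≢0}} , ℤ.+ D ℤ.* ℚ.↥ q ∷ Vec.map (ℤ.+ d ℤ.*_) X , head ∷ tail S
    where
    d = ℚ.↧ₙ q
    D*d : ℕtoℚ (D ℕ.* d) ≡ ℕtoℚ D * ℕtoℚ d
    D*d = trans (cong cast (ℤ.pos-* D d)) (cast-* (ℤ.+ D) (ℤ.+ d))
    head : ℕtoℚ (D ℕ.* d) * q ≡ cast (ℤ.+ D ℤ.* ℚ.↥ q)
    head = begin
      ℕtoℚ (D ℕ.* d) * q         ≡⟨ cong (λ z → z * q) D*d ⟩
      ℕtoℚ D * ℕtoℚ d * q        ≡⟨ ℚ.*-assoc (ℕtoℚ D) (ℕtoℚ d) q ⟩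
      ℕtoℚ D * (ℕtoℚ d * q)      ≡⟨ cong (λ z → ℕtoℚ D * z) (↧-*-↥ q) ⟩
      ℕtoℚ D * cast (ℚ.↥ q)      ≡⟨ cast-* (ℤ.+ D) (ℚ.↥ q) ⟨
      cast (ℤ.+ D ℤ.* ℚ.↥ q)     ∎
      where open ≡-Reasoning
    tail : ∀ {n} {x : Vec ℚ n} {X} → Scales D x X → Scales (D ℕ.* d) x (Vec.map (ℤ.+ d ℤ.*_) X)
    tail [] = []
    tail (_∷_ {x = q′} {y = z} e S) = (begin
      ℕtoℚ (D ℕ.* d) * q′        ≡⟨ cong (λ z → z * q′) D*d ⟩
      ℕtoℚ D * ℕtoℚ d * q′       ≡⟨ scale-swap (ℕtoℚ D) (ℕtoℚ d) q′ ⟩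
      ℕtoℚ d * (ℕtoℚ D * q′)     ≡⟨ cong (λ z → ℕtoℚ d * z) e ⟩
      ℕtoℚ d * cast z            ≡⟨ cast-* (ℤ.+ d) z ⟨
      cast (ℤ.+ d ℤ.* z)         ∎) ∷ tail S
      where open ≡-Reasoning

  selectℚ : Bool → ℚ → ℚ
  selectℚ i q = if i then q else 0ℚ

  sumOver′ : ∀ {n} → Subset n → Vec ℚ n → ℚ
  sumOver′ [] [] = 0ℚ
  sumOver′ (i ∷ I) (x ∷ xs) = selectℚ i x + sumOver′ I xs

  -- Unification supplies the local selector of `sumOver` as the argument `f` of `fold-ext`;
  -- agreement with `selectℚ` on both Booleans is all that is used.
  sumOver≡sumOver′ : ∀ {n} (I : Subset n) x → sumOver I x ≡ sumOver′ I x
  sumOver≡sumOver′ I x = fold-ext _ (λ { true q → refl ; false q → refl }) I x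
    where
    fold-ext : ∀ {n} (f : Bool → ℚ → ℚ) → (∀ i q → f i q ≡ selectℚ i q) →
               ∀ (I : Subset n) x → Vec.foldr (λ _ → ℚ) _+_ 0ℚ (zipWith (λ s a → f s a) I x) ≡ sumOver′ I x
    fold-ext f e [] [] = refl
    fold-ext f e (i ∷ I) (x ∷ xs) = cong₂ _+_ (e i x) (fold-ext f e I xs)

  scaled-sum′ : ∀ {n} D (I : Subset n) {x X} → Scales D x X → ℕtoℚ D * sumOver′ I x ≡ cast (sumIn I X)
  scaled-sum′ D [] [] = ℚ.*-zeroʳ (ℕtoℚ D)
  scaled-sum′ D (i ∷ I) (_∷_ {x = q} {y = z} {xs = x} {ys = X} e S) = begin
    ℕtoℚ D * (selectℚ i q + sumOver′ I x)           ≡⟨ ℚ.*-distribˡ-+ (ℕtoℚ D) (selectℚ i q) (sumOver′ I x) ⟩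
    ℕtoℚ D * selectℚ i q + ℕtoℚ D * sumOver′ I x    ≡⟨ cong₂ _+_ (head i) (scaled-sum′ D I S) ⟩
    cast (select i z) + cast (sumIn I X)            ≡⟨ cast-+ (select i z) (sumIn I X) ⟨
    cast (select i z ℤ.+ sumIn I X)                 ∎
    where
    open ≡-Reasoning
    head : ∀ i → ℕtoℚ D * selectℚ i q ≡ cast (select i z)
    head true = e
    head false = ℚ.*-zeroʳ (ℕtoℚ D)

  scaled-sum : ∀ {n} D (I : Subset n) {x X} → Scales D x X → ℕtoℚ D * sumOver I x ≡ cast (sumIn I X)
  scaled-sum D I {x} S = trans (cong (λ z → ℕtoℚ D * z) (sumOver≡sumOver′ I x)) (scaled-sum′ D I S)

  lowerℚ upperℚ : ∀ {n} → Vec Label n → Vec ℕ n → Subset n → ℚ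
  lowerℚ Ls ls I = cast (lowerBound Ls ls I)
  upperℚ Ls ls I = cast (upperBound Ls ls I)

  bounds-paramodular : ∀ {n} (Ls : Vec Label n) ls → Paramodular (lowerℚ Ls ls) (upperℚ Ls ls)
  bounds-paramodular Ls ls =
    cong cast (lowerBound-∅ Ls ls) , cong cast (upperBound-∅ Ls ls) ,
    (λ I J → subst₂ _≤_ (cast-+ (lb I) (lb J)) (cast-+ (lb (I ∪ J)) (lb (I ∩ J))) (cast-mono (lowerBound-supermodular Ls ls I J))) ,
    (λ I J → subst₂ _≤_ (cast-+ (ub (I ∪ J)) (ub (I ∩ J))) (cast-+ (ub I) (ub J)) (cast-mono (upperBound-submodular Ls ls I J))) ,
    (λ I J → subst₂ _≤_ (cast-- (ub (I ─ J)) (lb (J ─ I))) (cast-- (ub I) (lb J)) (cast-mono (bounds-cross Ls ls I J)))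
    where
    lb = lowerBound Ls ls
    ub = upperBound Ls ls

  WithinBounds : ∀ {n} → Vec Label n → Vec ℕ n → Vec ℚ n → Set
  WithinBounds Ls ls x = ∀ I → (lowerℚ Ls ls I ≤ sumOver I x) × (sumOver I x ≤ upperℚ Ls ls I)

  scaled-bounds⇒polytope : ∀ {n} {Ls : Vec Label n} {ls} D {x X} → Scales D x X → WithinBounds Ls ls x →
                           InPolytope (ℤ.+ D) 0ℤ Ls ls X
  scaled-bounds⇒polytope {Ls = Ls} {ls} D {x} {X} S h = bounds⇒polytope (ℤ.+ D) Ls ls X (ℤ.+≤+ z≤n) λ I →
    cast-cancel (subst₂ _≤_ (sym (cast-* (ℤ.+ D) (lowerBound Ls ls I))) (scaled-sum D I S) (mono (proj₁ (h I)))) ,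
    cast-cancel (subst₂ _≤_ (scaled-sum D I S) (sym (cast-* (ℤ.+ D) (upperBound Ls ls I))) (mono (proj₂ (h I))))
    where
    mono : ∀ {a b} → a ≤ b → ℕtoℚ D * a ≤ ℕtoℚ D * b
    mono = ℚ.*-monoˡ-≤-nonNeg (ℕtoℚ D) {{ℚ.normalize-nonNeg D 1}}

  polytope⇒scaled-bounds : ∀ {n} {Ls : Vec Label n} {ls} D {{_ : NonZero D}} {x X} → Scales D x X →
                           InPolytope (ℤ.+ D) 0ℤ Ls ls X → WithinBounds Ls ls x
  polytope⇒scaled-bounds {Ls = Ls} {ls} D {x} {X} S p I =
    cancel (subst₂ _≤_ (cast-* (ℤ.+ D) (lowerBound Ls ls I)) (sym (scaled-sum D I S)) (cast-mono (proj₁ (b I)))) ,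
    cancel (subst₂ _≤_ (sym (scaled-sum D I S)) (cast-* (ℤ.+ D) (upperBound Ls ls I)) (cast-mono (proj₂ (b I))))
    where
    b = polytope⇒bounds (ℤ.+ D) Ls ls X (ℤ.+≤+ z≤n) p
    cancel : ∀ {a b} → ℕtoℚ D * a ≤ ℕtoℚ D * b → a ≤ b
    cancel = ℚ.*-cancelˡ-≤-pos (ℕtoℚ D) {{ℕtoℚ-positive D}}

  nonneg⇒ℕ : ∀ {z} → 0ℤ ℤ.≤ z → ∃ λ m → z ≡ ℤ.+ m
  nonneg⇒ℕ {ℤ.+ m} _ = m , refl

  -- The inequalities make the entries and surpluses nonnegative, so the integers may be exchanged
  -- for natural numbers.
  polytope⇒Scaled : ∀ {n} D {{_ : NonZero D}} S (Ls : Vec Label n) ls X → InPolytope (ℤ.+ D) (ℤ.+ S) Ls ls X →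
                    ∃ λ X′ → X ≡ toℤᵥ X′ × Sampling.Scaled D S Ls ls X′
  polytope⇒Scaled D S [] [] [] _ = [] , refl , Sampling.[]
  polytope⇒Scaled D S (L ∷ Ls) (l ∷ ls) (x ∷ X) (p₁ , p₂ , p₃ , p)
    with nonneg⇒ℕ (ℤ.≤-trans (ℤ.≤-trans (ℤ.+≤+ z≤n) (ℤ.≤-reflexive (ℤ.pos-* D l))) p₁) | nonneg⇒ℕ p₃
  ... | x′ , refl | S′ , eS
    with polytope⇒Scaled D (continued 0 L S′) Ls ls X (subst (λ s → InPolytope (ℤ.+ D) s Ls ls X) (continued-cast L eS) p)
    where
    continued-cast : ∀ L {s} → s ≡ ℤ.+ S′ → continued 0ℤ L s ≡ ℤ.+ continued 0 L S′
    continued-cast (β , true) e = e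
    continued-cast (β , false) e = refl
  ... | X′ , refl , F = x′ ∷ X′ , refl , subst (λ z → Sampling.Scaled D S (L ∷ Ls) (l ∷ ls) (z ∷ X′)) (sym x′≡)
      (Sampling.row u S′ u≤ sum≡ F)
    where
    Dl≤x′ : D ℕ.* l ℕ.≤ x′
    Dl≤x′ = ℤ.drop‿+≤+ (subst (ℤ._≤ ℤ.+ x′) (sym (ℤ.pos-* D l)) p₁)
    u = x′ ℕ.∸ D ℕ.* l
    x′≡ : x′ ≡ D ℕ.* l ℕ.+ u
    x′≡ = sym (ℕ.m+[n∸m]≡n Dl≤x′)
    u≤ : u ℕ.≤ D ℕ.* width L
    u≤ = ℕ.+-cancelˡ-≤ (D ℕ.* l) _ _ (ℤ.drop‿+≤+ (subst₂ ℤ._≤_ (cong ℤ.+_ x′≡)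
      (cong₂ ℤ._+_ (sym (ℤ.pos-* D l)) (sym (ℤ.pos-* D (width L)))) p₂))
    arith : ∀ S l u b r → S ℤ.+ ((l ℤ.+ u) ℤ.- l) ℤ.- b ≡ r → S ℤ.+ u ≡ r ℤ.+ b
    arith S l u b r refl = h S l u b
      where
      h : ∀ S l u b → S ℤ.+ u ≡ S ℤ.+ ((l ℤ.+ u) ℤ.- l) ℤ.- b ℤ.+ b
      h = solveℤ
    sum≡ : S ℕ.+ u ≡ S′ ℕ.+ D ℕ.* bit (proj₁ L)
    sum≡ = ℤ.+-injective (trans
      (arith (ℤ.+ S) (ℤ.+ D ℤ.* ℤ.+ l) (ℤ.+ u) (ℤ.+ D ℤ.* bitℤ (proj₁ L)) (ℤ.+ S′)
        (trans (cong (λ z → ℤ.+ S ℤ.+ (z ℤ.- ℤ.+ D ℤ.* ℤ.+ l) ℤ.- ℤ.+ D ℤ.* bitℤ (proj₁ L))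
          (trans (cong (ℤ._+ ℤ.+ u) (sym (ℤ.pos-* D l))) (cong ℤ.+_ (sym x′≡)))) eS))
      (cong (λ z → ℤ.+ S′ ℤ.+ z) (sym (ℤ.pos-* D (bit (proj₁ L))))))

  combine : ∀ {n} → List (ℚ × Exp n) → Vec ℚ n
  combine {n} = foldr (λ t acc → zipWith _+_ (Vec.map (λ a → proj₁ t * ℕtoℚ a) (proj₂ t)) acc) (replicate n 0ℚ)

  totalWeight : ∀ {n} → List (ℚ × Exp n) → ℚ
  totalWeight ts = foldr _+_ 0ℚ (List.map proj₁ ts)

  ↥-nonneg : ∀ {t} → 0ℚ ≤ t → 0ℤ ℤ.≤ ℚ.↥ t
  ↥-nonneg {t} p = subst₂ ℤ._≤_ (ℤ.*-zeroˡ (ℚ.↧ t)) (ℤ.*-identityʳ (ℚ.↥ t)) (ℚ.drop-*≤* p)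

  module NewtonPolytope {n} (f : Poly n) (Ls : Vec Label n) (ls : Vec ℕ n)
    (supp⇒feasible : ∀ {α} → InSupp f α → Feasible 0 Ls ls α)
    (feasible⇒supp : ∀ {α} → Feasible 0 Ls ls α → InSupp f α) where

    -- The scaled total weight `W` takes the place of τ, so partial combinations of any weight are
    -- covered by the induction; the empty one is the apex of the cone.
    combination⇒polytope : ∀ ts → All (λ t → (0ℚ ≤ proj₁ t) × InSupp f (proj₂ t)) ts →
      ∃ λ D → NonZero D × ∃ λ W → ∃ λ X → ℕtoℚ D * totalWeight ts ≡ cast W × Scales D (combine ts) X × InPolytope W 0ℤ Ls ls X
    combination⇒polytope [] [] = 1 , _ , 0ℤ , replicate n 0ℤ , refl , zeros n , polytope-0 Ls ls
      where
      zeros : ∀ n → Scales 1 (replicate n 0ℚ) (replicate n 0ℤ)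
      zeros zero = []
      zeros (suc n) = refl ∷ zeros n
    combination⇒polytope ((t , α) ∷ ts) ((0≤t , f∋α) ∷ all) with combination⇒polytope ts all
    ... | D , D≢0 , W , X , eW , S , p =
      D ℕ.* d , ℕ.m*n≢0 D d {{D≢0}} , m ℤ.+ ℤ.+ d ℤ.* W ,
      X⁺ , weight , scales α S ,
      subst₂ (λ τ s → InPolytope τ s Ls ls X⁺) (cong (ℤ._+ ℤ.+ d ℤ.* W) (ℤ.*-identityʳ m))
        (cong₂ ℤ._+_ (ℤ.*-zeroʳ m) (ℤ.*-zeroʳ (ℤ.+ d)))
        (polytope-+ (m ℤ.* 1ℤ) (ℤ.+ d ℤ.* W) (m ℤ.* 0ℤ) (ℤ.+ d ℤ.* 0ℤ) Ls ls
          (polytope-scale m 1ℤ 0ℤ Ls ls 0≤m (feasible⇒polytope (supp⇒feasible f∋α)))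
          (polytope-scale (ℤ.+ d) W 0ℤ Ls ls (ℤ.+≤+ z≤n) p))
      where
      open ≡-Reasoning
      d = ℚ.↧ₙ t
      m = ℤ.+ D ℤ.* ℚ.↥ t
      X⁺ = zipWith ℤ._+_ (Vec.map (m ℤ.*_) (toℤᵥ α)) (Vec.map (ℤ.+ d ℤ.*_) X)
      0≤m : 0ℤ ℤ.≤ m
      0≤m = subst (ℤ._≤ m) (ℤ.*-zeroʳ (ℤ.+ D)) (*-monoˡ-nonneg {ℤ.+ D} (ℤ.+≤+ z≤n) (↥-nonneg 0≤t))
      D*d : ℕtoℚ (D ℕ.* d) ≡ ℕtoℚ D * ℕtoℚ d
      D*d = trans (cong cast (ℤ.pos-* D d)) (cast-* (ℤ.+ D) (ℤ.+ d))
      D*dt : ℕtoℚ D * (ℕtoℚ d * t) ≡ cast m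
      D*dt = trans (cong (λ z → ℕtoℚ D * z) (↧-*-↥ t)) (sym (cast-* (ℤ.+ D) (ℚ.↥ t)))
      weight : ℕtoℚ (D ℕ.* d) * (t + totalWeight ts) ≡ cast (m ℤ.+ ℤ.+ d ℤ.* W)
      weight = begin
        ℕtoℚ (D ℕ.* d) * (t + totalWeight ts)
          ≡⟨ cong (λ z → z * (t + totalWeight ts)) D*d ⟩
        ℕtoℚ D * ℕtoℚ d * (t + totalWeight ts)
          ≡⟨ scale-sum (ℕtoℚ D) (ℕtoℚ d) t (totalWeight ts) ⟩
        ℕtoℚ D * (ℕtoℚ d * t) + ℕtoℚ d * (ℕtoℚ D * totalWeight ts)
          ≡⟨ cong₂ _+_ D*dt (trans (cong (λ z → ℕtoℚ d * z) eW) (sym (cast-* (ℤ.+ d) W))) ⟩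
        cast m + cast (ℤ.+ d ℤ.* W) ≡⟨ cast-+ m (ℤ.+ d ℤ.* W) ⟨
        cast (m ℤ.+ ℤ.+ d ℤ.* W) ∎
      scales : ∀ {k} (α : Exp k) {x X} → Scales D x X →
               Scales (D ℕ.* d) (zipWith _+_ (Vec.map (λ a → t * ℕtoℚ a) α) x)
                      (zipWith ℤ._+_ (Vec.map (m ℤ.*_) (toℤᵥ α)) (Vec.map (ℤ.+ d ℤ.*_) X))
      scales [] [] = []
      scales (a ∷ α) (_∷_ {x = q} {y = z} e S) = (begin
        ℕtoℚ (D ℕ.* d) * (t * ℕtoℚ a + q)     ≡⟨ cong (λ z → z * (t * ℕtoℚ a + q)) D*d ⟩
        ℕtoℚ D * ℕtoℚ d * (t * ℕtoℚ a + q)    ≡⟨ scale-combine (ℕtoℚ D) (ℕtoℚ d) t (ℕtoℚ a) q ⟩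
        ℕtoℚ D * (ℕtoℚ d * t) * ℕtoℚ a + ℕtoℚ d * (ℕtoℚ D * q)
          ≡⟨ cong₂ _+_ (trans (cong (λ z → z * ℕtoℚ a) D*dt) (sym (cast-* m (ℤ.+ a))))
                       (trans (cong (λ z → ℕtoℚ d * z) e) (sym (cast-* (ℤ.+ d) z))) ⟩
        cast (m ℤ.* ℤ.+ a) + cast (ℤ.+ d ℤ.* z) ≡⟨ cast-+ (m ℤ.* ℤ.+ a) (ℤ.+ d ℤ.* z) ⟨
        cast (m ℤ.* ℤ.+ a ℤ.+ ℤ.+ d ℤ.* z) ∎) ∷ scales α S

    newton⇒bounds : ∀ {x} → InNewton f x → WithinBounds Ls ls x
    newton⇒bounds {x} (ts , all , total , x≡) with combination⇒polytope ts all
    ... | D , D≢0 , W , X , eW , S , p = polytope⇒scaled-bounds D {{D≢0}} (subst (λ x → Scales D x X) (sym x≡) S)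
        (subst (λ W → InPolytope W 0ℤ Ls ls X) W≡D p)
      where
      W≡D : W ≡ ℤ.+ D
      W≡D = cast-injective (trans (sym eW) (trans (cong (λ z → ℕtoℚ D * z) total) (ℚ.*-identityʳ (ℕtoℚ D))))

    module _ (D : ℕ) {{_ : NonZero D}} where

      open Sampling D

      private
        p : ℚ
        p = (ℚ.1/ ℕtoℚ D) {{ℚ.pos⇒nonZero (ℕtoℚ D) {{ℕtoℚ-positive D}}}}

      p*D : p * ℕtoℚ D ≡ 1ℚ
      p*D = ℚ.*-inverseˡ (ℕtoℚ D) {{ℚ.pos⇒nonZero (ℕtoℚ D) {{ℕtoℚ-positive D}}}}

      0≤p : 0ℚ ≤ p
      0≤p = ℚ.<⇒≤ (ℚ.positive⁻¹ p {{ℚ.1/pos⇒pos (ℕtoℚ D) {{ℕtoℚ-positive D}}}})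

      average : (ℕ → Exp n) → ℕ → List (ℚ × Exp n)
      average V zero = []
      average V (suc k) = (p , V k) ∷ average V k

      average-weights : ∀ V k → totalWeight (average V k) ≡ p * ℕtoℚ k
      average-weights V zero = sym (ℚ.*-zeroʳ p)
      average-weights V (suc k) = begin
        p + totalWeight (average V k) ≡⟨ cong (λ z → p + z) (average-weights V k) ⟩
        p + p * ℕtoℚ k                ≡⟨ add-weight p (ℕtoℚ k) ⟩
        p * (1ℚ + ℕtoℚ k)             ≡⟨ cong (λ z → p * z) (cast-+ 1ℤ (ℤ.+ k)) ⟨
        p * ℕtoℚ (suc k)              ∎
        where open ≡-Reasoning

      average-combine : ∀ V k → combine (average V k) ≡ Vec.map (λ a → p * ℕtoℚ a) (sumVec V k)
      average-combine V zero = zeros n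
        where
        zeros : ∀ n → replicate n 0ℚ ≡ Vec.map (λ a → p * ℕtoℚ a) (replicate n 0)
        zeros zero = refl
        zeros (suc n) = cong₂ _∷_ (sym (ℚ.*-zeroʳ p)) (zeros n)
      average-combine V (suc k) = trans (cong (zipWith _+_ _) (average-combine V k)) (add (V k) (sumVec V k))
        where
        add : ∀ {k} (α β : Exp k) → zipWith _+_ (Vec.map (λ a → p * ℕtoℚ a) α) (Vec.map (λ a → p * ℕtoℚ a) β)
              ≡ Vec.map (λ a → p * ℕtoℚ a) (zipWith ℕ._+_ α β)
        add [] [] = refl
        add (a ∷ α) (b ∷ β) = cong₂ _∷_
          (trans (sym (ℚ.*-distribˡ-+ p (ℕtoℚ a) (ℕtoℚ b))) (cong (λ z → p * z) (sym (cast-+ (ℤ.+ a) (ℤ.+ b)))))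
          (add α β)

      unscale : ∀ {k} {x : Vec ℚ k} (X : Vec ℕ k) → Scales D x (toℤᵥ X) → x ≡ Vec.map (λ a → p * ℕtoℚ a) X
      unscale [] [] = refl
      unscale (a ∷ X) (_∷_ {x = q} e S) = cong₂ _∷_ (begin
        q                   ≡⟨ ℚ.*-identityˡ q ⟨
        1ℚ * q              ≡⟨ cong (λ z → z * q) p*D ⟨
        p * ℕtoℚ D * q      ≡⟨ ℚ.*-assoc p (ℕtoℚ D) q ⟩
        p * (ℕtoℚ D * q)    ≡⟨ cong (λ z → p * z) e ⟩
        p * ℕtoℚ a          ∎) (unscale X S)
        where open ≡-Reasoning

      scaled⇒newton : ∀ {x X} → Scales D x (toℤᵥ X) → Scaled 0 Ls ls X → InNewton f x
      scaled⇒newton {x} {X} S F = average V D , all D ℕ.≤-refl ,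
        trans (average-weights V D) p*D ,
        trans (unscale X S) (trans (cong (Vec.map (λ a → p * ℕtoℚ a)) (sym (sum-samples 0 X))) (sym (average-combine V D)))
        where
        V : ℕ → Exp n
        V j = sample j X
        all : ∀ k → k ℕ.≤ D → All (λ t → (0ℚ ≤ proj₁ t) × InSupp f (proj₂ t)) (average V k)
        all zero _ = []
        -- Shift k < D: quotient 0 and residue k, with `j₀` also k, so that both surpluses start at
        -- zero.
        all (suc k) k<D = (0≤p , feasible⇒supp (sample-feasible F k 0 k 0 k (sym (ℕ.+-identityʳ k)) k<D refl)) ∷
          all k (ℕ.<⇒≤ k<D)

    bounds⇒newton : ∀ {x} → WithinBounds Ls ls x → InNewton f x
    bounds⇒newton {x} h = clear (commonDenominator x)
      where
      integral : ∀ D {{_ : NonZero D}} {X} → Scales D x X →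
                 (∃ λ X′ → X ≡ toℤᵥ X′ × Sampling.Scaled D 0 Ls ls X′) → InNewton f x
      integral D S (X′ , refl , F) = scaled⇒newton D S F
      clear : (∃ λ D → NonZero D × ∃ λ X → Scales D x X) → InNewton f x
      clear (D , D≢0 , X , S) =
        integral D {{D≢0}} S (polytope⇒Scaled D {{D≢0}} 0 Ls ls X (scaled-bounds⇒polytope D S h))

    newton-genPolymatroid : IsGenPolymatroid (InNewton f)
    newton-genPolymatroid = lowerℚ Ls ls , upperℚ Ls ls , bounds-paramodular Ls ls , λ x → mk⇔ newton⇒bounds bounds⇒newton

    scales-1 : ∀ {k} (β : Vec ℤ k) → Scales 1 (toℚᵥ β) β
    scales-1 [] = []
    scales-1 (b ∷ β) = ℚ.*-identityˡ (cast b) ∷ scales-1 β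

    -- With denominator 1 there is a single sample, and it is the lattice point itself, which is
    -- therefore feasible.
    newton⇒supp : ∀ β → InNewton f (toℚᵥ β) → InSuppℤ f β
    newton⇒supp β N =
      integral (polytope⇒Scaled 1 0 Ls ls β (scaled-bounds⇒polytope 1 (scales-1 β) (newton⇒bounds N)))
      where
      sum-zeros : ∀ {k} (α : Exp k) → zipWith ℕ._+_ α (replicate k 0) ≡ α
      sum-zeros [] = refl
      sum-zeros (a ∷ α) = cong₂ _∷_ (ℕ.+-identityʳ a) (sum-zeros α)
      sample≡ : ∀ β → Sampling.sample 1 0 β ≡ β
      sample≡ β = trans (sym (sum-zeros (Sampling.sample 1 0 β))) (Sampling.sum-samples 1 0 β)
      integral : ∀ {β} → (∃ λ β′ → β ≡ toℤᵥ β′ × Sampling.Scaled 1 0 Ls ls β′) → InSuppℤ f β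
      integral (β′ , refl , F) = β′ , refl , feasible⇒supp (subst (Feasible 0 Ls ls) (sample≡ β′)
        (Sampling.sample-feasible 1 F 0 0 0 0 0 refl ℕ.≤-refl refl))

    supp⇒newton : ∀ β → InSuppℤ f β → InNewton f (toℚᵥ β)
    supp⇒newton β (α , refl , f∋α) =
      (1ℚ , α) ∷ [] , (ℚ.nonNegative⁻¹ 1ℚ , f∋α) ∷ [] , refl , singleton α
      where
      singleton : ∀ {k} (α : Exp k) → toℚᵥ (toℤᵥ α) ≡ zipWith _+_ (Vec.map (λ a → 1ℚ * ℕtoℚ a) α) (replicate k 0ℚ)
      singleton [] = refl
      singleton (a ∷ α) = cong₂ _∷_ (sym (trans (ℚ.+-identityʳ (1ℚ * ℕtoℚ a)) (ℚ.*-identityˡ (ℕtoℚ a)))) (singleton α)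

    newton-saturated : ∀ β → InNewton f (toℚᵥ β) ⇔ InSuppℤ f β
    newton-saturated β = mk⇔ (newton⇒supp β) (supp⇒newton β)

open import Data.Nat using (ℕ; suc; _<_)
open import Data.Integer using (ℤ; 1ℤ; 0ℤ; _+_)
open import Data.Fin.Permutation using (Permutation′)
open import Data.Vec using (Vec)
open import Data.List using (map; foldr)
open import Data.Product using (Σ; _×_; _,_)
open import Relation.Binary.PropositionalEquality using (_≡_)
open import Function.Bundles using (_⇔_)

theorem5p6 : (n : ℕ) (w : Permutation′ n) →
    Avoids w p1432 → Avoids w p1423 → Avoids w p13254 →
    -- (1)
    (∀ (α : Exp n) → InSupp (𝔊 w) α → ∣ α ∣ < degree (𝔊 w) →
       Σ (Exp n) λ β → InSupp (𝔊 w) β × (α <ᵥ β) × (∣ β ∣ ≡ suc ∣ α ∣))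
    -- (2)
    × (∀ (α γ : Exp n) (β : Vec ℤ n) → InSupp (𝔊 w) α → InSupp (𝔊 w) γ →
         toℤᵥ α ≤ℤᵥ β → β ≤ℤᵥ toℤᵥ γ → InSuppℤ (𝔊 w) β)
    -- (3)
    × ((∀ (β : Vec ℤ n) → InNewton (𝔊 w) (toℚᵥ β) ⇔ InSuppℤ (𝔊 w) β)
       × IsGenPolymatroid (InNewton (𝔊 w)))
    -- (4)
    × (∀ (β : Exp n) → InSupp (𝔊 w) β → ∣ β ∣ ≡ degree (𝔊 w) →
         foldr _+_ 0ℤ (map (coeff (𝔊 w)) (below β)) ≡ 1ℤ)
theorem5p6 n w no1432 no1423 no13254 =
  supp-increment , supp-interval , (newton-saturated , newton-genPolymatroid) , supp-sum
  where
  open FirstAscents using (oneLine; labels; code)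
  open SupportProperties.ScanSupport (𝔊 w) (labels (oneLine w)) (code (oneLine w))
    (SignedScan.labels-closed (oneLine w))
    (GrothendieckCoefficients.coeff-𝔊 w no1432 no1423 no13254)
  open NewtonPolytopes.NewtonPolytope (𝔊 w) (labels (oneLine w)) (code (oneLine w))
    supp⇒feasible feasible⇒supp
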